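{- Let $n,d\ge1$ be integers. Let $\Lambda_n^{(d)}$ be the $\mathbb{Q}$-vector space of symmetric polynomials in $x_1,\dots,x_n$ whose degree in each variable does not exceed $d$, regarded as an $\mathfrak{sl}_2$-module via $$\mathfrak{e}_+\mapsto\sum_{k=1}^n\Big(-x_k^2\frac{\partial}{\partial x_k}+d\,x_k\Big),\qquad \mathfrak{h}\mapsto 2\sum_{k=1}^n x_k\frac{\partial}{\partial x_k}-nd,\qquad \mathfrak{e}_-\mapsto\sum_{k=1}^n\frac{\partial}{\partial x_k}.$$ Then there is an isomorphism of $\mathfrak{sl}_2$-modules $$\Lambda_n^{(d)}\cong\bigoplus_{i=0}^{nd}c_n(d,i)\,V_i,$$ where $$c_n(d,i)=\gamma\Big(d+n,n,\tfrac12dn-\tfrac12i\Big)-\gamma\Big(d+n,n,\tfrac12dn-\tfrac12i-1\Big),$$ and $\gamma(m,n,j)$ denotes the coefficient of $T^j$ in $$\frac{(1-T^{m-n+1})\cdots(1-T^m)}{(1-T)\cdots(1-T^n)},$$ so that $\gamma(d+n,n,j)$ is the number of partitions of size $j$ inside the $d\times n$ rectangle.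
   Context: $\mathfrak{sl}_2$ has basis $\mathfrak{e}_-,\mathfrak{h},\mathfrak{e}_+$ with $[\mathfrak{h},\mathfrak{e}_+]=2\mathfrak{e}_+$, $[\mathfrak{h},\mathfrak{e}_-]=-2\mathfrak{e}_-$, $[\mathfrak{e}_+,\mathfrak{e}_-]=\mathfrak{h}$; an $\mathfrak{sl}_2$-module is a $\mathbb{Q}$-vector space with three endomorphisms (the images of these basis elements) satisfying these relations. The operators above preserve $\Lambda_n^{(d)}$ and satisfy the relations. $V_i$ denotes the standard irreducible $\mathfrak{sl}_2$-module of dimension $i+1$, with basis $v_0,\dots,v_i$ and action $\mathfrak{e}_+v_j=(i-j)v_{j+1}$, $\mathfrak{h}v_j=(2j-i)v_j$, $\mathfrak{e}_-v_j=j\,v_{j-1}$ (with $v_{ -1}=v_{i+1}=0$). $c\,V_i$ denotes the direct sum of $c$ copies of $V_i$. By convention $\gamma(m,n,j)=0$ when $j$ is negative or not an integer. -}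

module Defs where

open import Algebra.Bundles using (Ring)
open import Algebra.Module.Bundles using (LeftModule)
open import Algebra.Module.Bundles.Raw using (RawLeftModule)
open import Algebra.Module.Morphism.Structures using (module LeftModuleMorphisms; IsLeftModuleMonomorphism)
import Algebra.Module.Construct.TensorUnit as TensorUnit
import Algebra.Module.Morphism.LeftModuleMonomorphism as LeftModuleMonomorphism
import Algebra.Properties.CommutativeMonoid.Sum as CommutativeMonoidSum
import Algebra.Properties.Group as GroupProperties
import Algebra.Properties.Semiring.Sum as SemiringSum
open import Data.Bool using (if_then_else_)
open import Data.Fin using (Fin; zero; suc; toℕ; fromℕ<)
import Data.Fin.Properties as Finₚ
open import Data.Fin.Permutation using (Permutation′; _⟨$⟩ʳ_; _⟨$⟩ˡ_)
import Data.Fin.Permutation as Perm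
open import Data.Integer as ℤ using (ℤ; +_; -[1+_]; 0ℤ; 1ℤ)
import Data.Integer.Properties as ℤₚ
import Data.Integer.Solver as ℤSolver
open import Data.List as List using (List)
open import Data.List.Relation.Unary.All using (All)
open import Data.List.Relation.Unary.Linked using (Linked)
open import Data.Nat as ℕ using (ℕ; zero; suc; pred; _≤_; _<_; _≥_; _∸_; _≡ᵇ_; s≤s; z≤n)
open import Data.Nat.ListAction using (sum)
import Data.Nat.Properties as ℕₚ
open import Data.Product using (_,_)
open import Data.Rational as ℚ using (ℚ; mkℚ; 0ℚ; 1ℚ; ½; _+_; _*_; -_; _-_)
open import Data.Rational.Literals using (fromℤ)
import Data.Rational.Properties as ℚₚ
import Data.Rational.Solver as ℚSolver
import Data.Rational.Unnormalised as ℚᵘ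
import Data.Rational.Unnormalised.Properties as ℚᵘₚ
open import Data.Sum using (_⊎_; inj₁; inj₂)
open import Data.Vec using (Vec; lookup; tabulate; _[_]≔_)
import Data.Vec.Properties as Vecₚ
open import Function using (id; _∘_)
open import Level using (0ℓ)
open import Relation.Binary.PropositionalEquality
open import Relation.Nullary using (yes; no)

fromℕ : ℕ → ℚ
fromℕ k = fromℤ (+ k)

module ℚΣ = SemiringSum (Ring.semiring ℚₚ.+-*-ring)
module ℤΣ = SemiringSum ℤₚ.+-*-semiring

fromℕ-+ : ∀ m n → fromℕ (m ℕ.+ n) ≡ fromℕ m + fromℕ n
fromℕ-+ m n = ℚₚ.toℚᵘ-injective (ℚᵘₚ.≃-trans
  (ℚᵘ.*≡* (cong (ℤ._* 1ℤ) (trans (ℤₚ.pos-+ m n)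
    (sym (cong₂ ℤ._+_ (ℤₚ.*-identityʳ (+ m)) (ℤₚ.*-identityʳ (+ n)))))))
  (ℚᵘₚ.≃-sym (ℚₚ.toℚᵘ-homo-+ (fromℕ m) (fromℕ n))))

fromℕ-suc : ∀ m → fromℕ (suc m) ≡ 1ℚ + fromℕ m
fromℕ-suc = fromℕ-+ 1

fromℕ-* : ∀ m n → fromℕ (m ℕ.* n) ≡ fromℕ m * fromℕ n
fromℕ-* m n = ℚₚ.toℚᵘ-injective (ℚᵘₚ.≃-trans
  (ℚᵘ.*≡* (cong (ℤ._* 1ℤ) (ℤₚ.pos-* m n)))
  (ℚᵘₚ.≃-sym (ℚₚ.toℚᵘ-homo-* (fromℕ m) (fromℕ n))))

VectorSpace : Set₁
VectorSpace = LeftModule ℚₚ.+-*-ring 0ℓ 0ℓ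

module _ (M N : VectorSpace) where
  private
    module M = LeftModule M
    module N = LeftModule N
  open LeftModuleMorphisms M.rawLeftModule N.rawLeftModule

  IsLinear : (M.Carrierᴹ → N.Carrierᴹ) → Set
  IsLinear = IsLeftModuleHomomorphism

  IsLinearIsomorphism : (M.Carrierᴹ → N.Carrierᴹ) → Set
  IsLinearIsomorphism = IsLeftModuleIsomorphism

  linear : (f : M.Carrierᴹ → N.Carrierᴹ) →
           (∀ {u v} → u M.≈ᴹ v → f u N.≈ᴹ f v) →
           (∀ u v → f (u M.+ᴹ v) N.≈ᴹ f u N.+ᴹ f v) →
           (∀ a v → f (a M.*ₗ v) N.≈ᴹ a N.*ₗ f v) →
           IsLinear f
  linear f f-cong f-+ f-* = record
    { +ᴹ-isGroupHomomorphism = record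
      { isMonoidHomomorphism = record
        { isMagmaHomomorphism = record
          { isRelHomomorphism = record { cong = f-cong }
          ; homo = f-+ }
        ; ε-homo = f-0 }
      ; ⁻¹-homo = λ v → inverseˡ-unique (f (M.-ᴹ v)) (f v)
          (N.≈ᴹ-trans (N.≈ᴹ-sym (f-+ (M.-ᴹ v) v))
            (N.≈ᴹ-trans (f-cong (M.-ᴹ‿inverseˡ v)) f-0)) }
    ; *ₗ-homo = f-* }
    where
    open GroupProperties N.+ᴹ-group using (inverseˡ-unique)
    f-0 : f M.0ᴹ N.≈ᴹ N.0ᴹ
    f-0 = N.≈ᴹ-trans (f-cong (M.≈ᴹ-sym (M.*ₗ-zeroˡ M.0ᴹ)))
            (N.≈ᴹ-trans (f-* 0ℚ M.0ᴹ) (N.*ₗ-zeroˡ (f M.0ᴹ)))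

-- Pointwise structure on a product of vector spaces.  For a finite index
-- set this is their direct sum.
Π : (I : Set) → (I → VectorSpace) → VectorSpace
Π I M = record
  { Carrierᴹ = ∀ i → Carrierᴹ (M i)
  ; _≈ᴹ_ = λ u v → ∀ i → _≈ᴹ_ (M i) (u i) (v i)
  ; _+ᴹ_ = λ u v i → _+ᴹ_ (M i) (u i) (v i)
  ; _*ₗ_ = λ a v i → _*ₗ_ (M i) a (v i)
  ; 0ᴹ = λ i → 0ᴹ (M i)
  ; -ᴹ_ = λ v i → -ᴹ_ (M i) (v i)
  ; isLeftModule = record
    { isLeftSemimodule = record
      { +ᴹ-isCommutativeMonoid = record
        { isMonoid = record
          { isSemigroup = record
            { isMagma = record
              { isEquivalence = record
                { refl = λ i → ≈ᴹ-refl (M i)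
                ; sym = λ p i → ≈ᴹ-sym (M i) (p i)
                ; trans = λ p q i → ≈ᴹ-trans (M i) (p i) (q i) }
              ; ∙-cong = λ p q i → +ᴹ-cong (M i) (p i) (q i) }
            ; assoc = λ u v w i → +ᴹ-assoc (M i) (u i) (v i) (w i) }
          ; identity = (λ u i → +ᴹ-identityˡ (M i) (u i))
                     , (λ u i → +ᴹ-identityʳ (M i) (u i)) }
        ; comm = λ u v i → +ᴹ-comm (M i) (u i) (v i) }
      ; isPreleftSemimodule = record
        { *ₗ-cong = λ p q i → *ₗ-cong (M i) p (q i)
        ; *ₗ-zeroˡ = λ u i → *ₗ-zeroˡ (M i) (u i)
        ; *ₗ-distribʳ = λ u a b i → *ₗ-distribʳ (M i) (u i) a b
        ; *ₗ-identityˡ = λ u i → *ₗ-identityˡ (M i) (u i)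
        ; *ₗ-assoc = λ a b u i → *ₗ-assoc (M i) a b (u i)
        ; *ₗ-zeroʳ = λ a i → *ₗ-zeroʳ (M i) a
        ; *ₗ-distribˡ = λ a u v i → *ₗ-distribˡ (M i) a (u i) (v i) } }
    ; -ᴹ‿cong = λ p i → -ᴹ‿cong (M i) (p i)
    ; -ᴹ‿inverse = (λ u i → -ᴹ‿inverseˡ (M i) (u i))
                 , (λ u i → -ᴹ‿inverseʳ (M i) (u i)) } }
  where open LeftModule

infixl 8 _^_
_^_ : VectorSpace → Set → VectorSpace
M ^ I = Π I (λ _ → M)

ℚ¹ : VectorSpace
ℚ¹ = TensorUnit.leftModule

-- Elements of A are identified when their images in N are equal, so this is
-- the subspace of N formed by the image of ⟦_⟧.
module _ (N : VectorSpace) where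
  private module N = LeftModule N

  induced : {A : Set} (⟦_⟧ : A → N.Carrierᴹ)
            (_⊕_ : A → A → A) (_⊙_ : ℚ → A → A) (𝟘 : A) (⊖_ : A → A) →
            (∀ u v → ⟦ u ⊕ v ⟧ N.≈ᴹ ⟦ u ⟧ N.+ᴹ ⟦ v ⟧) →
            (∀ a v → ⟦ a ⊙ v ⟧ N.≈ᴹ a N.*ₗ ⟦ v ⟧) →
            ⟦ 𝟘 ⟧ N.≈ᴹ N.0ᴹ →
            (∀ v → ⟦ ⊖ v ⟧ N.≈ᴹ N.-ᴹ ⟦ v ⟧) →
            VectorSpace
  induced ⟦_⟧ _⊕_ _⊙_ 𝟘 ⊖_ ⊕-homo ⊙-homo 𝟘-homo ⊖-homo = record
    { _≈ᴹ_ = λ u v → ⟦ u ⟧ N.≈ᴹ ⟦ v ⟧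
    ; _+ᴹ_ = _⊕_ ; _*ₗ_ = _⊙_ ; 0ᴹ = 𝟘 ; -ᴹ_ = ⊖_
    ; isLeftModule = isLeftModule ℚₚ.+-*-isRing N.isLeftModule }
    where
    inducedRaw : RawLeftModule ℚ 0ℓ 0ℓ
    inducedRaw = record
      { _≈ᴹ_ = λ u v → ⟦ u ⟧ N.≈ᴹ ⟦ v ⟧
      ; _+ᴹ_ = _⊕_ ; _*ₗ_ = _⊙_ ; 0ᴹ = 𝟘 ; -ᴹ_ = ⊖_ }

    isMonomorphism : IsLeftModuleMonomorphism inducedRaw N.rawLeftModule ⟦_⟧
    isMonomorphism = record
      { isLeftModuleHomomorphism = record
        { +ᴹ-isGroupHomomorphism = record
          { isMonoidHomomorphism = record
            { isMagmaHomomorphism = record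
              { isRelHomomorphism = record { cong = id }
              ; homo = ⊕-homo }
            ; ε-homo = 𝟘-homo }
          ; ⁻¹-homo = ⊖-homo }
        ; *ₗ-homo = ⊙-homo }
      ; injective = id }

    open LeftModuleMonomorphism isMonomorphism using (isLeftModule)

record SL2Module : Set₁ where
  field vectorSpace : VectorSpace
  open LeftModule vectorSpace public
  field
    e₋ h e₊ : Carrierᴹ → Carrierᴹ
    e₋-linear : IsLinear vectorSpace vectorSpace e₋
    h-linear  : IsLinear vectorSpace vectorSpace h
    e₊-linear : IsLinear vectorSpace vectorSpace e₊
    [h,e₊] : ∀ v → h (e₊ v) +ᴹ -ᴹ e₊ (h v) ≈ᴹ fromℕ 2 *ₗ e₊ v
    [h,e₋] : ∀ v → h (e₋ v) +ᴹ -ᴹ e₋ (h v) ≈ᴹ (- fromℕ 2) *ₗ e₋ v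
    [e₊,e₋] : ∀ v → e₊ (e₋ v) +ᴹ -ᴹ e₋ (e₊ v) ≈ᴹ h v

infix 4 _≅_
record _≅_ (M N : SL2Module) : Set where
  private
    module M = SL2Module M
    module N = SL2Module N
  field
    to : M.Carrierᴹ → N.Carrierᴹ
    isLinearIsomorphism : IsLinearIsomorphism M.vectorSpace N.vectorSpace to
    to-e₋ : ∀ v → to (M.e₋ v) N.≈ᴹ N.e₋ (to v)
    to-h  : ∀ v → to (M.h v) N.≈ᴹ N.h (to v)
    to-e₊ : ∀ v → to (M.e₊ v) N.≈ᴹ N.e₊ (to v)

⨁ : ∀ {N} → (Fin N → SL2Module) → SL2Module
⨁ {N} M = record
  { vectorSpace = ⨁M
  ; e₋ = λ v i → e₋ (M i) (v i)
  ; h = λ v i → h (M i) (v i)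
  ; e₊ = λ v i → e₊ (M i) (v i)
  ; e₋-linear = pointwise (λ i → e₋ (M i)) (λ i → e₋-linear (M i))
  ; h-linear = pointwise (λ i → h (M i)) (λ i → h-linear (M i))
  ; e₊-linear = pointwise (λ i → e₊ (M i)) (λ i → e₊-linear (M i))
  ; [h,e₊] = λ v i → [h,e₊] (M i) (v i)
  ; [h,e₋] = λ v i → [h,e₋] (M i) (v i)
  ; [e₊,e₋] = λ v i → [e₊,e₋] (M i) (v i) }
  where
  open SL2Module
  ⨁M = Π (Fin N) (vectorSpace ∘ M)
  pointwise : (f : ∀ i → Carrierᴹ (M i) → Carrierᴹ (M i)) →
              (∀ i → IsLinear (vectorSpace (M i)) (vectorSpace (M i)) (f i)) →
              IsLinear ⨁M ⨁M (λ v i → f i (v i))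
  pointwise f f-linear = linear ⨁M ⨁M (λ v i → f i (v i))
    (λ p i → ⟦⟧-cong (f-linear i) (p i))
    (λ u v i → +ᴹ-homo (f-linear i) (u i) (v i))
    (λ a v i → *ₗ-homo (f-linear i) a (v i))
    where open LeftModuleMorphisms.IsLeftModuleHomomorphism

infixr 7 _·_
_·_ : ℕ → SL2Module → SL2Module
c · M = ⨁ {c} (λ _ → M)

δ : ℕ → ℕ → ℚ
δ m k = if m ≡ᵇ k then 1ℚ else 0ℚ

∑-zero : ∀ {n} (f : Fin n → ℚ) → (∀ k → f k ≡ 0ℚ) → ℚΣ.sum f ≡ 0ℚ
∑-zero {n} f f≡0 = trans (ℚΣ.sum-cong-≋ f≡0) (ℚΣ.sum-replicate-zero n)

δ-in : ∀ {n} (l : Fin n) (f : Fin n → ℚ) →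
       ℚΣ.sum (λ j → δ (toℕ l) (toℕ j) * f j) ≡ f l
δ-in zero f = trans
  (cong₂ _+_ (ℚₚ.*-identityˡ (f zero))
    (∑-zero (λ j → 0ℚ * f (suc j)) (λ j → ℚₚ.*-zeroˡ (f (suc j)))))
  (ℚₚ.+-identityʳ (f zero))
δ-in (suc l) f = trans
  (cong₂ _+_ (ℚₚ.*-zeroˡ (f zero)) (δ-in l (f ∘ suc)))
  (ℚₚ.+-identityˡ (f (suc l)))

module Standard (i : ℕ) where

  space : VectorSpace
  space = ℚ¹ ^ Fin (suc i)

  open LeftModule space public

  -- v j = 0 for j > i
  v : ℕ → Carrierᴹ
  v j k = if j ≡ᵇ toℕ k then 1ℚ else 0ℚ

  e₊v hv e₋v : ℕ → Carrierᴹ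
  e₊v j = (fromℕ i - fromℕ j) *ₗ v (suc j)
  hv j = (fromℕ 2 * fromℕ j - fromℕ i) *ₗ v j
  e₋v zero = 0ᴹ
  e₋v (suc j) = fromℕ (suc j) *ₗ v j

  extend : (ℕ → Carrierᴹ) → Carrierᴹ → Carrierᴹ
  extend F a k = ℚΣ.sum (λ j → a j * F (toℕ j) k)

  extend-linear : ∀ F → IsLinear space space (extend F)
  extend-linear F = linear space space (extend F)
    (λ p k → ℚΣ.sum-cong-≋ (λ j → cong (_* F (toℕ j) k) (p j)))
    (λ a b k → trans
      (ℚΣ.sum-cong-≋ (λ j → ℚₚ.*-distribʳ-+ (F (toℕ j) k) (a j) (b j)))
      (ℚΣ.∑-distrib-+ (λ j → a j * F (toℕ j) k) (λ j → b j * F (toℕ j) k)))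
    (λ c a k → trans
      (ℚΣ.sum-cong-≋ (λ j → ℚₚ.*-assoc c (a j) (F (toℕ j) k)))
      (sym (ℚΣ.*-distribˡ-sum c (λ j → a j * F (toℕ j) k))))

  extend-v : ∀ F {j} → j ≤ i → extend F (v j) ≈ᴹ F j
  extend-v F {j} j≤i k =
    subst (λ m → extend F (v m) k ≡ F m k) (Finₚ.toℕ-fromℕ< (s≤s j≤i))
      (δ-in (fromℕ< (s≤s j≤i)) (λ l → F (toℕ l) k))

  extend-*v : ∀ F c m k → m ≤ i ⊎ c ≡ 0ℚ →
              extend F (c *ₗ v m) k ≡ c * F m k
  extend-*v F c m k c*Fm = trans
    (trans (ℚΣ.sum-cong-≋ (λ j → ℚₚ.*-assoc c (v m j) (F (toℕ j) k)))
      (sym (ℚΣ.*-distribˡ-sum c (λ j → v m j * F (toℕ j) k))))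
    (go c*Fm)
    where
    go : m ≤ i ⊎ c ≡ 0ℚ → c * extend F (v m) k ≡ c * F m k
    go (inj₁ m≤i) = cong (c *_) (extend-v F m≤i k)
    go (inj₂ refl) = trans (ℚₚ.*-zeroˡ (extend F (v m) k)) (sym (ℚₚ.*-zeroˡ (F m k)))

  extend-extend : ∀ F G a k →
    extend F (extend G a) k ≡ ℚΣ.sum (λ j → a j * extend F (G (toℕ j)) k)
  extend-extend F G a k = begin
    ℚΣ.sum (λ l → ℚΣ.sum (λ j → a j * G (toℕ j) l) * F (toℕ l) k)
      ≡⟨ ℚΣ.sum-cong-≋ (λ l → trans
           (ℚΣ.*-distribʳ-sum (F (toℕ l) k) (λ j → a j * G (toℕ j) l))
           (ℚΣ.sum-cong-≋ (λ j → ℚₚ.*-assoc (a j) (G (toℕ j) l) (F (toℕ l) k)))) ⟩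
    ℚΣ.sum (λ l → ℚΣ.sum (λ j → a j * (G (toℕ j) l * F (toℕ l) k)))
      ≡⟨ ℚΣ.∑-comm (λ l j → a j * (G (toℕ j) l * F (toℕ l) k)) ⟩
    ℚΣ.sum (λ j → ℚΣ.sum (λ l → a j * (G (toℕ j) l * F (toℕ l) k)))
      ≡⟨ ℚΣ.sum-cong-≋ (λ j → sym
           (ℚΣ.*-distribˡ-sum (a j) (λ l → G (toℕ j) l * F (toℕ l) k))) ⟩
    ℚΣ.sum (λ j → a j * extend F (G (toℕ j)) k) ∎
    where open ≡-Reasoning

  commutator : ∀ F G H c →
    (∀ {j} → j ≤ i → ∀ k → extend F (G j) k - extend G (F j) k ≡ c * H j k) →
    ∀ a → extend F (extend G a) +ᴹ -ᴹ extend G (extend F a) ≈ᴹ c *ₗ extend H a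
  commutator F G H c [F,G] a k = begin
    extend F (extend G a) k - extend G (extend F a) k
      ≡⟨ cong₂ _-_ (extend-extend F G a k) (extend-extend G F a k) ⟩
    ℚΣ.sum (λ j → a j * FG j) - ℚΣ.sum (λ j → a j * GF j)
      ≡⟨ cong (λ x → ℚΣ.sum (λ j → a j * FG j) + x) (trans
           (solve 1 (λ x → :- x := con (- 1ℚ) :* x) refl (ℚΣ.sum (λ j → a j * GF j)))
           (ℚΣ.*-distribˡ-sum (- 1ℚ) (λ j → a j * GF j))) ⟩
    ℚΣ.sum (λ j → a j * FG j) + ℚΣ.sum (λ j → - 1ℚ * (a j * GF j))
      ≡⟨ ℚΣ.∑-distrib-+ (λ j → a j * FG j) (λ j → - 1ℚ * (a j * GF j)) ⟨
    ℚΣ.sum (λ j → a j * FG j + - 1ℚ * (a j * GF j))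
      ≡⟨ ℚΣ.sum-cong-≋ (λ j → trans
           (solve 3 (λ x y z → x :* y :+ con (- 1ℚ) :* (x :* z) := x :* (y :- z)) refl
             (a j) (FG j) (GF j))
           (trans (cong (a j *_) ([F,G] (ℕₚ.≤-pred (Finₚ.toℕ<n j)) k))
             (solve 3 (λ x y z → x :* (y :* z) := y :* (x :* z)) refl
               (a j) c (H (toℕ j) k)))) ⟩
    ℚΣ.sum (λ j → c * (a j * H (toℕ j) k))
      ≡⟨ ℚΣ.*-distribˡ-sum c (λ j → a j * H (toℕ j) k) ⟨
    c * extend H a k ∎
    where
    open ≡-Reasoning
    open ℚSolver.+-*-Solver
    FG GF : Fin (suc i) → ℚ
    FG j = extend F (G (toℕ j)) k
    GF j = extend G (F (toℕ j)) k

  -- The image under F of e₊v j, also when j = i.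
  extend-e₊v : ∀ F {j} → j ≤ i → ∀ k →
               extend F (e₊v j) k ≡ (fromℕ i - fromℕ j) * F (suc j) k
  extend-e₊v F {j} j≤i k with ℕₚ.m≤n⇒m<n∨m≡n j≤i
  ... | inj₁ j<i = extend-*v F (fromℕ i - fromℕ j) (suc j) k (inj₁ j<i)
  ... | inj₂ refl = extend-*v F (fromℕ i - fromℕ i) (suc j) k (inj₂ (ℚₚ.+-inverseʳ (fromℕ i)))

  extend-0 : ∀ F k → extend F 0ᴹ k ≡ 0ℚ
  extend-0 F k = ∑-zero {suc i} (λ j → 0ℚ * F (toℕ j) k) (λ j → ℚₚ.*-zeroˡ (F (toℕ j) k))

  -- The identities are stated for variables because terms such as
  -- fromℕ 2 * fromℕ j do not stay folded under normalisation.
  h-e₊ : ∀ n m m′ x → m′ ≡ 1ℚ + m →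
         (n - m) * ((fromℕ 2 * m′ - n) * x) - (fromℕ 2 * m - n) * ((n - m) * x)
         ≡ fromℕ 2 * ((n - m) * x)
  h-e₊ n m _ x refl = solve 3 (λ n m x →
      (n :- m) :* ((con (fromℕ 2) :* (con 1ℚ :+ m) :- n) :* x)
        :- (con (fromℕ 2) :* m :- n) :* ((n :- m) :* x)
      := con (fromℕ 2) :* ((n :- m) :* x)) refl n m x
    where open ℚSolver.+-*-Solver

  h-e₋ : ∀ n m m′ x → m′ ≡ 1ℚ + m →
         m′ * ((fromℕ 2 * m - n) * x) - (fromℕ 2 * m′ - n) * (m′ * x)
         ≡ - fromℕ 2 * (m′ * x)
  h-e₋ n m _ x refl = solve 3 (λ n m x →
      (con 1ℚ :+ m) :* ((con (fromℕ 2) :* m :- n) :* x)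
        :- (con (fromℕ 2) :* (con 1ℚ :+ m) :- n) :* ((con 1ℚ :+ m) :* x)
      := con (- fromℕ 2) :* ((con 1ℚ :+ m) :* x)) refl n m x
    where open ℚSolver.+-*-Solver

  e₊-e₋ : ∀ n m m′ m″ x → m′ ≡ 1ℚ + m → m″ ≡ 1ℚ + m′ →
          m′ * ((n - m) * x) - (n - m′) * (m″ * x)
          ≡ 1ℚ * ((fromℕ 2 * m′ - n) * x)
  e₊-e₋ n m _ _ x refl refl = solve 3 (λ n m x →
      (con 1ℚ :+ m) :* ((n :- m) :* x)
        :- (n :- (con 1ℚ :+ m)) :* ((con 1ℚ :+ (con 1ℚ :+ m)) :* x)
      := con 1ℚ :* ((con (fromℕ 2) :* (con 1ℚ :+ m) :- n) :* x)) refl n m x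
    where open ℚSolver.+-*-Solver

  [h,e₊]v : ∀ {j} → j ≤ i → ∀ k →
            extend hv (e₊v j) k - extend e₊v (hv j) k ≡ fromℕ 2 * e₊v j k
  [h,e₊]v {j} j≤i k = trans
    (cong₂ _-_ (extend-e₊v hv j≤i k)
               (extend-*v e₊v (fromℕ 2 * fromℕ j - fromℕ i) j k (inj₁ j≤i)))
    (h-e₊ (fromℕ i) (fromℕ j) (fromℕ (suc j)) (v (suc j) k) (fromℕ-suc j))

  [h,e₋]v : ∀ {j} → j ≤ i → ∀ k →
            extend hv (e₋v j) k - extend e₋v (hv j) k ≡ - fromℕ 2 * e₋v j k
  [h,e₋]v {zero} _ k = cong₂ _-_ (extend-0 hv k) (trans
    (extend-*v e₋v (fromℕ 2 * fromℕ 0 - fromℕ i) 0 k (inj₁ z≤n))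
    (ℚₚ.*-zeroʳ (fromℕ 2 * fromℕ 0 - fromℕ i)))
  [h,e₋]v {suc j} j<i k = trans
    (cong₂ _-_
      (extend-*v hv (fromℕ (suc j)) j k (inj₁ (ℕₚ.<⇒≤ j<i)))
      (extend-*v e₋v (fromℕ 2 * fromℕ (suc j) - fromℕ i) (suc j) k (inj₁ j<i)))
    (h-e₋ (fromℕ i) (fromℕ j) (fromℕ (suc j)) (v j k) (fromℕ-suc j))

  [e₊,e₋]v : ∀ {j} → j ≤ i → ∀ k →
             extend e₊v (e₋v j) k - extend e₋v (e₊v j) k ≡ 1ℚ * hv j k
  [e₊,e₋]v {zero} _ k = trans
    (cong₂ _-_ (extend-0 e₊v k) (extend-e₊v e₋v z≤n k))
    (solve 2 (λ n x →
      con 0ℚ :- (n :- con 0ℚ) :* (con 1ℚ :* x)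
      := con 1ℚ :* ((con (fromℕ 2) :* con 0ℚ :- n) :* x)) refl (fromℕ i) (v 0 k))
    where open ℚSolver.+-*-Solver
  [e₊,e₋]v {suc j} j<i k = trans
    (cong₂ _-_ (extend-*v e₊v (fromℕ (suc j)) j k (inj₁ (ℕₚ.<⇒≤ j<i)))
               (extend-e₊v e₋v j<i k))
    (e₊-e₋ (fromℕ i) (fromℕ j) (fromℕ (suc j)) (fromℕ (suc (suc j))) (v (suc j) k)
      (fromℕ-suc j) (fromℕ-suc (suc j)))

  V : SL2Module
  V = record
    { vectorSpace = space
    ; e₋ = extend e₋v ; h = extend hv ; e₊ = extend e₊v
    ; e₋-linear = extend-linear e₋v
    ; h-linear = extend-linear hv
    ; e₊-linear = extend-linear e₊v
    ; [h,e₊] = commutator hv e₊v e₊v (fromℕ 2) [h,e₊]v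
    ; [h,e₋] = commutator hv e₋v e₋v (- fromℕ 2) [h,e₋]v
    ; [e₊,e₋] = λ a k → trans (commutator e₊v e₋v hv 1ℚ [e₊,e₋]v a k)
                              (ℚₚ.*-identityˡ (extend hv a k)) }

open Standard public using (V)

-- A polynomial in n variables is a finitely supported family of coefficients
-- indexed by exponent vectors; finite support is a bound on all exponents.
Coefficients : ℕ → Set
Coefficients n = Vec ℕ n → ℚ

DegreesAtMost : ∀ {n} → ℕ → Coefficients n → Set
DegreesAtMost d c = ∀ α k → d < lookup α k → c α ≡ 0ℚ

record Polynomial (n : ℕ) : Set where
  field
    coeff   : Coefficients n
    bound   : ℕ
    bounded : DegreesAtMost bound coeff
open Polynomial public

permute : ∀ {n} → Permutation′ n → Vec ℕ n → Vec ℕ n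
permute σ α = tabulate (λ k → lookup α (σ ⟨$⟩ʳ k))

Symmetric : ∀ {n} → Coefficients n → Set
Symmetric {n} c = ∀ (σ : Permutation′ n) α → c (permute σ α) ≡ c α

DegreesAtMost-mono : ∀ {n d d′} {c : Coefficients n} → d ≤ d′ →
                     DegreesAtMost d c → DegreesAtMost d′ c
DegreesAtMost-mono d≤d′ deg α k d′<αk = deg α k (ℕₚ.≤-<-trans d≤d′ d′<αk)

x₁ ∂₁ : (ℕ → ℚ) → ℕ → ℚ
x₁ g zero = 0ℚ
x₁ g (suc m) = g m
∂₁ g m = fromℕ (suc m) * g (suc m)

-- Apply an operation on coefficient sequences in one variable to the k-th
-- variable.
along : ∀ {n} → Fin n → ((ℕ → ℚ) → ℕ → ℚ) → Coefficients n → Coefficients n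
along k T c α = T (λ m → c (α [ k ]≔ m)) (lookup α k)

at-updated : ∀ {n d} {c : Coefficients n} → DegreesAtMost d c →
             ∀ α k {m} → d < m → c (α [ k ]≔ m) ≡ 0ℚ
at-updated deg α k {m} d<m = deg (α [ k ]≔ m) k
  (subst (_ <_) (sym (Vecₚ.lookup∘update k α m)) d<m)

at-other : ∀ {n d} {c : Coefficients n} → DegreesAtMost d c →
           ∀ α {k l} → l ≢ k → d < lookup α l → ∀ m → c (α [ k ]≔ m) ≡ 0ℚ
at-other deg α {k} {l} l≢k d<αl m = deg (α [ k ]≔ m) l
  (subst (_ <_) (sym (Vecₚ.lookup∘update′ l≢k α m)) d<αl)

x₁-zero : ∀ g m → (∀ j → g j ≡ 0ℚ) → x₁ g m ≡ 0ℚ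
x₁-zero g zero _ = refl
x₁-zero g (suc m) g≡0 = g≡0 m

x₁-bounded : ∀ {d} g → (∀ {j} → d < j → g j ≡ 0ℚ) →
             ∀ {m} → suc d < m → x₁ g m ≡ 0ℚ
x₁-bounded g g≡0 {suc m} (s≤s d<m) = g≡0 d<m

x-bounded : ∀ {n d} k (c : Coefficients n) → DegreesAtMost d c →
            DegreesAtMost (suc d) (along k x₁ c)
x-bounded {d = d} k c deg α l d<αl with l Finₚ.≟ k
... | yes refl = x₁-bounded (λ m → c (α [ k ]≔ m)) (at-updated deg α k) d<αl
... | no l≢k = x₁-zero (λ m → c (α [ k ]≔ m)) (lookup α k)
                 (at-other deg α l≢k (ℕₚ.<-trans (ℕₚ.n<1+n d) d<αl))

∂-bounded : ∀ {n d} k (c : Coefficients n) → DegreesAtMost d c →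
            DegreesAtMost d (along k ∂₁ c)
∂-bounded k c deg α l d<αl with l Finₚ.≟ k
... | yes refl = trans
        (cong (fromℕ (suc (lookup α k)) *_) (at-updated deg α k (ℕₚ.m≤n⇒m≤1+n d<αl)))
        (ℚₚ.*-zeroʳ (fromℕ (suc (lookup α k))))
... | no l≢k = trans
        (cong (fromℕ (suc (lookup α k)) *_) (at-other deg α l≢k d<αl _))
        (ℚₚ.*-zeroʳ (fromℕ (suc (lookup α k))))

module _ {n : ℕ} where

  -- x k p is x_k · p.
  x : Fin n → Polynomial n → Polynomial n
  x k p = record
    { coeff = along k x₁ (coeff p)
    ; bound = suc (bound p)
    ; bounded = x-bounded k (coeff p) (bounded p) }

  ∂ : Fin n → Polynomial n → Polynomial n
  ∂ k p = record
    { coeff = along k ∂₁ (coeff p)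
    ; bound = bound p
    ; bounded = ∂-bounded k (coeff p) (bounded p) }

ℚ[x] : ℕ → VectorSpace
ℚ[x] n = induced (ℚ¹ ^ Vec ℕ n) coeff
  (λ p q → record
    { coeff = λ α → coeff p α + coeff q α
    ; bound = bound p ℕ.⊔ bound q
    ; bounded = λ α k b<αk → trans
        (cong₂ _+_
          (DegreesAtMost-mono {c = coeff p} (ℕₚ.m≤m⊔n (bound p) (bound q)) (bounded p) α k b<αk)
          (DegreesAtMost-mono {c = coeff q} (ℕₚ.m≤n⊔m (bound p) (bound q)) (bounded q) α k b<αk))
        (ℚₚ.+-identityʳ 0ℚ) })
  (λ a p → record
    { coeff = λ α → a * coeff p α
    ; bound = bound p
    ; bounded = λ α k b<αk → trans (cong (a *_) (bounded p α k b<αk)) (ℚₚ.*-zeroʳ a) })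
  (record { coeff = λ _ → 0ℚ ; bound = 0 ; bounded = λ _ _ _ → refl })
  (λ p → record
    { coeff = λ α → - coeff p α
    ; bound = bound p
    ; bounded = λ α k b<αk → cong -_ (bounded p α k b<αk) })
  (λ _ _ _ → refl) (λ _ _ _ → refl) (λ _ → refl) (λ _ _ → refl)

module Operators (n d : ℕ) where
  open LeftModule (ℚ[x] n)
  open CommutativeMonoidSum +ᴹ-commutativeMonoid using () renaming (sum to ∑)

  E₊ H E₋ : Polynomial n → Polynomial n
  E₊ p = ∑ (λ k → -ᴹ x k (x k (∂ k p)) +ᴹ fromℕ d *ₗ x k p)
  H p = fromℕ 2 *ₗ ∑ (λ k → x k (∂ k p)) +ᴹ -ᴹ (fromℕ (n ℕ.* d) *ₗ p)
  E₋ p = ∑ (λ k → ∂ k p)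

-- Each operator is a sum over the variables of operators sending the
-- coefficient of x_k^m to a multiple of the coefficient of x_k^(s m).
record Weighted : Set where
  constructor _·[_]
  field
    weight : ℕ → ℚ
    source : ℕ → ℕ

open Weighted

one : Weighted → (ℕ → ℚ) → ℕ → ℚ
one W g m = weight W m * g (source W m)

total : ∀ {n} → Weighted → Coefficients n → Coefficients n
total W c α = ℚΣ.sum (λ k → along k (one W) c α)

total-cong : ∀ {n} W {c c′ : Coefficients n} → c ≗ c′ → total W c ≗ total W c′
total-cong W c≗c′ α = ℚΣ.sum-cong-≋ (λ k → cong (weight W (lookup α k) *_) (c≗c′ _))

total-+ : ∀ {n} W (c c′ : Coefficients n) α →
          total W (λ β → c β + c′ β) α ≡ total W c α + total W c′ α
total-+ W c c′ α = trans
  (ℚΣ.sum-cong-≋ (λ k → ℚₚ.*-distribˡ-+ (weight W (lookup α k)) _ _))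
  (ℚΣ.∑-distrib-+ (λ k → along k (one W) c α) (λ k → along k (one W) c′ α))

total-* : ∀ {n} W a (c : Coefficients n) α →
          total W (λ β → a * c β) α ≡ a * total W c α
total-* W a c α = trans
  (ℚΣ.sum-cong-≋ (λ k → swap (weight W (lookup α k)) a _))
  (sym (ℚΣ.*-distribˡ-sum a (λ k → along k (one W) c α)))
  where
  open ℚSolver.+-*-Solver
  swap : ∀ p q r → p * (q * r) ≡ q * (p * r)
  swap = solve 3 (λ p q r → p :* (q :* r) := q :* (p :* r)) refl

total-symmetric : ∀ {n} W (c : Coefficients n) → Symmetric c → Symmetric (total W c)
total-symmetric W c c-sym σ α = trans
  (ℚΣ.sum-cong-≋ (λ k → term k))
  (sym (ℚΣ.sum-permute (λ k → along k (one W) c α) σ))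
  where
  lookup-permute : ∀ k → lookup (permute σ α) k ≡ lookup α (σ ⟨$⟩ʳ k)
  lookup-permute k = Vecₚ.lookup∘tabulate (λ j → lookup α (σ ⟨$⟩ʳ j)) k

  σ-injective : ∀ {j k} → σ ⟨$⟩ʳ j ≡ σ ⟨$⟩ʳ k → j ≡ k
  σ-injective {j} {k} eq =
    trans (sym (Perm.inverseˡ σ)) (trans (cong (σ ⟨$⟩ˡ_) eq) (Perm.inverseˡ σ))

  update-permute : ∀ k m → permute σ α [ k ]≔ m ≡ permute σ (α [ σ ⟨$⟩ʳ k ]≔ m)
  update-permute k m = trans
    (sym (Vecₚ.tabulate∘lookup (permute σ α [ k ]≔ m)))
    (Vecₚ.tabulate-cong at)
    where
    at : ∀ j → lookup (permute σ α [ k ]≔ m) j ≡ lookup (α [ σ ⟨$⟩ʳ k ]≔ m) (σ ⟨$⟩ʳ j)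
    at j with j Finₚ.≟ k
    ... | yes refl = trans (Vecₚ.lookup∘update k (permute σ α) m)
                           (sym (Vecₚ.lookup∘update (σ ⟨$⟩ʳ k) α m))
    ... | no j≢k = trans (Vecₚ.lookup∘update′ j≢k (permute σ α) m)
                     (trans (lookup-permute j)
                       (sym (Vecₚ.lookup∘update′ (j≢k ∘ σ-injective) α m)))

  term : ∀ k → along k (one W) c (permute σ α) ≡ along (σ ⟨$⟩ʳ k) (one W) c α
  term k = trans
    (cong (λ m → weight W m * c (permute σ α [ k ]≔ source W m)) (lookup-permute k))
    (cong (weight W (lookup α (σ ⟨$⟩ʳ k)) *_)
      (trans (cong c (update-permute k (source W (lookup α (σ ⟨$⟩ʳ k)))))
        (c-sym σ (α [ σ ⟨$⟩ʳ k ]≔ source W (lookup α (σ ⟨$⟩ʳ k))))))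

Preserves : ℕ → Weighted → Set
Preserves d W = ∀ m → d < m → weight W m ≡ 0ℚ ⊎ d < source W m

total-bounded : ∀ {n d} W → Preserves d W → (c : Coefficients n) →
                DegreesAtMost d c → DegreesAtMost d (total W c)
total-bounded {d = d} W W-preserves c deg α l d<αl = ∑-zero (λ k → along k (one W) c α) term
  where
  term : ∀ k → along k (one W) c α ≡ 0ℚ
  term k with l Finₚ.≟ k
  ... | no l≢k = trans
          (cong (weight W (lookup α k) *_) (at-other deg α l≢k d<αl _))
          (ℚₚ.*-zeroʳ (weight W (lookup α k)))
  ... | yes refl with W-preserves (lookup α k) d<αl
  ...   | inj₁ w≡0 = trans (cong (_* c (α [ k ]≔ source W (lookup α k))) w≡0)
                           (ℚₚ.*-zeroˡ (c (α [ k ]≔ source W (lookup α k))))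
  ...   | inj₂ d<s = trans (cong (weight W (lookup α k) *_) (at-updated deg α k d<s))
                           (ℚₚ.*-zeroʳ (weight W (lookup α k)))

-- Operators in different variables commute, so a commutator of totals
-- reduces to the commutator in one variable.
total-commutator : ∀ W W′ a W″ →
  (∀ g m → one W (one W′ g) m - one W′ (one W g) m ≡ a * one W″ g m) →
  ∀ {n} (c : Coefficients n) α →
  total W (total W′ c) α - total W′ (total W c) α ≡ a * total W″ c α
total-commutator W W′ a W″ [W,W′] {n} c α = begin
  total W (total W′ c) α - total W′ (total W c) α
    ≡⟨ cong₂ _-_ (expand W W′) (trans (expand W′ W) (ℚΣ.∑-comm (λ l k → P W′ W l k))) ⟩
  ℚΣ.sum (λ k → ℚΣ.sum (P W W′ k)) - ℚΣ.sum (λ k → ℚΣ.sum (λ l → P W′ W l k))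
    ≡⟨ sum-- (λ k → ℚΣ.sum (P W W′ k)) (λ k → ℚΣ.sum (λ l → P W′ W l k)) ⟩
  ℚΣ.sum (λ k → ℚΣ.sum (P W W′ k) - ℚΣ.sum (λ l → P W′ W l k))
    ≡⟨ ℚΣ.sum-cong-≋ (λ k → trans (sum-- (P W W′ k) (λ l → P W′ W l k)) (diagonal k)) ⟩
  ℚΣ.sum (λ k → a * along k (one W″) c α)
    ≡⟨ ℚΣ.*-distribˡ-sum a (λ k → along k (one W″) c α) ⟨
  a * total W″ c α ∎
  where
  open ≡-Reasoning
  open ℚSolver.+-*-Solver

  P : Weighted → Weighted → Fin n → Fin n → ℚ
  P W W′ k l = along k (one W) (along l (one W′) c) α

  expand : ∀ W W′ → total W (total W′ c) α ≡ ℚΣ.sum (λ k → ℚΣ.sum (P W W′ k))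
  expand W W′ = ℚΣ.sum-cong-≋ (λ k → ℚΣ.*-distribˡ-sum (weight W (lookup α k))
    (λ l → along l (one W′) c (α [ k ]≔ source W (lookup α k))))

  sum-- : ∀ {N} (f g : Fin N → ℚ) →
          ℚΣ.sum f - ℚΣ.sum g ≡ ℚΣ.sum (λ k → f k - g k)
  sum-- {zero} f g = refl
  sum-- {suc N} f g = trans
    (solve 4 (λ f₀ f₁ g₀ g₁ → (f₀ :+ f₁) :- (g₀ :+ g₁) := (f₀ :- g₀) :+ (f₁ :- g₁)) refl
      (f zero) (ℚΣ.sum (f ∘ suc)) (g zero) (ℚΣ.sum (g ∘ suc)))
    (cong (λ t → (f zero - g zero) + t) (sum-- (f ∘ suc) (g ∘ suc)))

  off-diagonal : ∀ k l → l ≢ k → P W W′ k l - P W′ W l k ≡ 0ℚ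
  off-diagonal k l l≢k = trans
    (cong₂ (λ s t → w * s - w′ * t)
      (cong₂ (λ m β → weight W′ m * c β)
        (Vecₚ.lookup∘update′ l≢k α (source W (lookup α k)))
        (cong ((α [ k ]≔ source W (lookup α k)) [ l ]≔_)
          (cong (source W′) (Vecₚ.lookup∘update′ l≢k α (source W (lookup α k))))))
      (cong₂ (λ m β → weight W m * c β)
        (Vecₚ.lookup∘update′ (l≢k ∘ sym) α (source W′ (lookup α l)))
        (trans
          (cong ((α [ l ]≔ source W′ (lookup α l)) [ k ]≔_)
            (cong (source W) (Vecₚ.lookup∘update′ (l≢k ∘ sym) α (source W′ (lookup α l)))))
          (Vecₚ.[]≔-commutes α l k l≢k))))
    (solve 3 (λ w w′ y → w :* (w′ :* y) :- w′ :* (w :* y) := con 0ℚ) refl w w′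
      (c ((α [ k ]≔ source W (lookup α k)) [ l ]≔ source W′ (lookup α l))))
    where
    w = weight W (lookup α k)
    w′ = weight W′ (lookup α l)

  same : ∀ W W′ k → P W W′ k k ≡ one W (one W′ (λ m → c (α [ k ]≔ m))) (lookup α k)
  same W W′ k = cong (weight W (lookup α k) *_)
    (cong₂ (λ m β → weight W′ m * c β)
      (Vecₚ.lookup∘update k α (source W (lookup α k)))
      (trans
        (cong ((α [ k ]≔ source W (lookup α k)) [ k ]≔_)
          (cong (source W′) (Vecₚ.lookup∘update k α (source W (lookup α k)))))
        (Vecₚ.[]≔-idempotent α k)))

  diagonal : ∀ k → ℚΣ.sum (λ l → P W W′ k l - P W′ W l k) ≡ a * along k (one W″) c α
  diagonal k = trans (only k (λ l → P W W′ k l - P W′ W l k) (off-diagonal k))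
    (trans (cong₂ _-_ (same W W′ k) (same W′ W k))
      ([W,W′] (λ m → c (α [ k ]≔ m)) (lookup α k)))
    where
    only : ∀ {N} (k : Fin N) (f : Fin N → ℚ) → (∀ l → l ≢ k → f l ≡ 0ℚ) → ℚΣ.sum f ≡ f k
    only zero f f≡0 = trans
      (cong (λ t → f zero + t) (∑-zero (f ∘ suc) (λ l → f≡0 (suc l) λ ())))
      (ℚₚ.+-identityʳ (f zero))
    only (suc k) f f≡0 = trans
      (cong₂ _+_ (f≡0 zero λ ())
        (only k (f ∘ suc) (λ l l≢k → f≡0 (suc l) (l≢k ∘ Finₚ.suc-injective))))
      (ℚₚ.+-identityˡ (f (suc k)))

w₊ : ℕ → ℕ → ℚ
w₊ d zero = 0ℚ
w₊ d (suc m) = fromℕ d - fromℕ m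

W₊ W₀ : ℕ → Weighted
W₊ d = w₊ d ·[ pred ]
W₀ d = (λ m → fromℕ 2 * fromℕ m - fromℕ d) ·[ id ]

W₋ : Weighted
W₋ = (λ m → fromℕ (suc m)) ·[ suc ]

W₊-preserves : ∀ d → Preserves d (W₊ d)
W₊-preserves d (suc m) (s≤s d≤m) with ℕₚ.m≤n⇒m<n∨m≡n d≤m
... | inj₁ d<m = inj₂ d<m
... | inj₂ refl = inj₁ (ℚₚ.+-inverseʳ (fromℕ d))

W₀-preserves : ∀ d → Preserves d (W₀ d)
W₀-preserves d m d<m = inj₂ d<m

W₋-preserves : ∀ d → Preserves d W₋
W₋-preserves d m d<m = inj₂ (ℕₚ.m≤n⇒m≤1+n d<m)

[W₀,W₊] : ∀ d g m → one (W₀ d) (one (W₊ d) g) m - one (W₊ d) (one (W₀ d) g) m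
                    ≡ fromℕ 2 * one (W₊ d) g m
[W₀,W₊] d g zero =
  solve 2 (λ w y → w :* (con 0ℚ :* y) :- con 0ℚ :* (w :* y) := con (fromℕ 2) :* (con 0ℚ :* y))
    refl (fromℕ 2 * fromℕ 0 - fromℕ d) (g 0)
  where open ℚSolver.+-*-Solver
[W₀,W₊] d g (suc m) = identity (fromℕ d) (fromℕ m) (fromℕ (suc m)) (g m) (fromℕ-suc m)
  where
  open ℚSolver.+-*-Solver
  identity : ∀ d m m′ y → m′ ≡ 1ℚ + m →
    (fromℕ 2 * m′ - d) * ((d - m) * y) - (d - m) * ((fromℕ 2 * m - d) * y)
    ≡ fromℕ 2 * ((d - m) * y)
  identity d m _ y refl = solve 3 (λ d m y →
    (con (fromℕ 2) :* (con 1ℚ :+ m) :- d) :* ((d :- m) :* y)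
      :- (d :- m) :* ((con (fromℕ 2) :* m :- d) :* y)
    := con (fromℕ 2) :* ((d :- m) :* y)) refl d m y

[W₀,W₋] : ∀ d g m → one (W₀ d) (one W₋ g) m - one W₋ (one (W₀ d) g) m
                    ≡ - fromℕ 2 * one W₋ g m
[W₀,W₋] d g m = identity (fromℕ d) (fromℕ m) (fromℕ (suc m)) (g (suc m)) (fromℕ-suc m)
  where
  open ℚSolver.+-*-Solver
  identity : ∀ d m m′ y → m′ ≡ 1ℚ + m →
    (fromℕ 2 * m - d) * (m′ * y) - m′ * ((fromℕ 2 * m′ - d) * y)
    ≡ - fromℕ 2 * (m′ * y)
  identity d m _ y refl = solve 3 (λ d m y →
    (con (fromℕ 2) :* m :- d) :* ((con 1ℚ :+ m) :* y)
      :- (con 1ℚ :+ m) :* ((con (fromℕ 2) :* (con 1ℚ :+ m) :- d) :* y)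
    := con (- fromℕ 2) :* ((con 1ℚ :+ m) :* y)) refl d m y

[W₊,W₋] : ∀ d g m → one (W₊ d) (one W₋ g) m - one W₋ (one (W₊ d) g) m
                    ≡ 1ℚ * one (W₀ d) g m
[W₊,W₋] d g zero =
  solve 3 (λ d y z → con 0ℚ :* z :- con 1ℚ :* ((d :- con 0ℚ) :* y)
    := con 1ℚ :* ((con (fromℕ 2) :* con 0ℚ :- d) :* y)) refl (fromℕ d) (g 0) (one W₋ g 0)
  where open ℚSolver.+-*-Solver
[W₊,W₋] d g (suc m) = identity (fromℕ d) (fromℕ m) (fromℕ (suc m)) (fromℕ (suc (suc m)))
    (g (suc m)) (fromℕ-suc m) (fromℕ-suc (suc m))
  where
  open ℚSolver.+-*-Solver
  identity : ∀ d m m′ m″ y → m′ ≡ 1ℚ + m → m″ ≡ 1ℚ + m′ →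
    (d - m) * (m′ * y) - m″ * ((d - m′) * y) ≡ 1ℚ * ((fromℕ 2 * m′ - d) * y)
  identity d m _ _ y refl refl = solve 3 (λ d m y →
    (d :- m) :* ((con 1ℚ :+ m) :* y)
      :- (con 1ℚ :+ (con 1ℚ :+ m)) :* ((d :- (con 1ℚ :+ m)) :* y)
    := con 1ℚ :* ((con (fromℕ 2) :* (con 1ℚ :+ m) :- d) :* y)) refl d m y

module OperatorProperties (n d : ℕ) where
  open Operators n d public
  open LeftModule (ℚ[x] n)
  open CommutativeMonoidSum +ᴹ-commutativeMonoid using () renaming (sum to ∑)

  coeff-sum : ∀ {N} (f : Fin N → Polynomial n) α →
              coeff (∑ f) α ≡ ℚΣ.sum (λ k → coeff (f k) α)
  coeff-sum {zero} f α = refl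
  coeff-sum {suc N} f α = cong (λ t → coeff (f zero) α + t) (coeff-sum (f ∘ suc) α)

  -- x_k ∂_k multiplies x^α by α_k.
  coeff-x∂ : ∀ k (p : Polynomial n) α → coeff (x k (∂ k p)) α ≡ fromℕ (lookup α k) * coeff p α
  coeff-x∂ k p α with lookup α k in eq
  ... | zero = sym (ℚₚ.*-zeroˡ (coeff p α))
  ... | suc m = cong₂ (λ j β → fromℕ (suc j) * coeff p β)
        (Vecₚ.lookup∘update k α m)
        (trans (cong ((α [ k ]≔ m) [ k ]≔_) (cong suc (Vecₚ.lookup∘update k α m)))
          (trans (Vecₚ.[]≔-idempotent α k)
            (trans (cong (α [ k ]≔_) (sym eq)) (Vecₚ.[]≔-lookup α k))))

  term₊ : ∀ k (p : Polynomial n) α → coeff (-ᴹ x k (x k (∂ k p)) +ᴹ fromℕ d *ₗ x k p) α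
                    ≡ along k (one (W₊ d)) (coeff p) α
  term₊ k p α with lookup α k
  ... | zero = solve 2 (λ d y → con (- 0ℚ) :+ d :* con 0ℚ := con 0ℚ :* y) refl
                 (fromℕ d) (coeff p (α [ k ]≔ 0))
    where open ℚSolver.+-*-Solver
  ... | suc m = trans
        (cong (λ t → - t + fromℕ d * coeff p (α [ k ]≔ m))
          (trans (coeff-x∂ k p (α [ k ]≔ m))
            (cong (λ j → fromℕ j * coeff p (α [ k ]≔ m)) (Vecₚ.lookup∘update k α m))))
        (solve 3 (λ m d y → :- (m :* y) :+ d :* y := (d :- m) :* y) refl
          (fromℕ m) (fromℕ d) (coeff p (α [ k ]≔ m)))
    where open ℚSolver.+-*-Solver

  coeff-E₊ : ∀ p α → coeff (E₊ p) α ≡ total (W₊ d) (coeff p) α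
  coeff-E₊ p α = trans
    (coeff-sum (λ k → -ᴹ x k (x k (∂ k p)) +ᴹ fromℕ d *ₗ x k p) α)
    (ℚΣ.sum-cong-≋ (λ k → term₊ k p α))

  coeff-E₋ : ∀ p α → coeff (E₋ p) α ≡ total W₋ (coeff p) α
  coeff-E₋ p α = coeff-sum (λ k → ∂ k p) α

  coeff-H : ∀ p α → coeff (H p) α ≡ total (W₀ d) (coeff p) α
  coeff-H p α = trans
    (cong₂ (λ s t → fromℕ 2 * s + - (t * coeff p α))
      (trans (coeff-sum (λ k → x k (∂ k p)) α) (ℚΣ.sum-cong-≋ (λ k → coeff-x∂ k p α)))
      (fromℕ-* n d))
    (trans (collect (lookup α))
      (ℚΣ.sum-cong-≋ (λ k → cong (λ β → weight (W₀ d) (lookup α k) * coeff p β)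
        (sym (Vecₚ.[]≔-lookup α k)))))
    where
    open ℚSolver.+-*-Solver
    y = coeff p α
    step : ∀ a s n n′ d y → n′ ≡ 1ℚ + n →
      fromℕ 2 * (a * y + s) + - (n′ * d * y)
      ≡ (fromℕ 2 * a - d) * y + (fromℕ 2 * s + - (n * d * y))
    step a s n _ d y refl = solve 5 (λ a s n d y →
      con (fromℕ 2) :* (a :* y :+ s) :+ :- ((con 1ℚ :+ n) :* d :* y)
      := (con (fromℕ 2) :* a :- d) :* y :+ (con (fromℕ 2) :* s :+ :- (n :* d :* y)))
      refl a s n d y
    collect : ∀ {N} (a : Fin N → ℕ) →
      fromℕ 2 * ℚΣ.sum (λ k → fromℕ (a k) * y) + - (fromℕ N * fromℕ d * y)
      ≡ ℚΣ.sum (λ k → (fromℕ 2 * fromℕ (a k) - fromℕ d) * y)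
    collect {zero} a =
      solve 2 (λ d y → con (fromℕ 2) :* con 0ℚ :+ :- (con 0ℚ :* d :* y) := con 0ℚ) refl
        (fromℕ d) y
    collect {suc N} a = trans
      (step (fromℕ (a zero)) (ℚΣ.sum (λ k → fromℕ (a (suc k)) * y)) (fromℕ N) (fromℕ (suc N))
        (fromℕ d) y (fromℕ-suc N))
      (cong (λ t → (fromℕ 2 * fromℕ (a zero) - fromℕ d) * y + t) (collect (a ∘ suc)))

record SymmetricPolynomial (n d : ℕ) : Set where
  field
    polynomial : Polynomial n
    symmetric  : Symmetric (coeff polynomial)
    degrees    : DegreesAtMost d (coeff polynomial)
open SymmetricPolynomial public

module _ (n d : ℕ) where
  open OperatorProperties n d
  private module P = LeftModule (ℚ[x] n)

  Λ-space : VectorSpace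
  Λ-space = induced (ℚ[x] n) {SymmetricPolynomial n d} polynomial
    (λ f g → record
      { polynomial = polynomial f P.+ᴹ polynomial g
      ; symmetric = λ σ α → cong₂ _+_ (symmetric f σ α) (symmetric g σ α)
      ; degrees = λ α k d<αk → cong₂ _+_ (degrees f α k d<αk) (degrees g α k d<αk) })
    (λ a f → record
      { polynomial = a P.*ₗ polynomial f
      ; symmetric = λ σ α → cong (a *_) (symmetric f σ α)
      ; degrees = λ α k d<αk → trans (cong (a *_) (degrees f α k d<αk)) (ℚₚ.*-zeroʳ a) })
    (record
      { polynomial = P.0ᴹ
      ; symmetric = λ _ _ → refl
      ; degrees = λ _ _ _ → refl })
    (λ f → record
      { polynomial = P.-ᴹ polynomial f
      ; symmetric = λ σ α → cong -_ (symmetric f σ α)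
      ; degrees = λ α k d<αk → cong -_ (degrees f α k d<αk) })
    (λ _ _ _ → refl) (λ _ _ _ → refl) (λ _ → refl) (λ _ _ → refl)

  private
    restrict : (T : Polynomial n → Polynomial n) (W : Weighted) →
               (∀ p α → coeff (T p) α ≡ total W (coeff p) α) → Preserves d W →
               SymmetricPolynomial n d → SymmetricPolynomial n d
    restrict T W T≡W W-preserves f = record
      { polynomial = T (polynomial f)
      ; symmetric = λ σ α → trans (T≡W (polynomial f) (permute σ α))
          (trans (total-symmetric W (coeff (polynomial f)) (symmetric f) σ α)
            (sym (T≡W (polynomial f) α)))
      ; degrees = λ α k d<αk → trans (T≡W (polynomial f) α)
          (total-bounded W W-preserves (coeff (polynomial f)) (degrees f) α k d<αk) }

    restrict-linear : ∀ T W T≡W W-preserves →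
      IsLinear Λ-space Λ-space (restrict T W T≡W W-preserves)
    restrict-linear T W T≡W W-preserves =
      linear Λ-space Λ-space (restrict T W T≡W W-preserves)
        (λ {f} {g} f≈g α → trans (T≡W (polynomial f) α)
          (trans (total-cong W f≈g α) (sym (T≡W (polynomial g) α))))
        (λ f g α → trans (T≡W (polynomial f P.+ᴹ polynomial g) α)
          (trans (total-+ W (coeff (polynomial f)) (coeff (polynomial g)) α)
            (sym (cong₂ _+_ (T≡W (polynomial f) α) (T≡W (polynomial g) α)))))
        (λ a f α → trans (T≡W (a P.*ₗ polynomial f) α)
          (trans (total-* W a (coeff (polynomial f)) α)
            (cong (a *_) (sym (T≡W (polynomial f) α)))))

    commutes : ∀ (T : Polynomial n → Polynomial n) W (T′ : Polynomial n → Polynomial n) W′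
               a (T″ : Polynomial n → Polynomial n) W″ →
      (∀ p α → coeff (T p) α ≡ total W (coeff p) α) →
      (∀ p α → coeff (T′ p) α ≡ total W′ (coeff p) α) →
      (∀ p α → coeff (T″ p) α ≡ total W″ (coeff p) α) →
      (∀ g m → one W (one W′ g) m - one W′ (one W g) m ≡ a * one W″ g m) →
      ∀ p α → coeff (T (T′ p)) α - coeff (T′ (T p)) α ≡ a * coeff (T″ p) α
    commutes T W T′ W′ a T″ W″ T≡W T′≡W′ T″≡W″ [W,W′] p α = trans
      (cong₂ _-_
        (trans (T≡W (T′ p) α) (total-cong W (T′≡W′ p) α))
        (trans (T′≡W′ (T p) α) (total-cong W′ (T≡W p) α)))
      (trans (total-commutator W W′ a W″ [W,W′] (coeff p) α)
        (cong (a *_) (sym (T″≡W″ p α))))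

  Λ : SL2Module
  Λ = record
    { vectorSpace = Λ-space
    ; e₋ = restrict E₋ W₋ coeff-E₋ (W₋-preserves d)
    ; h = restrict H (W₀ d) coeff-H (W₀-preserves d)
    ; e₊ = restrict E₊ (W₊ d) coeff-E₊ (W₊-preserves d)
    ; e₋-linear = restrict-linear E₋ W₋ coeff-E₋ (W₋-preserves d)
    ; h-linear = restrict-linear H (W₀ d) coeff-H (W₀-preserves d)
    ; e₊-linear = restrict-linear E₊ (W₊ d) coeff-E₊ (W₊-preserves d)
    ; [h,e₊] = λ f α → commutes H (W₀ d) E₊ (W₊ d) (fromℕ 2) E₊ (W₊ d)
        coeff-H coeff-E₊ coeff-E₊ ([W₀,W₊] d) (polynomial f) α
    ; [h,e₋] = λ f α → commutes H (W₀ d) E₋ W₋ (- fromℕ 2) E₋ W₋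
        coeff-H coeff-E₋ coeff-E₋ ([W₀,W₋] d) (polynomial f) α
    ; [e₊,e₋] = λ f α → trans
        (commutes E₊ (W₊ d) E₋ W₋ 1ℚ H (W₀ d)
          coeff-E₊ coeff-E₋ coeff-H ([W₊,W₋] d) (polynomial f) α)
        (ℚₚ.*-identityˡ (coeff (H (polynomial f)) α)) }

Series : Set
Series = ℕ → ℤ

T^ : ℕ → Series
T^ m j = if m ≡ᵇ j then 1ℤ else 0ℤ

1-T^ : ℕ → Series
1-T^ m j = T^ 0 j ℤ.- T^ m j

infixl 7 _⊛_ _⊘_

_⊛_ : Series → Series → Series
(f ⊛ g) j = ℤΣ.sum {suc j} (λ a → f (toℕ a) ℤ.* g (j ∸ toℕ a))

-- ∏ n f is the product of f 1, …, f n.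
∏ : ℕ → (ℕ → Series) → Series
∏ zero f = T^ 0
∏ (suc n) f = ∏ n f ⊛ f (suc n)

-- Long division, meaningful when g has constant term 1.
_⊘_ : Series → Series → Series
(f ⊘ g) zero = f 0
(f ⊘ g) (suc j) = ((λ a → f (suc a) ℤ.- f 0 ℤ.* g (suc a)) ⊘ g) j

⊘-⊛ : ∀ f g → g 0 ≡ 1ℤ → (f ⊘ g) ⊛ g ≗ f
⊘-⊛ f g g₀≡1 zero = trans (ℤₚ.+-identityʳ (f 0 ℤ.* g 0))
  (trans (cong (f 0 ℤ.*_) g₀≡1) (ℤₚ.*-identityʳ (f 0)))
⊘-⊛ f g g₀≡1 (suc j) = trans
  (cong (λ t → f 0 ℤ.* g (suc j) ℤ.+ t)
    (⊘-⊛ (λ a → f (suc a) ℤ.- f 0 ℤ.* g (suc a)) g g₀≡1 j))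
  (solve 2 (λ p q → p :+ (q :- p) := q) refl (f 0 ℤ.* g (suc j)) (f (suc j)))
  where open ℤSolver.+-*-Solver

-- m ∸ n is m - n, as only m ≥ n is used.
numerator : ℕ → ℕ → Series
numerator m n = ∏ n (λ k → 1-T^ (m ∸ n ℕ.+ k))

denominator : ℕ → Series
denominator n = ∏ n 1-T^

denominator₀ : ∀ n → denominator n 0 ≡ 1ℤ
denominator₀ zero = refl
denominator₀ (suc n) = trans (ℤₚ.+-identityʳ (denominator n 0 ℤ.* 1ℤ))
  (trans (ℤₚ.*-identityʳ (denominator n 0)) (denominator₀ n))

-- j ranges over ℚ because it is a difference of halves of integers.
γ : ℕ → ℕ → ℚ → ℤ
γ m n (mkℚ (+ j) zero _) = (numerator m n ⊘ denominator n) j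
γ m n (mkℚ (+ _) (suc _) _) = 0ℤ
γ m n (mkℚ -[1+ _ ] _ _) = 0ℤ

c : (n d i : ℕ) → ℤ
c n d i = γ (d ℕ.+ n) n (½ * fromℕ (d ℕ.* n) - ½ * fromℕ i)
      ℤ.- γ (d ℕ.+ n) n (½ * fromℕ (d ℕ.* n) - ½ * fromℕ i - 1ℚ)

-- Partitions of j whose diagram fits in a rectangle with a rows and b columns.
record PartitionInRectangle (a b j : ℕ) : Set where
  field
    parts       : List ℕ
    .positive   : All (0 <_) parts
    .decreasing : Linked _≥_ parts
    .size       : sum parts ≡ j
    .rows       : List.length parts ≤ a
    .columns    : All (_≤ b) parts

{-# OPTIONS --safe #-}

-- A vector v of an 𝔰𝔩₂-module that is a sum of finitely many weight spaces lies in
-- the submodule generated by the spaces K i = { v | h v = −i v, e₋ v = 0 }: on a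
-- negative weight space e₋ e₊ is invertible, so some v − e₊ r is killed by e₋, and
-- on a positive one e₊ e₋ is invertible, so v = e₊ (e₋ r); the vectors r and e₋ r are
-- treated by induction.  There is no relation between the vectors e₊^k w for w in bases
-- of the K i, because e₋ lowers it to one between the w.  This gives the sum of
-- dim K i copies of V i.  Since e₋ maps the space of weight −i onto that of weight
-- −i − 2, dim K i is the difference of their dimensions.  In Λ n d these spaces are
-- spanned by the monomial symmetric polynomials of one degree, which correspond to
-- partitions.  The generating functions p(a,b) of partitions in a rectangle satisfy
-- p(a+1,b+1) = p(a+1,b) + T^(b+1) p(a,b+1), hence
-- (1−T)⋯(1−T^a) (1−T)⋯(1−T^b) p(a,b) = (1−T)⋯(1−T^(a+b)), and so does the Gaussian quotient.
module Submission where

open import Defs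
open import Algebra.Module.Bundles using (LeftModule)
open import Algebra.Module.Morphism.Structures using (module LeftModuleMorphisms)
import Algebra.Properties.AbelianGroup as AbelianGroupProperties
import Algebra.Properties.CommutativeMonoid.Sum as CommutativeMonoidSum
import Algebra.Properties.Group as GroupProperties
open import Data.Bool using (if_then_else_)
open import Data.Empty using (⊥; ⊥-elim; ⊥-elim-irr)
open import Data.Fin using (Fin; zero; suc; toℕ; inject₁; fromℕ<; punchIn)
open import Data.Fin.Permutation as Perm using (Permutation′; _⟨$⟩ʳ_)
import Data.Fin.Properties as Finₚ
open import Data.Integer as ℤ using (ℤ; +_; -[1+_]; 0ℤ; 1ℤ)
import Data.Integer.Properties as ℤₚ
import Data.Integer.Solver as ℤSolver
open import Data.List as List using (List; []; _∷_; _++_)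
import Data.List.Properties as Listₚ
open import Data.List.Relation.Binary.Permutation.Propositional as ↭
  using (_↭_; ↭-sym; ↭-trans; ↭⇒↭ₛ′)
import Data.List.Relation.Binary.Permutation.Propositional.Properties as ↭ₚ
import Data.List.Relation.Binary.Pointwise as Pointwise
open import Data.List.Relation.Unary.All as All using (All; []; _∷_)
import Data.List.Relation.Unary.All.Properties as Allₚ
open import Data.List.Relation.Unary.AllPairs using (_∷_)
open import Data.List.Relation.Unary.Linked as Linked using (Linked; []; [-]; _∷_)
import Data.List.Relation.Unary.Linked.Properties as Linkedₚ
import Data.List.Relation.Unary.Sorted.TotalOrder.Properties as Sortedₚ
open import Data.Nat as ℕ using (ℕ; zero; suc; _≤_; _<_; _≥_; _∸_; s≤s; z≤n)
import Data.Nat.Induction as ℕI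
open import Data.Nat.ListAction using () renaming (sum to sumˡ)
open import Data.Nat.ListAction.Properties using (sum-↭)
import Data.Nat.Properties as ℕₚ
open import Data.Product using (Σ-syntax; ∃-syntax; _×_; _,_; proj₁; proj₂)
open import Data.Rational as ℚ using (ℚ; mkℚ; 0ℚ; 1ℚ; ½)
import Data.Rational.Properties as ℚₚ
import Data.Rational.Solver as ℚSolver
open import Data.Sum using (_⊎_; inj₁; inj₂)
open import Data.Sum.Function.Propositional using (_⊎-↔_)
open import Data.Vec as Vec using (Vec; []; _∷_; lookup; tabulate; toList)
open import Data.Vec.Functional using (insertAt)
import Data.Vec.Functional.Properties as VFₚ
import Data.Vec.Properties as Vecₚ
open import Function using (_∘_; _↔_; mk↔ₛ′; Inverse)
open import Function.Construct.Composition using (_↔-∘_)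
open import Function.Construct.Symmetry using (↔-sym)
open import Relation.Binary.Bundles using (DecTotalOrder)
import Relation.Binary.Construct.Flip.EqAndOrd as Flip
open import Relation.Binary.PropositionalEquality hiding ([_])
import Relation.Binary.Reasoning.Setoid as SetoidReasoning
open import Relation.Nullary using (¬_; Dec; yes; no; does; contradiction; recompute)
open import Relation.Nullary.Decidable using (dec-true; dec-false)

-- The argument is constructive: it uses no chosen complements, no complete reducibility and no
-- abstract dimension. What takes their place is the bound D = nd on weights. Since e₋^k v leaves
-- the range of weights for large k, e₋ e₊ is inverted on the space of weight -m by finitely many
-- divisions by the positive integers (k+1)(m+k). The same inversion makes e₋ surjective between
-- weight spaces, so rank-nullity returns a natural number k with k + `count n d s` =
-- `count n d (s+1)` whenever 2(s+1) ≤ nd. This is how the integer `c n d i`, defined by a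
-- subtraction, is seen to be a multiplicity. Gaussian elimination itself asks only for decidable
-- equality on ℚ. Exponent vectors give partitions with at most n parts, each at most d, while the
-- rectangle in the theorem has d rows and n columns. That the two are equinumerous is read off the
-- product formula instead of from conjugation of diagrams.

private
  module ℤG = AbelianGroupProperties ℤₚ.+-0-abelianGroup
  module ℚG = AbelianGroupProperties ℚₚ.+-0-abelianGroup

-- Gaussian coefficients

-- The filler `z` is a parameter because the same operation serves integer series (`0ℤ`), natural
-- counts (`0`) and families of types (`⊥`).
shift : ∀ {ℓ} {A : Set ℓ} → A → ℕ → (ℕ → A) → ℕ → A
shift z zero f j = f j
shift z (suc m) f zero = z
shift z (suc m) f (suc j) = shift z m f j

-- m ⊖ f is (1 − T^m) f.
infixr 8 _⊖_
_⊖_ : ℕ → Series → Series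
(m ⊖ f) j = f j ℤ.- shift 0ℤ m f j

shift-cong : ∀ m {f g : Series} → f ≗ g → shift 0ℤ m f ≗ shift 0ℤ m g
shift-cong zero f≗g j = f≗g j
shift-cong (suc m) f≗g zero = refl
shift-cong (suc m) f≗g (suc j) = shift-cong m f≗g j

shift-+ : ∀ m f g j →
  shift 0ℤ m (λ i → f i ℤ.+ g i) j ≡ shift 0ℤ m f j ℤ.+ shift 0ℤ m g j
shift-+ zero f g j = refl
shift-+ (suc m) f g zero = refl
shift-+ (suc m) f g (suc j) = shift-+ m f g j

shift-- : ∀ m f g j →
  shift 0ℤ m (λ i → f i ℤ.- g i) j ≡ shift 0ℤ m f j ℤ.- shift 0ℤ m g j
shift-- zero f g j = refl
shift-- (suc m) f g zero = refl
shift-- (suc m) f g (suc j) = shift-- m f g j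

shift-shift : ∀ m k (f : Series) j → shift 0ℤ m (shift 0ℤ k f) j ≡ shift 0ℤ (m ℕ.+ k) f j
shift-shift zero k f j = refl
shift-shift (suc m) k f zero = refl
shift-shift (suc m) k f (suc j) = shift-shift m k f j

shift-comm : ∀ m k (f : Series) j →
  shift 0ℤ m (shift 0ℤ k f) j ≡ shift 0ℤ k (shift 0ℤ m f) j
shift-comm m k f j = trans (shift-shift m k f j)
  (trans (cong (λ t → shift 0ℤ t f j) (ℕₚ.+-comm m k)) (sym (shift-shift k m f j)))

⊖-cong : ∀ m {f g} → f ≗ g → m ⊖ f ≗ m ⊖ g
⊖-cong m f≗g j = cong₂ ℤ._-_ (f≗g j) (shift-cong m f≗g j)

⊖-+ : ∀ m f g j → (m ⊖ (λ i → f i ℤ.+ g i)) j ≡ (m ⊖ f) j ℤ.+ (m ⊖ g) j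
⊖-+ m f g j = trans (cong (λ t → f j ℤ.+ g j ℤ.- t) (shift-+ m f g j))
  (solve 4 (λ a b s t → a :+ b :- (s :+ t) := (a :- s) :+ (b :- t)) refl
    (f j) (g j) (shift 0ℤ m f j) (shift 0ℤ m g j))
  where open ℤSolver.+-*-Solver

⊖-shift : ∀ m k f → m ⊖ shift 0ℤ k f ≗ shift 0ℤ k (m ⊖ f)
⊖-shift m k f j = trans (cong (λ t → shift 0ℤ k f j ℤ.- t) (shift-comm m k f j))
  (sym (shift-- k f (shift 0ℤ m f) j))

⊖-comm : ∀ m k f → m ⊖ k ⊖ f ≗ k ⊖ m ⊖ f
⊖-comm m k f j = trans
  (cong (λ t → f j ℤ.- shift 0ℤ k f j ℤ.- t) (trans (shift-- m f (shift 0ℤ k f) j)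
    (cong (λ t → shift 0ℤ m f j ℤ.- t) (shift-comm m k f j))))
  (trans
    (solve 4 (λ a b c d → a :- b :- (c :- d) := a :- c :- (b :- d)) refl
      (f j) (shift 0ℤ k f j) (shift 0ℤ m f j) (shift 0ℤ k (shift 0ℤ m f) j))
    (cong (λ t → f j ℤ.- shift 0ℤ m f j ℤ.- t) (sym (shift-- k f (shift 0ℤ m f) j))))
  where open ℤSolver.+-*-Solver

shift-< : ∀ m {f g : Series} j → (∀ {i} → i < j → f i ≡ g i) →
          shift 0ℤ (suc m) f j ≡ shift 0ℤ (suc m) g j
shift-< m zero f≡g = refl
shift-< zero (suc j) f≡g = f≡g ℕₚ.≤-refl
shift-< (suc m) (suc j) f≡g = shift-< m j (λ i<j → f≡g (ℕₚ.m≤n⇒m≤1+n i<j))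

-- Coefficient j of (1 - T^(m+1)) f is f j minus a coefficient of lower index, or minus 0, so strong
-- induction on j recovers f. The exponent must be positive, since `0 ⊖_` is zero.
⊖-injective : ∀ m {f g} → (suc m) ⊖ f ≗ (suc m) ⊖ g → f ≗ g
⊖-injective m {f} {g} eq = ℕI.<-rec (λ j → f j ≡ g j) λ j f≡g →
  ℤG.∙-cancelʳ (ℤ.- shift 0ℤ (suc m) f j) (f j) (g j)
    (trans (eq j) (cong (λ t → g j ℤ.- t) (sym (shift-< m j f≡g))))

⊛-cong : ∀ f {g h} → g ≗ h → f ⊛ g ≗ f ⊛ h
⊛-cong f g≗h zero = cong (λ t → f 0 ℤ.* t ℤ.+ 0ℤ) (g≗h 0)
⊛-cong f g≗h (suc j) =
  cong₂ ℤ._+_ (cong (f 0 ℤ.*_) (g≗h (suc j))) (⊛-cong (f ∘ suc) g≗h j)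

⊛-T : ∀ f g → f ⊛ shift 0ℤ 1 g ≗ shift 0ℤ 1 (f ⊛ g)
⊛-T f g zero = trans (ℤₚ.+-identityʳ (f 0 ℤ.* 0ℤ)) (ℤₚ.*-zeroʳ (f 0))
⊛-T f g (suc zero) =
  cong (λ t → f 0 ℤ.* g 0 ℤ.+ t) (⊛-T (f ∘ suc) g zero)
⊛-T f g (suc (suc j)) =
  cong (λ t → f 0 ℤ.* g (suc j) ℤ.+ t) (⊛-T (f ∘ suc) g (suc j))

shift-suc : ∀ m (f : Series) → shift 0ℤ (suc m) f ≗ shift 0ℤ 1 (shift 0ℤ m f)
shift-suc m f zero = refl
shift-suc m f (suc j) = refl

⊛-shift : ∀ m f g → f ⊛ shift 0ℤ m g ≗ shift 0ℤ m (f ⊛ g)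
⊛-shift zero f g j = refl
⊛-shift (suc m) f g j = trans (⊛-cong f (shift-suc m g) j)
  (trans (⊛-T f (shift 0ℤ m g) j)
    (trans (shift-cong 1 (⊛-shift m f g) j) (sym (shift-suc m (f ⊛ g) j))))

⊛-- : ∀ f g h j → (f ⊛ (λ i → g i ℤ.- h i)) j ≡ (f ⊛ g) j ℤ.- (f ⊛ h) j
⊛-- f g h zero = solve 3 (λ f g h → f :* (g :- h) :+ con 0ℤ
    := f :* g :+ con 0ℤ :- (f :* h :+ con 0ℤ)) refl (f 0) (g 0) (h 0)
  where open ℤSolver.+-*-Solver
⊛-- f g h (suc j) = trans
  (cong (λ t → f 0 ℤ.* (g (suc j) ℤ.- h (suc j)) ℤ.+ t) (⊛-- (f ∘ suc) g h j))
  (solve 5 (λ f g h s t → f :* (g :- h) :+ (s :- t) := f :* g :+ s :- (f :* h :+ t)) refl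
    (f 0) (g (suc j)) (h (suc j)) (((f ∘ suc) ⊛ g) j) (((f ∘ suc) ⊛ h) j))
  where open ℤSolver.+-*-Solver

⊛-⊖ : ∀ m f g → f ⊛ (m ⊖ g) ≗ m ⊖ (f ⊛ g)
⊛-⊖ m f g j = trans (⊛-- f g (shift 0ℤ m g) j)
  (cong (λ t → (f ⊛ g) j ℤ.- t) (⊛-shift m f g j))

⊛-identityʳ : ∀ f → f ⊛ T^ 0 ≗ f
⊛-identityʳ f zero = trans (ℤₚ.+-identityʳ (f 0 ℤ.* 1ℤ)) (ℤₚ.*-identityʳ (f 0))
⊛-identityʳ f (suc j) = trans
  (cong₂ ℤ._+_ (ℤₚ.*-zeroʳ (f 0)) (⊛-identityʳ (f ∘ suc) j))
  (ℤₚ.+-identityˡ (f (suc j)))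

T^-shift : ∀ m → T^ m ≗ shift 0ℤ m (T^ 0)
T^-shift zero j = refl
T^-shift (suc m) zero = refl
T^-shift (suc m) (suc j) = T^-shift m j

-- `∏` appends its factors on the right. This lemma turns each of them into an operator `m ⊖_`, and
-- commuting these operators takes the place of commutativity and associativity of `_⊛_`.
⊛-factor : ∀ f m → f ⊛ 1-T^ m ≗ m ⊖ f
⊛-factor f m j = trans (⊛-cong f (λ i → cong (λ t → T^ 0 i ℤ.- t) (T^-shift m i)) j)
  (trans (⊛-⊖ m f (T^ 0) j) (⊖-cong m (⊛-identityʳ f) j))

-- factors e k f is (1 − T^(e+1)) ⋯ (1 − T^(e+k)) f.
factors : ℕ → ℕ → Series → Series
factors e zero f = f
factors e (suc k) f = (e ℕ.+ suc k) ⊖ factors e k f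

factors-⊖ : ∀ e k m f → factors e k (m ⊖ f) ≗ m ⊖ factors e k f
factors-⊖ e zero m f j = refl
factors-⊖ e (suc k) m f j = trans
  (⊖-cong (e ℕ.+ suc k) (factors-⊖ e k m f) j)
  (⊖-comm (e ℕ.+ suc k) m (factors e k f) j)

factors-swap : ∀ n d f → factors 0 n (factors 0 d f) ≗ factors 0 d (factors 0 n f)
factors-swap zero d f j = refl
factors-swap (suc n) d f j = trans (⊖-cong (suc n) (factors-swap n d f) j)
  (sym (factors-⊖ 0 d (suc n) (factors 0 n f) j))

factors-cong : ∀ e k {f g} → f ≗ g → factors e k f ≗ factors e k g
factors-cong e zero f≗g = f≗g
factors-cong e (suc k) f≗g = ⊖-cong (e ℕ.+ suc k) (factors-cong e k f≗g)

factors-+ : ∀ e k f g j →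
  factors e k (λ i → f i ℤ.+ g i) j ≡ factors e k f j ℤ.+ factors e k g j
factors-+ e zero f g j = refl
factors-+ e (suc k) f g j = trans (⊖-cong (e ℕ.+ suc k) (factors-+ e k f g) j)
  (⊖-+ (e ℕ.+ suc k) (factors e k f) (factors e k g) j)

factors-shift : ∀ e k m f → factors e k (shift 0ℤ m f) ≗ shift 0ℤ m (factors e k f)
factors-shift e zero m f j = refl
factors-shift e (suc k) m f j = trans
  (⊖-cong (e ℕ.+ suc k) (factors-shift e k m f) j)
  (⊖-shift (e ℕ.+ suc k) m (factors e k f) j)

-- Replaces division by (1-T)⋯(1-T^k): identities between quotients are proved after multiplying
-- through.
factors-injective : ∀ k {f g} → factors 0 k f ≗ factors 0 k g → f ≗ g
factors-injective zero eq = eq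
factors-injective (suc k) eq = factors-injective k (⊖-injective k eq)

factors-factors : ∀ e k f → factors 0 e (factors e k f) ≗ factors 0 (e ℕ.+ k) f
factors-factors e zero f j = cong (λ t → factors 0 t f j) (sym (ℕₚ.+-identityʳ e))
factors-factors e (suc k) f j rewrite ℕₚ.+-suc e k = trans
  (factors-⊖ 0 e (suc (e ℕ.+ k)) (factors e k f) j)
  (⊖-cong (suc (e ℕ.+ k)) (factors-factors e k f) j)

⊛-∏ : ∀ f e k → f ⊛ ∏ k (λ i → 1-T^ (e ℕ.+ i)) ≗ factors e k f
⊛-∏ f e zero j = ⊛-identityʳ f j
⊛-∏ f e (suc k) j = trans (⊛-cong f (⊛-factor (∏ k (λ i → 1-T^ (e ℕ.+ i))) (e ℕ.+ suc k)) j)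
  (trans (⊛-⊖ (e ℕ.+ suc k) f (∏ k (λ i → 1-T^ (e ℕ.+ i))) j)
    (⊖-cong (e ℕ.+ suc k) (⊛-∏ f e k) j))

∏-factors : ∀ e k → ∏ k (λ i → 1-T^ (e ℕ.+ i)) ≗ factors e k (T^ 0)
∏-factors e zero j = refl
∏-factors e (suc k) j = trans (⊛-factor (∏ k (λ i → 1-T^ (e ℕ.+ i))) (e ℕ.+ suc k) j)
  (⊖-cong (e ℕ.+ suc k) (∏-factors e k) j)

-- Partitions with at most a parts, all at most b, are split by whether b occurs.
count : ℕ → ℕ → ℕ → ℕ
count zero b zero = 1
count zero b (suc j) = 0
count (suc a) zero zero = 1
count (suc a) zero (suc j) = 0
count (suc a) (suc b) j = count (suc a) b j ℕ.+ shift 0 (suc b) (count a (suc b)) j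

countSeries : ℕ → ℕ → Series
countSeries a b j = + count a b j

+-shift : ∀ m (f : ℕ → ℕ) j → + shift 0 m f j ≡ shift 0ℤ m (λ i → + f i) j
+-shift zero f j = refl
+-shift (suc m) f zero = refl
+-shift (suc m) f (suc j) = +-shift m f j

private
  -- The two terms T^(b+1) F cancel, and the remaining shift is by (b+1) + (a+1).
  q-Pascal : ∀ a b F j →
    ((suc b) ⊖ F) j ℤ.+ shift 0ℤ (suc b) ((suc a) ⊖ F) j
    ≡ ((suc a ℕ.+ suc b) ⊖ F) j
  q-Pascal a b F j = trans
    (cong (λ t → F j ℤ.- shift 0ℤ (suc b) F j ℤ.+ t) (trans
      (shift-- (suc b) F (shift 0ℤ (suc a) F) j)
      (cong (λ t → shift 0ℤ (suc b) F j ℤ.- t) (trans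
        (shift-comm (suc b) (suc a) F j) (shift-shift (suc a) (suc b) F j)))))
    (solve 3 (λ f s t → f :- s :+ (s :- t) := f :- t) refl
      (F j) (shift 0ℤ (suc b) F j) (shift 0ℤ (suc a ℕ.+ suc b) F j))
    where open ℤSolver.+-*-Solver

count-T^0 : ∀ b → countSeries 0 b ≗ T^ 0
count-T^0 b zero = refl
count-T^0 b (suc j) = refl

count-T^0′ : ∀ a → countSeries a 0 ≗ T^ 0
count-T^0′ zero = count-T^0 0
count-T^0′ (suc a) zero = refl
count-T^0′ (suc a) (suc j) = refl

-- Induction along the recursion of `count`. Each summand carries the factors its induction
-- hypothesis consumes and one more: 1 - T^(b+1) when the parts are at most b, and 1 - T^(a+1) when
-- b+1 occurs. Both hypotheses give the same product `F`, and `q-Pascal` adds the two leftover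
-- factors.
factors-count : ∀ a b → factors 0 a (factors 0 b (countSeries a b)) ≗ factors 0 (a ℕ.+ b) (T^ 0)
factors-count zero b = factors-cong 0 b (count-T^0 b)
factors-count (suc a) zero j = trans (factors-cong 0 (suc a) (count-T^0′ (suc a)) j)
  (cong (λ t → factors 0 t (T^ 0) j) (sym (ℕₚ.+-identityʳ (suc a))))
factors-count (suc a) (suc b) j = begin
  factors 0 (suc a) (factors 0 (suc b) (countSeries (suc a) (suc b))) j
    ≡⟨ factors-cong 0 (suc a) (factors-cong 0 (suc b)
         (λ i → cong (λ t → + count (suc a) b i ℤ.+ t) (+-shift (suc b) (count a (suc b)) i))) j ⟩
  factors 0 (suc a) (factors 0 (suc b) (λ i →
    countSeries (suc a) b i ℤ.+ shift 0ℤ (suc b) (countSeries a (suc b)) i)) j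
    ≡⟨ factors-cong 0 (suc a) (factors-+ 0 (suc b) _ _) j ⟩
  factors 0 (suc a) (λ i → factors 0 (suc b) (countSeries (suc a) b) i
    ℤ.+ factors 0 (suc b) (shift 0ℤ (suc b) (countSeries a (suc b))) i) j
    ≡⟨ factors-+ 0 (suc a) _ _ j ⟩
  factors 0 (suc a) (factors 0 (suc b) (countSeries (suc a) b)) j
    ℤ.+ factors 0 (suc a) (factors 0 (suc b) (shift 0ℤ (suc b) (countSeries a (suc b)))) j
    ≡⟨ cong₂ ℤ._+_ first second ⟩
  ((suc b) ⊖ F) j ℤ.+ shift 0ℤ (suc b) ((suc a) ⊖ F) j
    ≡⟨ q-Pascal a b F j ⟩
  ((suc a ℕ.+ suc b) ⊖ F) j
    ≡⟨ cong (λ t → ((suc a ℕ.+ suc b) ⊖ factors 0 t (T^ 0)) j) (sym (ℕₚ.+-suc a b)) ⟩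
  factors 0 (suc a ℕ.+ suc b) (T^ 0) j ∎
  where
  open ≡-Reasoning
  F = factors 0 (suc (a ℕ.+ b)) (T^ 0)
  first = trans (factors-⊖ 0 (suc a) (suc b) (factors 0 b (countSeries (suc a) b)) j)
    (⊖-cong (suc b) (factors-count (suc a) b) j)
  second = trans
    (factors-cong 0 (suc a) (factors-shift 0 (suc b) (suc b) (countSeries a (suc b))) j)
    (trans (factors-shift 0 (suc a) (suc b) (factors 0 (suc b) (countSeries a (suc b))) j)
      (shift-cong (suc b) (⊖-cong (suc a) (λ i → trans (factors-count a (suc b) i)
        (cong (λ t → factors 0 t (T^ 0) i) (ℕₚ.+-suc a b)))) j))

-- Multiplied by the denominators for n and d, both sides become the product of
-- all 1 − T^i with i ≤ n + d.
γ-count : ∀ n d → numerator (d ℕ.+ n) n ⊘ denominator n ≗ countSeries n d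
γ-count n d = factors-injective d (factors-injective n λ j → trans
  (swap-factors j) (sym (factors-count n d j)))
  where
  G = numerator (d ℕ.+ n) n ⊘ denominator n
  swap-factors : factors 0 n (factors 0 d G) ≗ factors 0 (n ℕ.+ d) (T^ 0)
  swap-factors j = begin
    factors 0 n (factors 0 d G) j ≡⟨ factors-swap n d G j ⟩
    factors 0 d (factors 0 n G) j ≡⟨ factors-cong 0 d (⊛-∏ G 0 n) j ⟨
    factors 0 d (G ⊛ denominator n) j
      ≡⟨ factors-cong 0 d (⊘-⊛ (numerator (d ℕ.+ n) n) (denominator n) (denominator₀ n)) j ⟩
    factors 0 d (numerator (d ℕ.+ n) n) j
      ≡⟨ cong (λ e → factors 0 d (∏ n (λ k → 1-T^ (e ℕ.+ k))) j) (ℕₚ.m+n∸n≡m d n) ⟩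
    factors 0 d (∏ n (λ k → 1-T^ (d ℕ.+ k))) j ≡⟨ factors-cong 0 d (∏-factors d n) j ⟩
    factors 0 d (factors d n (T^ 0)) j ≡⟨ factors-factors d n (T^ 0) j ⟩
    factors 0 (d ℕ.+ n) (T^ 0) j ≡⟨ cong (λ t → factors 0 t (T^ 0) j) (ℕₚ.+-comm d n) ⟩
    factors 0 (n ℕ.+ d) (T^ 0) j ∎
    where open ≡-Reasoning

-- The product formula of `factors-count` is symmetric in a and b up to the order of the factors, so
-- no conjugate partition has to be constructed.
count-comm : ∀ a b → count a b ≗ count b a
count-comm a b j = ℤₚ.+-injective (factors-injective a (factors-injective b (λ i → trans
  (swap i) (sym (trans (factors-count b a i)
    (cong (λ t → factors 0 t (T^ 0) i) (ℕₚ.+-comm b a)))))) j)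
  where
  swap : factors 0 b (factors 0 a (countSeries a b)) ≗ factors 0 (a ℕ.+ b) (T^ 0)
  swap i = trans (factors-swap b a (countSeries a b) i) (factors-count a b i)

-- Partitions in a rectangle

open PartitionInRectangle

-- All fields other than `parts` are irrelevant, so a partition is determined by its list.
parts-injective : ∀ {a b j} {π ρ : PartitionInRectangle a b j} → parts π ≡ parts ρ → π ≡ ρ
parts-injective {π = record { parts = xs }} {record { parts = .xs }} refl = refl

decreasing-∷ : ∀ {m xs} → All (_≤ m) xs → Linked _≥_ xs → Linked _≥_ (m ∷ xs)
decreasing-∷ [] [] = [-]
decreasing-∷ (x≤m ∷ _) xs↘ = x≤m ∷ xs↘

≤-head : ∀ {m x xs} → x ≤ m → Linked _≥_ (x ∷ xs) → All (_≤ m) (x ∷ xs)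
≤-head x≤m xs↘ with x≥xs ∷ _ ← Linkedₚ.Linked⇒AllPairs (λ x≥y y≥z → ℕₚ.≤-trans y≥z x≥y) xs↘ =
  x≤m ∷ All.map (λ x≥y → ℕₚ.≤-trans x≥y x≤m) x≥xs

module _ {a b : ℕ} where

  -- Partitions of j - m, with the empty type when m > j. The form copies the shift in `count`, so
  -- that `rest-↔` can follow its recursion.
  Rest : ℕ → ℕ → Set
  Rest m = shift ⊥ m (PartitionInRectangle a b)

  -- The equation is irrelevant because it will come from the irrelevant field `size`. It cannot be
  -- matched on, so the recursion is on `m` and `j`.
  rest : ∀ m {i} j → .(m ℕ.+ i ≡ j) → PartitionInRectangle a b i → Rest m j
  rest zero j eq (record { parts = xs ; positive = 0< ; decreasing = ↘ ; size = size
                         ; rows = rows ; columns = cols }) = record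
    { parts = xs ; positive = 0< ; decreasing = ↘
    ; size = trans size eq ; rows = rows ; columns = cols }
  rest (suc m) zero () π
  rest (suc m) (suc j) eq π = rest m j (ℕₚ.suc-injective eq) π

  unrest : ∀ m j → Rest m j → Σ[ i ∈ ℕ ] m ℕ.+ i ≡ j × PartitionInRectangle a b i
  unrest zero j π = j , refl , π
  unrest (suc m) (suc j) π with i , eq , π′ ← unrest m j π = i , cong suc eq , π′

  restParts : ∀ m j → Rest m j → List ℕ
  restParts m j π = parts (proj₂ (proj₂ (unrest m j π)))

  restParts-rest : ∀ m {i} j .(eq : m ℕ.+ i ≡ j) π → restParts m j (rest m j eq π) ≡ parts π
  restParts-rest zero j eq (record {}) = refl
  restParts-rest (suc m) zero () π
  restParts-rest (suc m) (suc j) eq π = restParts-rest m j (ℕₚ.suc-injective eq) π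

  restParts-injective : ∀ m j {π ρ : Rest m j} → restParts m j π ≡ restParts m j ρ → π ≡ ρ
  restParts-injective zero j eq = parts-injective eq
  restParts-injective (suc m) (suc j) eq = restParts-injective m j eq

rest-↔ : ∀ {f : ℕ → ℕ} {F : ℕ → Set} m j → (∀ i → Fin (f i) ↔ F i) →
         Fin (shift 0 m f j) ↔ shift ⊥ m F j
rest-↔ zero j f↔F = f↔F j
rest-↔ (suc m) zero f↔F = Finₚ.0↔⊥
rest-↔ (suc m) (suc j) f↔F = rest-↔ m j f↔F

module _ (a b j : ℕ) where
  private
    R = PartitionInRectangle (suc a) (suc b) j
    S = PartitionInRectangle (suc a) b j
    T = Rest {a} {suc b} (suc b) j

    -- Embeds the disjoint union into lists, which reduces both round trips of `largest-part` to
    -- equalities of lists. The two halves stay disjoint because a list starting with b+1 is not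
    -- bounded by b.
    parts⊎ : S ⊎ T → List ℕ
    parts⊎ (inj₁ π) = parts π
    parts⊎ (inj₂ π) = suc b ∷ restParts (suc b) j π

    parts⊎-injective : ∀ {π ρ} → parts⊎ π ≡ parts⊎ ρ → π ≡ ρ
    parts⊎-injective {inj₁ π} {inj₁ ρ} eq = cong inj₁ (parts-injective eq)
    parts⊎-injective {inj₁ (record { columns = cols })} {inj₂ ρ} eq =
      ⊥-elim-irr (b≱1+b (subst (All (_≤ b)) eq cols))
      where
      b≱1+b : ∀ {xs} → ¬ All (_≤ b) (suc b ∷ xs)
      b≱1+b (1+b≤b ∷ _) = ℕₚ.<-irrefl refl 1+b≤b
    parts⊎-injective {inj₂ π} {inj₁ ρ} eq = sym (parts⊎-injective {inj₁ ρ} {inj₂ π} (sym eq))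
    parts⊎-injective {inj₂ π} {inj₂ ρ} eq =
      cong inj₂ (restParts-injective (suc b) j (Listₚ.∷-injectiveʳ eq))

    split : R → S ⊎ T
    split (record { parts = [] ; size = size }) = inj₁ (record
      { parts = [] ; positive = [] ; decreasing = [] ; size = size ; rows = z≤n ; columns = [] })
    split (record { parts = m ∷ ms ; positive = 0< ; decreasing = ↘ ; size = size ; rows = rows
                  ; columns = columns }) with m ℕ.≟ suc b
    ... | yes refl = inj₂ (rest (suc b) j size (record
      { parts = ms ; positive = All.tail 0< ; decreasing = Linked.tail ↘ ; size = refl
      ; rows = ℕₚ.≤-pred rows ; columns = All.tail columns }))
    -- The head is the largest part, so once it is at most b all parts are.
    ... | no m≢1+b = inj₁ (record
      { parts = m ∷ ms ; positive = 0< ; decreasing = ↘ ; size = size ; rows = rows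
      ; columns = ≤-head (ℕₚ.≤-pred (ℕₚ.≤∧≢⇒< (All.head columns) m≢1+b)) ↘ })

    merge : S ⊎ T → R
    merge (inj₁ (record { parts = xs ; positive = 0< ; decreasing = ↘ ; size = size
                        ; rows = rows ; columns = cols })) = record
      { parts = xs ; positive = 0< ; decreasing = ↘
      ; size = size ; rows = rows ; columns = All.map ℕₚ.m≤n⇒m≤1+n cols }
    merge (inj₂ π) = grow (proj₂ (unrest (suc b) j π))
      where
      grow : ∀ {i} → suc b ℕ.+ i ≡ j × PartitionInRectangle a (suc b) i → R
      grow (eq , record { parts = xs ; positive = 0< ; decreasing = ↘ ; size = size
                        ; rows = rows ; columns = cols }) = record
        { parts = suc b ∷ xs
        ; positive = s≤s z≤n ∷ 0<
        ; decreasing = decreasing-∷ cols ↘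
        ; size = trans (cong (suc b ℕ.+_) size) eq
        ; rows = s≤s rows
        ; columns = ℕₚ.≤-refl ∷ cols }

    parts-merge : ∀ π → parts (merge π) ≡ parts⊎ π
    parts-merge (inj₁ π) = refl
    parts-merge (inj₂ π) = refl

    parts⊎-split : ∀ π → parts⊎ (split π) ≡ parts π
    parts⊎-split (record { parts = [] }) = refl
    parts⊎-split (record { parts = m ∷ ms ; size = size }) with m ℕ.≟ suc b
    ... | yes refl = cong (suc b ∷_) (restParts-rest (suc b) j size _)
    ... | no m≢1+b = refl

  largest-part : R ↔ (S ⊎ T)
  largest-part = mk↔ₛ′ split merge
    (λ π → parts⊎-injective (trans (parts⊎-split (merge π)) (parts-merge π)))
    (λ π → parts-injective (trans (parts-merge (split π)) (parts⊎-split π)))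

no-rows : ∀ {b j} → PartitionInRectangle 0 b (suc j) → ⊥
no-rows (record { parts = [] ; size = () })
no-rows (record { parts = _ ∷ _ ; rows = () })

no-columns : ∀ {a j} (π : PartitionInRectangle a 0 j) → parts π ≡ []
no-columns (record { parts = [] }) = refl
no-columns (record { parts = _ ∷ _ ; positive = 0< ; columns = columns }) =
  ⊥-elim-irr (ℕₚ.<⇒≱ (All.head 0<) (All.head columns))

no-columns-suc : ∀ {a j} → PartitionInRectangle a 0 (suc j) → ⊥
no-columns-suc π@(record { parts = xs ; size = size })
  with () ← recompute (_ ℕ.≟ _) (trans (cong sumˡ (sym (no-columns π))) size)

empty : ∀ {a b} → PartitionInRectangle a b 0
empty = record
  { parts = [] ; positive = [] ; decreasing = [] ; size = refl ; rows = z≤n ; columns = [] }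

unique-↔ : ∀ {A : Set} (x : A) → (∀ y → x ≡ y) → Fin 1 ↔ A
unique-↔ x x≡ = mk↔ₛ′ (λ _ → x) (λ _ → zero) x≡ (λ { zero → refl })

empty-↔ : ∀ {A : Set} → (A → ⊥) → Fin 0 ↔ A
empty-↔ ¬A = mk↔ₛ′ (λ ()) (λ x → ⊥-elim (¬A x)) (λ x → ⊥-elim (¬A x)) (λ ())

count-↔ : ∀ a b j → Fin (count a b j) ↔ PartitionInRectangle a b j
count-↔ zero b zero = unique-↔ empty λ
  { (record { parts = [] }) → refl ; (record { parts = _ ∷ _ ; rows = () }) }
count-↔ zero b (suc j) = empty-↔ no-rows
count-↔ (suc a) zero zero = unique-↔ empty (λ π → parts-injective (sym (no-columns π)))
count-↔ (suc a) zero (suc j) = empty-↔ no-columns-suc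
count-↔ (suc a) (suc b) j =
  ↔-sym (largest-part a b j)
  ↔-∘ ((count-↔ (suc a) b j ⊎-↔ rest-↔ (suc b) j (count-↔ a (suc b))) ↔-∘ Finₚ.+↔⊎)

-- Orbits of exponent vectors

≥-decTotalOrder : DecTotalOrder _ _ _
≥-decTotalOrder = Flip.decTotalOrder ℕₚ.≤-decTotalOrder

open import Data.List.Sort ≥-decTotalOrder using (sort; sort-↭; sort-↗)

decreasing-↭⇒≡ : ∀ {xs ys} → Linked _≥_ xs → Linked _≥_ ys → xs ↭ ys → xs ≡ ys
decreasing-↭⇒≡ xs↘ ys↘ xs↭ys = Pointwise.Pointwise-≡⇒≡
  (Sortedₚ.↗↭↗⇒≋ (DecTotalOrder.totalOrder ≥-decTotalOrder) xs↘ ys↘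
    (↭⇒↭ₛ′ (DecTotalOrder.isEquivalence ≥-decTotalOrder) xs↭ys))

nonzero : List ℕ → List ℕ
nonzero = List.filter (0 ℕ.<?_)

nonzero-↭ : ∀ xs → xs ↭ nonzero xs ++ List.replicate (List.length xs ∸ List.length (nonzero xs)) 0
nonzero-↭ [] = ↭.refl
nonzero-↭ (zero ∷ xs) = ↭-trans (↭.prep 0 (nonzero-↭ xs))
  (subst (λ k → 0 ∷ nonzero xs ++ List.replicate (List.length xs ∸ List.length (nonzero xs)) 0
                ↭ nonzero xs ++ List.replicate k 0)
    (sym (ℕₚ.+-∸-assoc 1 (Listₚ.length-filter (0 ℕ.<?_) xs)))
    (↭-sym (↭ₚ.shift 0 (nonzero xs) _)))
nonzero-↭ (suc x ∷ xs) = ↭.prep (suc x) (nonzero-↭ xs)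

sum-nonzero : ∀ xs → sumˡ (nonzero xs) ≡ sumˡ xs
sum-nonzero [] = refl
sum-nonzero (zero ∷ xs) = sum-nonzero xs
sum-nonzero (suc x ∷ xs) = cong (suc x ℕ.+_) (sum-nonzero xs)

∣_∣ : ∀ {n} → Vec ℕ n → ℕ
∣ α ∣ = sumˡ (toList α)

-- A canonical name for the orbit of α under permutations of the variables, in the form of a
-- partition. Zeros are dropped because parts are positive.
key : ∀ {n} → Vec ℕ n → List ℕ
key α = sort (nonzero (toList α))

key-↭ : ∀ {n} (α : Vec ℕ n) → key α ↭ nonzero (toList α)
key-↭ α = sort-↭ (nonzero (toList α))

key-cong : ∀ {n} {α β : Vec ℕ n} → toList α ↭ toList β → key α ≡ key β
key-cong {α = α} {β} α↭β = decreasing-↭⇒≡ (sort-↗ _) (sort-↗ _)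
  (↭-trans (key-↭ α) (↭-trans (↭ₚ.filter-↭ (0 ℕ.<?_) α↭β) (↭-sym (key-↭ β))))

sum-key : ∀ {n} (α : Vec ℕ n) → sumˡ (key α) ≡ ∣ α ∣
sum-key α = trans (sum-↭ (key-↭ α)) (sum-nonzero (toList α))

↭-key : ∀ {n} (α : Vec ℕ n) → toList α ↭ key α ++ List.replicate (n ∸ List.length (key α)) 0
↭-key {n} α = ↭-trans (nonzero-↭ (toList α)) (subst
  (λ k → nonzero (toList α) ++ List.replicate k 0
         ↭ key α ++ List.replicate (n ∸ List.length (key α)) 0)
  (cong₂ _∸_ (sym (trans (Vecₚ.length-toList α) refl)) (↭ₚ.↭-length (key-↭ α)))
  (↭ₚ.++⁺ʳ _ (↭-sym (key-↭ α))))

-- The number of zeros dropped by `key` is recovered from the common length `n`.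
key-injective : ∀ {n} (α β : Vec ℕ n) → key α ≡ key β → toList α ↭ toList β
key-injective {n} α β eq = ↭-trans (↭-key α) (↭-trans
  (↭.↭-reflexive (cong (λ xs → xs ++ List.replicate (n ∸ List.length xs) 0) eq))
  (↭-sym (↭-key β)))

Symmetric-∷ : ∀ {n} {f : Coefficients (suc n)} → Symmetric f → ∀ x → Symmetric (λ α → f (x ∷ α))
Symmetric-∷ f-sym x σ α = f-sym (Perm.lift₀ σ) (x ∷ α)

-- `Symmetric` speaks of permutations of indices, `_↭_` of derivations on lists. Induction on the
-- derivation needs only the transposition of the first two variables, because fixing a leading
-- exponent leaves a symmetric family in the others; hence `f` varies in the induction.
Symmetric-↭ : ∀ {xs ys} → xs ↭ ys → ∀ {n} {α β : Vec ℕ n} → toList α ≡ xs → toList β ≡ ys →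
  ∀ {f} → Symmetric f → f α ≡ f β
Symmetric-↭ ↭.refl {α = α} {β} refl β≡α {f} f-sym =
  cong f (sym (trans (sym (Vecₚ.cast-is-id refl β)) (Vecₚ.toList-injective refl β α β≡α)))
Symmetric-↭ (↭.prep x xs↭ys) {α = _ ∷ _} {_ ∷ _} refl refl f-sym =
  Symmetric-↭ xs↭ys refl refl (Symmetric-∷ f-sym x)
Symmetric-↭ (↭.swap x y xs↭ys) {α = _ ∷ _ ∷ α} {_ ∷ _ ∷ β} refl refl {f} f-sym = trans
  (trans (sym (f-sym (Perm.transpose zero (suc zero)) (x ∷ y ∷ α)))
    (cong (λ ε → f (y ∷ x ∷ ε)) (Vecₚ.tabulate∘lookup α)))
  (Symmetric-↭ xs↭ys refl refl (Symmetric-∷ (Symmetric-∷ f-sym y) x))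
Symmetric-↭ (↭.trans {ys = zs} p q) {α = α} {β} refl refl f-sym =
  trans (Symmetric-↭ p {β = ζ} refl ζ≡ f-sym) (Symmetric-↭ q {α = ζ} ζ≡ refl f-sym)
  where
  length-zs = trans (sym (↭ₚ.↭-length p)) (Vecₚ.length-toList α)
  -- The intermediate list of a transitivity step has length `n` too, hence comes from an exponent
  -- vector.
  ζ = Vec.cast length-zs (Vec.fromList zs)
  ζ≡ : toList ζ ≡ zs
  ζ≡ = trans (Vecₚ.toList-cast length-zs (Vec.fromList zs)) (Vecₚ.toList∘fromList zs)

Symmetric-key : ∀ {n} {f : Coefficients n} → Symmetric f → ∀ α β → key α ≡ key β → f α ≡ f β
Symmetric-key f-sym α β eq = Symmetric-↭ (key-injective α β eq) refl refl f-sym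

tabulate-punchIn : ∀ {n} (f : Fin (suc n) → ℕ) p →
  toList (tabulate f) ↭ f p ∷ toList (tabulate (f ∘ punchIn p))
tabulate-punchIn f zero = ↭.refl
tabulate-punchIn {suc n} f (suc p) =
  ↭-trans (↭.prep (f zero) (tabulate-punchIn (f ∘ suc) p)) (↭.swap (f zero) (f (suc p)) ↭.refl)

-- Induction on `n`: the value at the image of 0 is moved to the front, and `Perm.remove zero σ`
-- permutes the remaining indices.
tabulate-permute : ∀ {n} (f : Fin n → ℕ) (σ : Permutation′ n) →
  toList (tabulate (f ∘ (σ ⟨$⟩ʳ_))) ↭ toList (tabulate f)
tabulate-permute {zero} f σ = ↭.refl
tabulate-permute {suc n} f σ = ↭-trans
  (↭.prep (f (σ ⟨$⟩ʳ zero)) (↭-trans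
    (↭.↭-reflexive (cong toList
      (Vecₚ.tabulate-cong (λ k → cong f (Perm.punchIn-permute σ zero k)))))
    (tabulate-permute (f ∘ punchIn (σ ⟨$⟩ʳ zero)) (Perm.remove zero σ))))
  (↭-sym (tabulate-punchIn f (σ ⟨$⟩ʳ zero)))

permute-↭ : ∀ {n} (σ : Permutation′ n) α → toList (permute σ α) ↭ toList α
permute-↭ σ α = ↭-trans (tabulate-permute (lookup α) σ)
  (↭.↭-reflexive (cong toList (Vecₚ.tabulate∘lookup α)))

key-permute : ∀ {n} (σ : Permutation′ n) α → key (permute σ α) ≡ key α
key-permute σ α = key-cong (permute-↭ σ α)

∣permute∣ : ∀ {n} (σ : Permutation′ n) (α : Vec ℕ n) → ∣ permute σ α ∣ ≡ ∣ α ∣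
∣permute∣ σ α = sum-↭ (permute-↭ σ α)

-- Padding with zeros; parts beyond the n-th are dropped.
pad : ∀ n → List ℕ → Vec ℕ n
pad zero xs = []
pad (suc n) [] = 0 ∷ pad n []
pad (suc n) (x ∷ xs) = x ∷ pad n xs

nonzero-pad : ∀ n {xs} → All (0 <_) xs → List.length xs ≤ n → nonzero (toList (pad n xs)) ≡ xs
nonzero-pad zero {[]} [] _ = refl
nonzero-pad (suc n) {[]} [] _ = nonzero-pad n [] z≤n
nonzero-pad (suc n) {suc x ∷ xs} (_ ∷ 0<xs) (s≤s xs≤n) = cong (suc x ∷_) (nonzero-pad n 0<xs xs≤n)

module _ {n d s : ℕ} where
  open PartitionInRectangle

  representative : PartitionInRectangle n d s → Vec ℕ n
  representative π = pad n (parts π)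

  key-representative : (π : PartitionInRectangle n d s) → key (representative π) ≡ parts π
  key-representative (record { parts = xs ; positive = 0< ; decreasing = ↘ ; rows = rows }) =
    -- The fields of a partition are irrelevant but decidable, so they can be recomputed.
    decreasing-↭⇒≡ (sort-↗ _) (recompute (Linked.linked? (λ x y → y ℕ.≤? x) xs) ↘)
      (↭-trans (key-↭ (pad n xs)) (↭.↭-reflexive
        (nonzero-pad n (recompute (All.all? (0 ℕ.<?_) xs) 0<) (recompute (_ ℕ.≤? _) rows))))

  parts-≤ : (π : PartitionInRectangle n d s) → All (_≤ d) (parts π)
  parts-≤ (record { parts = xs ; columns = cols }) = recompute (All.all? (ℕ._≤? d) xs) cols

  sum-parts : (π : PartitionInRectangle n d s) → sumˡ (parts π) ≡ s
  sum-parts (record { parts = xs ; size = size }) = recompute (_ ℕ.≟ _) size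

  toPartition : (α : Vec ℕ n) → (∀ k → lookup α k ≤ d) → ∣ α ∣ ≡ s → PartitionInRectangle n d s
  toPartition α α≤d ∣α∣≡s = record
    { parts = key α
    ; positive = ↭ₚ.All-resp-↭ (↭-sym (key-↭ α)) (Allₚ.all-filter (0 ℕ.<?_) (toList α))
    ; decreasing = sort-↗ (nonzero (toList α))
    ; size = trans (sum-key α) ∣α∣≡s
    ; rows = subst₂ _≤_ (sym (↭ₚ.↭-length (key-↭ α))) (Vecₚ.length-toList α)
        (Listₚ.length-filter (0 ℕ.<?_) (toList α))
    ; columns = ↭ₚ.All-resp-↭ (↭-sym (key-↭ α)) (Allₚ.filter⁺ (0 ℕ.<?_) (all α α≤d)) }
    where
    all : ∀ {m} (α : Vec ℕ m) → (∀ k → lookup α k ≤ d) → All (_≤ d) (toList α)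
    all [] _ = []
    all (x ∷ α) ≤d = ≤d zero ∷ all α (≤d ∘ suc)

key-≤ : ∀ {n d} (α : Vec ℕ n) → All (_≤ d) (key α) → ∀ k → lookup α k ≤ d
key-≤ {d = d} α key≤d = go (toList α) (↭ₚ.All-resp-↭ (key-↭ α) key≤d) α refl
  where
  go : ∀ {m} xs → All (_≤ d) (nonzero xs) → (β : Vec ℕ m) → toList β ≡ xs → ∀ k → lookup β k ≤ d
  go _ ≤d (zero ∷ β) refl zero = z≤n
  go _ ≤d (zero ∷ β) refl (suc k) = go _ ≤d β refl k
  go _ (x≤d ∷ _) (suc x ∷ β) refl zero = x≤d
  go _ (_ ∷ ≤d) (suc x ∷ β) refl (suc k) = go _ ≤d β refl k

∣∣-≤ : ∀ {n d} (α : Vec ℕ n) → (∀ k → lookup α k ≤ d) → ∣ α ∣ ≤ n ℕ.* d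
∣∣-≤ [] _ = z≤n
∣∣-≤ (x ∷ α) ≤d = ℕₚ.+-mono-≤ (≤d zero) (∣∣-≤ α (≤d ∘ suc))

-- Linear algebra over ℚ: bases of subspaces, rank-nullity, linear identities

module LinearAlgebra where

  open import Data.Rational using (_+_; _*_; -_; _-_)

  *-cancel-0 : ∀ {p q} → p ≢ 0ℚ → p * q ≡ 0ℚ → q ≡ 0ℚ
  *-cancel-0 {p} {q} p≢0 pq≡0 = begin
    q ≡⟨ ℚₚ.*-identityˡ q ⟨
    1ℚ * q ≡⟨ cong (_* q) (ℚₚ.*-inverseˡ p) ⟨
    ℚ.1/ p * p * q ≡⟨ ℚₚ.*-assoc (ℚ.1/ p) p q ⟩
    ℚ.1/ p * (p * q) ≡⟨ cong (ℚ.1/ p *_) pq≡0 ⟩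
    ℚ.1/ p * 0ℚ ≡⟨ ℚₚ.*-zeroʳ (ℚ.1/ p) ⟩
    0ℚ ∎
    where
    open ≡-Reasoning
    instance p-nonZero = ℚ.≢-nonZero p≢0

  solve-pivot : ∀ a f f⁻¹ t → f * f⁻¹ ≡ 1ℚ → a * f + t ≡ 0ℚ → a ≡ t * - f⁻¹
  solve-pivot a f f⁻¹ t ff⁻¹≡1 af+t≡0 = begin
    a ≡⟨ ℚₚ.*-identityʳ a ⟨
    a * 1ℚ ≡⟨ cong (a *_) ff⁻¹≡1 ⟨
    a * (f * f⁻¹)
      ≡⟨ solve 4 (λ a f i t → a :* (f :* i) := (a :* f :+ t) :* i :+ t :* (:- i)) refl a f f⁻¹ t ⟩
    (a * f + t) * f⁻¹ + t * - f⁻¹ ≡⟨ cong (λ s → s * f⁻¹ + t * - f⁻¹) af+t≡0 ⟩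
    0ℚ * f⁻¹ + t * - f⁻¹ ≡⟨ cong (_+ t * - f⁻¹) (ℚₚ.*-zeroˡ f⁻¹) ⟩
    0ℚ + t * - f⁻¹ ≡⟨ ℚₚ.+-identityˡ (t * - f⁻¹) ⟩
    t * - f⁻¹ ∎
    where
    open ≡-Reasoning
    open ℚSolver.+-*-Solver

  module Sums (M : VectorSpace) where
    open LeftModule M
    open CommutativeMonoidSum +ᴹ-commutativeMonoid public

    lincomb : ∀ {n} → (Fin n → ℚ) → (Fin n → Carrierᴹ) → Carrierᴹ
    lincomb a v = sum (λ q → a q *ₗ v q)

    sum-0 : ∀ {n} (v : Fin n → Carrierᴹ) → (∀ q → v q ≈ᴹ 0ᴹ) → sum v ≈ᴹ 0ᴹ
    sum-0 {n} v v≈0 = ≈ᴹ-trans (sum-cong-≋ v≈0) (sum-replicate-zero n)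

  module _ (M N : VectorSpace) {f : LeftModule.Carrierᴹ M → LeftModule.Carrierᴹ N}
           (f-linear : IsLinear M N f) where
    private
      module M = LeftModule M
      module N = LeftModule N
      module ∑M = Sums M
      module ∑N = Sums N
    open LeftModuleMorphisms.IsLeftModuleHomomorphism f-linear

    linear-sum : ∀ {n} (v : Fin n → M.Carrierᴹ) → f (∑M.sum v) N.≈ᴹ ∑N.sum (f ∘ v)
    linear-sum {zero} v = 0ᴹ-homo
    linear-sum {suc n} v = N.≈ᴹ-trans (+ᴹ-homo (v zero) (∑M.sum (v ∘ suc)))
      (N.+ᴹ-cong N.≈ᴹ-refl (linear-sum (v ∘ suc)))

    linear-lincomb : ∀ {n} (a : Fin n → ℚ) v → f (∑M.lincomb a v) N.≈ᴹ ∑N.lincomb a (f ∘ v)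
    linear-lincomb a v = N.≈ᴹ-trans (linear-sum (λ q → a q M.*ₗ v q))
      (∑N.sum-cong-≋ (λ q → *ₗ-homo (a q) (v q)))

  module Bases (M : VectorSpace) where
    open LeftModule M
    open Sums M
    open SetoidReasoning ≈ᴹ-setoid
    private module ∑ℚ = Sums ℚ¹

    *ₗ-linear : ∀ v → IsLinear ℚ¹ M (_*ₗ v)
    *ₗ-linear v = linear ℚ¹ M (_*ₗ v) (λ p → *ₗ-cong p ≈ᴹ-refl)
      (λ a b → *ₗ-distribʳ v a b) (λ a b → *ₗ-assoc a b v)

    -- A subspace is a predicate on `M`, so its vectors remain vectors of `M` and the operators
    -- apply to them without coercions.
    record IsSubspace (S : Carrierᴹ → Set) : Set where
      field
        ∈-resp : ∀ {u v} → u ≈ᴹ v → S u → S v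
        0∈ : S 0ᴹ
        +∈ : ∀ {u v} → S u → S v → S (u +ᴹ v)
        *∈ : ∀ a {v} → S v → S (a *ₗ v)

      sum∈ : ∀ {n} (v : Fin n → Carrierᴹ) → (∀ q → S (v q)) → S (sum v)
      sum∈ {zero} v v∈S = 0∈
      sum∈ {suc n} v v∈S = +∈ (v∈S zero) (sum∈ (v ∘ suc) (v∈S ∘ suc))

      lincomb∈ : ∀ {n} (a : Fin n → ℚ) v → (∀ q → S (v q)) → S (lincomb a v)
      lincomb∈ a v v∈S = sum∈ (λ q → a q *ₗ v q) (λ q → *∈ (a q) (v∈S q))

    record Basis (S : Carrierᴹ → Set) (n : ℕ) : Set where
      field
        vec : Fin n → Carrierᴹ
        vec∈ : ∀ q → S (vec q)
        independent : ∀ a → lincomb a vec ≈ᴹ 0ᴹ → ∀ q → a q ≡ 0ℚ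
        spans : ∀ {v} → S v → ∃[ a ] v ≈ᴹ lincomb a vec

    Basis-resp : ∀ {S T n} → (∀ {v} → S v → T v) → (∀ {v} → T v → S v) → Basis S n → Basis T n
    Basis-resp S⇒T T⇒S B = record
      { vec = vec ; vec∈ = S⇒T ∘ vec∈ ; independent = independent ; spans = spans ∘ T⇒S }
      where open Basis B

    -- The elementary operation of elimination: adding multiples of a pivot `w` to all vectors
    -- changes only the coefficient of `w` in a combination. It is used in one direction for
    -- independence and in the other for spanning.
    lincomb-shear : ∀ {n} (a r : Fin n → ℚ) v w →
      lincomb a (λ q → v q +ᴹ r q *ₗ w) ≈ᴹ ℚΣ.sum (λ q → a q * r q) *ₗ w +ᴹ lincomb a v
    lincomb-shear a r v w = begin
      lincomb a (λ q → v q +ᴹ r q *ₗ w)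
        ≈⟨ sum-cong-≋ (λ q → *ₗ-distribˡ (a q) (v q) (r q *ₗ w)) ⟩
      sum (λ q → a q *ₗ v q +ᴹ a q *ₗ r q *ₗ w)
        ≈⟨ ∑-distrib-+ (λ q → a q *ₗ v q) (λ q → a q *ₗ r q *ₗ w) ⟩
      lincomb a v +ᴹ sum (λ q → a q *ₗ r q *ₗ w)
        ≈⟨ +ᴹ-cong ≈ᴹ-refl (sum-cong-≋ (λ q → ≈ᴹ-sym (*ₗ-assoc (a q) (r q) w))) ⟩
      lincomb a v +ᴹ sum (λ q → (a q * r q) *ₗ w)
        ≈⟨ +ᴹ-cong ≈ᴹ-refl (≈ᴹ-sym (linear-sum ℚ¹ M (*ₗ-linear w) (λ q → a q * r q))) ⟩
      lincomb a v +ᴹ ℚΣ.sum (λ q → a q * r q) *ₗ w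
        ≈⟨ +ᴹ-comm _ _ ⟩
      ℚΣ.sum (λ q → a q * r q) *ₗ w +ᴹ lincomb a v ∎

    lincomb-remove : ∀ {n} (a : Fin (suc n) → ℚ) v p →
      lincomb a v ≈ᴹ a p *ₗ v p +ᴹ lincomb (a ∘ punchIn p) (v ∘ punchIn p)
    lincomb-remove a v p = sum-remove (λ q → a q *ₗ v q)

    module _ {S : Carrierᴹ → Set} (S-sub : IsSubspace S)
             {φ : Carrierᴹ → ℚ} (φ-linear : IsLinear M ℚ¹ φ) where
      open IsSubspace S-sub
      open LeftModuleMorphisms.IsLeftModuleHomomorphism φ-linear

      ker-subspace : IsSubspace (λ v → S v × φ v ≡ 0ℚ)
      ker-subspace = record
        { ∈-resp = λ u≈v (u∈S , φu≡0) → ∈-resp u≈v u∈S , trans (sym (⟦⟧-cong u≈v)) φu≡0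
        ; 0∈ = 0∈ , 0ᴹ-homo
        ; +∈ = λ {u} {v} (u∈S , φu≡0) (v∈S , φv≡0) →
            +∈ u∈S v∈S , trans (+ᴹ-homo u v) (cong₂ _+_ φu≡0 φv≡0)
        ; *∈ = λ a {v} (v∈S , φv≡0) →
            *∈ a v∈S , trans (*ₗ-homo a v) (trans (cong (a *_) φv≡0) (ℚₚ.*-zeroʳ a)) }

      -- If φ vanished on the whole basis, it would vanish on x. Decidable equality on ℚ and
      -- finiteness of the basis turn this into an explicit index.
      pivot : ∀ {n} (B : Basis S n) {x} → S x → φ x ≢ 0ℚ → ∃[ p ] φ (Basis.vec B p) ≢ 0ℚ
      pivot {n} B {x} x∈S φx≢0 =
        Finₚ.¬∀⟶∃¬ n (λ p → φ (vec p) ≡ 0ℚ) (λ p → φ (vec p) ℚ.≟ 0ℚ) λ φvec≡0 →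
          let a , x≈ = spans x∈S in
          φx≢0 (trans (⟦⟧-cong x≈) (trans (linear-lincomb M ℚ¹ φ-linear a vec)
            (∑-zero (λ q → a q * φ (vec q))
              (λ q → trans (cong (a q *_) (φvec≡0 q)) (ℚₚ.*-zeroʳ (a q))))))
        where open Basis B

      -- Gaussian elimination of the coordinate φ, with pivot vec p.
      ker-basis-at : ∀ {n} (B : Basis S (suc n)) p → φ (Basis.vec B p) ≢ 0ℚ →
                     Basis (λ v → S v × φ v ≡ 0ℚ) n
      ker-basis-at {n} B p φp≢0 = record
        { vec = vec′ ; vec∈ = λ q → +∈ (vec∈ (punchIn p q)) (*∈ (r q) (vec∈ p)) , φvec′ q
        ; independent = independent′ ; spans = spans′ }
        where
        open Basis B
        instance φp-nonZero = ℚ.≢-nonZero φp≢0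
        φp⁻¹ = ℚ.1/ (φ (vec p))
        -- The multiple of the pivot that makes φ vanish on `vec′ q`.
        r : Fin n → ℚ
        r q = - (φ (vec (punchIn p q)) * φp⁻¹)
        vec′ : Fin n → Carrierᴹ
        vec′ q = vec (punchIn p q) +ᴹ r q *ₗ vec p

        cancel : ∀ y → - (y * φp⁻¹) * φ (vec p) ≡ - y
        cancel y = trans
          (solve 3 (λ y i f → :- (y :* i) :* f := :- (y :* (i :* f))) refl y φp⁻¹ (φ (vec p)))
          (cong -_ (trans (cong (y *_) (ℚₚ.*-inverseˡ (φ (vec p)))) (ℚₚ.*-identityʳ y)))
          where open ℚSolver.+-*-Solver

        φvec′ : ∀ q → φ (vec′ q) ≡ 0ℚ
        φvec′ q = trans (+ᴹ-homo _ _)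
          (trans (cong (λ t → φ (vec (punchIn p q)) + t)
            (trans (*ₗ-homo (r q) (vec p)) (cancel (φ (vec (punchIn p q))))))
          (ℚₚ.+-inverseʳ (φ (vec (punchIn p q)))))

        independent′ : ∀ a → lincomb a vec′ ≈ᴹ 0ᴹ → ∀ q → a q ≡ 0ℚ
        independent′ a a≈0 q = trans (sym (VFₚ.insertAt-punchIn a p s q))
          (independent a′ a′≈0 (punchIn p q))
          where
          -- The coefficient that a combination of the vectors `vec′` collects on the pivot.
          s = ℚΣ.sum (λ q → a q * r q)
          a′ = insertAt a p s
          a′≈0 : lincomb a′ vec ≈ᴹ 0ᴹ
          a′≈0 = begin
            lincomb a′ vec ≈⟨ lincomb-remove a′ vec p ⟩
            a′ p *ₗ vec p +ᴹ lincomb (a′ ∘ punchIn p) (vec ∘ punchIn p)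
              ≈⟨ +ᴹ-cong (*ₗ-cong (VFₚ.insertAt-lookup a p s) ≈ᴹ-refl)
                   (sum-cong-≋ (λ q → *ₗ-cong (VFₚ.insertAt-punchIn a p s q) ≈ᴹ-refl)) ⟩
            s *ₗ vec p +ᴹ lincomb a (vec ∘ punchIn p)
              ≈⟨ lincomb-shear a r (vec ∘ punchIn p) (vec p) ⟨
            lincomb a vec′ ≈⟨ a≈0 ⟩
            0ᴹ ∎

        spans′ : ∀ {v} → S v × φ v ≡ 0ℚ → ∃[ a ] v ≈ᴹ lincomb a vec′
        spans′ {v} (v∈S , φv≡0) with a , v≈ ← spans v∈S = a ∘ punchIn p , (begin
          v ≈⟨ v≈ ⟩
          lincomb a vec ≈⟨ lincomb-remove a vec p ⟩
          a p *ₗ vec p +ᴹ lincomb (a ∘ punchIn p) (vec ∘ punchIn p)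
            ≈⟨ +ᴹ-cong (*ₗ-cong ap≡ ≈ᴹ-refl) ≈ᴹ-refl ⟩
          ℚΣ.sum (λ q → a (punchIn p q) * r q) *ₗ vec p +ᴹ lincomb (a ∘ punchIn p) (vec ∘ punchIn p)
            ≈⟨ lincomb-shear (a ∘ punchIn p) r (vec ∘ punchIn p) (vec p) ⟨
          lincomb (a ∘ punchIn p) vec′ ∎)
          where
          -- `φ v ≡ 0ℚ` is one linear equation between the coefficients of v, and it determines
          -- `a p` from the others.
          t = ℚΣ.sum (λ q → a (punchIn p q) * φ (vec (punchIn p q)))
          φv≡ : a p * φ (vec p) + t ≡ 0ℚ
          φv≡ = trans (sym (∑ℚ.sum-remove (λ q → a q * φ (vec q))))
            (trans (sym (linear-lincomb M ℚ¹ φ-linear a vec)) (trans (sym (⟦⟧-cong v≈)) φv≡0))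
          open ℚSolver.+-*-Solver
          ap≡ : a p ≡ ℚΣ.sum (λ q → a (punchIn p q) * r q)
          ap≡ = trans (solve-pivot (a p) (φ (vec p)) φp⁻¹ t (ℚₚ.*-inverseʳ (φ (vec p))) φv≡)
            (trans (ℚΣ.*-distribʳ-sum (- φp⁻¹) (λ q → a (punchIn p q) * φ (vec (punchIn p q))))
              (ℚΣ.sum-cong-≋ (λ q → solve 3 (λ a f i → a :* f :* (:- i) := a :* (:- (f :* i)))
                refl (a (punchIn p q)) (φ (vec (punchIn p q))) φp⁻¹)))

      ker-basis : ∀ {n x} → Basis S n → S x → φ x ≢ 0ℚ →
                  ∃[ k ] suc k ≡ n × Basis (λ v → S v × φ v ≡ 0ℚ) k
      ker-basis {suc k} B x∈S φx≢0 with p , φp≢0 ← pivot B x∈S φx≢0 =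
        k , refl , ker-basis-at B p φp≢0
      ker-basis {zero} B x∈S φx≢0 with () ← proj₁ (pivot B x∈S φx≢0)

    -- The functionals are imposed one at a time, each lowering the dimension by exactly one. Joint
    -- surjectivity supplies a vector on which the first is nonzero, and it survives on the kernel
    -- of the first: prescribe 0 there and the wanted values for the rest.
    rank-nullity : ∀ {S n} b → IsSubspace S → Basis S n →
      (φ : Fin b → Carrierᴹ → ℚ) → (∀ k → IsLinear M ℚ¹ (φ k)) →
      (∀ (y : Fin b → ℚ) → ∃[ x ] S x × (∀ k → φ k x ≡ y k)) →
      ∃[ m ] m ℕ.+ b ≡ n × Basis (λ v → S v × (∀ k → φ k v ≡ 0ℚ)) m
    rank-nullity {n = n} zero S-sub B φ φ-linear φ-onto =
      n , ℕₚ.+-identityʳ n , Basis-resp (λ v∈S → v∈S , λ ()) proj₁ B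
    rank-nullity (suc b) S-sub B φ φ-linear φ-onto
      with x , x∈S , φx≡ ← φ-onto (λ _ → 1ℚ)
      with k , refl , K ← ker-basis S-sub (φ-linear zero) B x∈S
                            (λ φx≡0 → ℚₚ.1≢0 (trans (sym (φx≡ zero)) φx≡0))
      with m , m+b≡k , L ← rank-nullity b (ker-subspace S-sub (φ-linear zero)) K
                             (φ ∘ suc) (φ-linear ∘ suc)
                             (λ y → let x , x∈S , φx≡ = φ-onto (λ { zero → 0ℚ ; (suc k) → y k }) in
                                    x , (x∈S , φx≡ zero) , φx≡ ∘ suc)
      = m , trans (ℕₚ.+-suc m b) (cong suc m+b≡k) , Basis-resp
        (λ ((v∈S , φ₀≡0) , φ₊≡0) → v∈S , λ { zero → φ₀≡0 ; (suc k) → φ₊≡0 k })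
        (λ (v∈S , φ≡0) → (v∈S , φ≡0 zero) , φ≡0 ∘ suc) L

  -- A copy of fromℕ that does not compute, so that weights are not normalised to
  -- quotients in lowest terms.
  abstract
    ι : ℕ → ℚ
    ι = fromℕ

    ι≡fromℕ : ∀ n → ι n ≡ fromℕ n
    ι≡fromℕ n = refl

    ι-+ : ∀ m n → ι (m ℕ.+ n) ≡ ι m + ι n
    ι-+ = fromℕ-+

    ι-* : ∀ m n → ι (m ℕ.* n) ≡ ι m * ι n
    ι-* = fromℕ-*

    ι-injective : ∀ {m n} → ι m ≡ ι n → m ≡ n
    ι-injective refl = refl

    recip : ℕ → ℚ
    recip m = ℚ.1/ fromℕ (suc m)

    recip-inverseˡ : ∀ m → recip m * ι (suc m) ≡ 1ℚ
    recip-inverseˡ m = ℚₚ.*-inverseˡ (fromℕ (suc m))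

  ι-0 : ι 0 ≡ 0ℚ
  ι-0 = ι≡fromℕ 0

  ι-suc : ∀ m → ι (suc m) ≡ 1ℚ + ι m
  ι-suc m = trans (ι-+ 1 m) (cong (_+ ι m) (ι≡fromℕ 1))

  -ι-suc-suc : ∀ n → - ι (suc (suc n)) + fromℕ 2 ≡ - ι n
  -ι-suc-suc n = eq (ι n) (ι (suc n)) (ι (suc (suc n))) (ι-suc n) (ι-suc (suc n))
    where
    open ℚSolver.+-*-Solver
    eq : ∀ a b c → b ≡ 1ℚ + a → c ≡ 1ℚ + b → - c + fromℕ 2 ≡ - a
    eq a _ _ refl refl = solve 1 (λ a → :- (con 1ℚ :+ (con 1ℚ :+ a)) :+ con (fromℕ 2) := :- a)
      refl a

  descent-factor : ∀ l k′ k t s → t ≡ l + k → s ≡ k′ * t →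
                   k′ * (- l - fromℕ 2 * k + k) ≡ - s
  descent-factor l k′ k _ _ refl refl = solve 3 (λ l k′ k →
    k′ :* (:- l :- con (fromℕ 2) :* k :+ k) := :- (k′ :* (l :+ k))) refl l k′ k
    where open ℚSolver.+-*-Solver

  descent-weight : ∀ l a b c → b ≡ a → c ≡ l + b → - l - a ≡ - c
  descent-weight l a _ _ refl refl = solve 2 (λ l a → :- l :- a := :- (l :+ a)) refl l a
    where open ℚSolver.+-*-Solver

  module Combinations (M : VectorSpace) where
    open LeftModule M
    open Sums M
    open Bases M using (*ₗ-linear)

    sum-δ : ∀ {n} (l : Fin n) (f : Fin n → Carrierᴹ) →
            sum (λ j → δ (toℕ l) (toℕ j) *ₗ f j) ≈ᴹ f l
    sum-δ zero f = ≈ᴹ-trans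
      (+ᴹ-cong (*ₗ-identityˡ (f zero)) (sum-0 _ (λ j → *ₗ-zeroˡ (f (suc j)))))
      (+ᴹ-identityʳ (f zero))
    sum-δ (suc l) f = ≈ᴹ-trans (+ᴹ-cong (*ₗ-zeroˡ (f zero)) (sum-δ l (f ∘ suc)))
      (+ᴹ-identityˡ (f (suc l)))

    infixl 6 _⊕_ _⊝_
    infixr 7 _⊙_
    -- Reflected linear expressions. By `combine`, an identity between vectors reduces to one
    -- identity in ℚ for each vector involved.
    data Expr (n : ℕ) : Set where
      var : Fin n → Expr n
      _⊕_ _⊝_ : Expr n → Expr n → Expr n
      _⊙_ : ℚ → Expr n → Expr n

    ⟦_⟧ : ∀ {n} → Expr n → Vec Carrierᴹ n → Carrierᴹ
    ⟦ var i ⟧ ρ = lookup ρ i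
    ⟦ s ⊕ t ⟧ ρ = ⟦ s ⟧ ρ +ᴹ ⟦ t ⟧ ρ
    ⟦ s ⊝ t ⟧ ρ = ⟦ s ⟧ ρ +ᴹ -ᴹ ⟦ t ⟧ ρ
    ⟦ a ⊙ s ⟧ ρ = a *ₗ ⟦ s ⟧ ρ

    #₀ : ∀ {n} → Expr (suc n)
    #₀ = var zero

    #₁ : ∀ {n} → Expr (suc (suc n))
    #₁ = var (suc zero)

    coefficient : ∀ {n} → Expr n → Fin n → ℚ
    coefficient (var i) j = δ (toℕ i) (toℕ j)
    coefficient (s ⊕ t) j = coefficient s j + coefficient t j
    coefficient (s ⊝ t) j = coefficient s j - coefficient t j
    coefficient (a ⊙ s) j = a * coefficient s j

    scale-linear : ∀ c → IsLinear M M (c *ₗ_)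
    scale-linear c = linear M M (c *ₗ_) (*ₗ-cong refl) (*ₗ-distribˡ c)
      (λ a w → ≈ᴹ-trans (≈ᴹ-sym (*ₗ-assoc c a w))
        (≈ᴹ-trans (*ₗ-cong (ℚₚ.*-comm c a) ≈ᴹ-refl) (*ₗ-assoc a c w)))

    lincomb-linear : ∀ {n} (v : Fin n → Carrierᴹ) → IsLinear (ℚ¹ ^ Fin n) M (λ a → lincomb a v)
    lincomb-linear {n} v = linear (ℚ¹ ^ Fin n) M (λ a → lincomb a v)
      (λ p → sum-cong-≋ (λ q → *ₗ-cong (p q) ≈ᴹ-refl))
      (λ a b → ≈ᴹ-trans (sum-cong-≋ (λ q → *ₗ-distribʳ (v q) (a q) (b q)))
        (∑-distrib-+ (λ q → a q *ₗ v q) (λ q → b q *ₗ v q)))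
      (λ c a → ≈ᴹ-trans (sum-cong-≋ (λ q → *ₗ-assoc c (a q) (v q)))
        (≈ᴹ-sym (linear-sum M M (scale-linear c) (λ q → a q *ₗ v q))))

    normal : ∀ {n} (ρ : Vec Carrierᴹ n) s → ⟦ s ⟧ ρ ≈ᴹ lincomb (coefficient s) (lookup ρ)
    normal ρ (var i) = ≈ᴹ-sym (sum-δ i (lookup ρ))
    normal ρ (s ⊕ t) = ≈ᴹ-trans (+ᴹ-cong (normal ρ s) (normal ρ t))
      (≈ᴹ-sym (+ᴹ-homo (coefficient s) (coefficient t)))
      where open LeftModuleMorphisms.IsLeftModuleHomomorphism (lincomb-linear (lookup ρ))
    normal ρ (s ⊝ t) = ≈ᴹ-trans
      (+ᴹ-cong (normal ρ s) (≈ᴹ-trans (-ᴹ‿cong (normal ρ t)) (≈ᴹ-sym (-ᴹ-homo (coefficient t)))))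
      (≈ᴹ-sym (+ᴹ-homo (coefficient s) (-_ ∘ coefficient t)))
      where open LeftModuleMorphisms.IsLeftModuleHomomorphism (lincomb-linear (lookup ρ))
    normal ρ (a ⊙ s) = ≈ᴹ-trans (*ₗ-cong refl (normal ρ s)) (≈ᴹ-sym (*ₗ-homo a (coefficient s)))
      where open LeftModuleMorphisms.IsLeftModuleHomomorphism (lincomb-linear (lookup ρ))

    combine : ∀ {n} (ρ : Vec Carrierᴹ n) s t → (∀ j → coefficient s j ≡ coefficient t j) →
              ⟦ s ⟧ ρ ≈ᴹ ⟦ t ⟧ ρ
    combine ρ s t s≡t = ≈ᴹ-trans (normal ρ s)
      (≈ᴹ-trans (sum-cong-≋ (λ q → *ₗ-cong (s≡t q) ≈ᴹ-refl)) (≈ᴹ-sym (normal ρ t)))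

open LinearAlgebra

-- Representations of 𝔰𝔩₂: weights and inversion of e₋ e₊

module SL2Representations where

  open import Data.Rational using (_+_; _*_; -_; _-_)

  module Weights (M : SL2Module) where
    open SL2Module M
    open Sums vectorSpace
    open Combinations vectorSpace
    open SetoidReasoning ≈ᴹ-setoid
    module E₊ = LeftModuleMorphisms.IsLeftModuleHomomorphism e₊-linear
    module E₋ = LeftModuleMorphisms.IsLeftModuleHomomorphism e₋-linear
    module H = LeftModuleMorphisms.IsLeftModuleHomomorphism h-linear

    Weight : ℚ → Carrierᴹ → Set
    Weight μ v = h v ≈ᴹ μ *ₗ v

    Weight-subspace : ∀ μ → Bases.IsSubspace vectorSpace (Weight μ)
    Weight-subspace μ = record
      { ∈-resp = λ u≈v hu → ≈ᴹ-trans (H.⟦⟧-cong (≈ᴹ-sym u≈v)) (≈ᴹ-trans hu (*ₗ-cong refl u≈v))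
      ; 0∈ = ≈ᴹ-trans H.0ᴹ-homo (≈ᴹ-sym (*ₗ-zeroʳ μ))
      ; +∈ = λ {u} {v} hu hv → ≈ᴹ-trans (H.+ᴹ-homo u v)
          (≈ᴹ-trans (+ᴹ-cong hu hv) (≈ᴹ-sym (*ₗ-distribˡ μ u v)))
      ; *∈ = λ a {v} hv → ≈ᴹ-trans (H.*ₗ-homo a v) (≈ᴹ-trans (*ₗ-cong refl hv)
          (combine (v ∷ []) (a ⊙ μ ⊙ #₀) (μ ⊙ a ⊙ #₀) (λ { zero →
            solve 2 (λ a m → a :* (m :* con 1ℚ) := m :* (a :* con 1ℚ)) refl a μ }))) }
      where open ℚSolver.+-*-Solver

    weight-e₊ : ∀ {μ ν v} → ν ≡ μ + fromℕ 2 → Weight μ v → Weight ν (e₊ v)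
    weight-e₊ {μ} {v = v} refl hv = begin
      h (e₊ v) ≈⟨ combine (h (e₊ v) ∷ e₊ (h v) ∷ []) #₀ (#₀ ⊝ #₁ ⊕ #₁)
                    (λ { zero → refl ; (suc zero) → refl }) ⟩
      h (e₊ v) +ᴹ -ᴹ e₊ (h v) +ᴹ e₊ (h v)
        ≈⟨ +ᴹ-cong ([h,e₊] v) (≈ᴹ-trans (E₊.⟦⟧-cong hv) (E₊.*ₗ-homo μ v)) ⟩
      fromℕ 2 *ₗ e₊ v +ᴹ μ *ₗ e₊ v
        ≈⟨ combine (e₊ v ∷ []) (fromℕ 2 ⊙ #₀ ⊕ μ ⊙ #₀) ((μ + fromℕ 2) ⊙ #₀) (λ { zero →
             solve 2 (λ t m → t :* con 1ℚ :+ m :* con 1ℚ := (m :+ t) :* con 1ℚ) refl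
               (fromℕ 2) μ }) ⟩
      (μ + fromℕ 2) *ₗ e₊ v ∎
      where open ℚSolver.+-*-Solver

    weight-e₋ : ∀ {μ ν v} → ν + fromℕ 2 ≡ μ → Weight μ v → Weight ν (e₋ v)
    weight-e₋ {ν = ν} {v} refl hv = begin
      h (e₋ v) ≈⟨ combine (h (e₋ v) ∷ e₋ (h v) ∷ []) #₀ (#₀ ⊝ #₁ ⊕ #₁)
                    (λ { zero → refl ; (suc zero) → refl }) ⟩
      h (e₋ v) +ᴹ -ᴹ e₋ (h v) +ᴹ e₋ (h v)
        ≈⟨ +ᴹ-cong ([h,e₋] v) (≈ᴹ-trans (E₋.⟦⟧-cong hv) (E₋.*ₗ-homo (ν + fromℕ 2) v)) ⟩
      (- fromℕ 2) *ₗ e₋ v +ᴹ (ν + fromℕ 2) *ₗ e₋ v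
        ≈⟨ combine (e₋ v ∷ []) ((- fromℕ 2) ⊙ #₀ ⊕ (ν + fromℕ 2) ⊙ #₀) (ν ⊙ #₀) (λ { zero →
             solve 2 (λ t n → (:- t) :* con 1ℚ :+ (n :+ t) :* con 1ℚ := n :* con 1ℚ) refl
               (fromℕ 2) ν }) ⟩
      ν *ₗ e₋ v ∎
      where open ℚSolver.+-*-Solver

    e₋e₊ : ∀ {μ v} → Weight μ v → e₋ (e₊ v) +ᴹ μ *ₗ v ≈ᴹ e₊ (e₋ v)
    e₋e₊ {μ} {v} hv = begin
      e₋ (e₊ v) +ᴹ μ *ₗ v ≈⟨ +ᴹ-cong ≈ᴹ-refl (≈ᴹ-sym (≈ᴹ-trans ([e₊,e₋] v) hv)) ⟩
      e₋ (e₊ v) +ᴹ (e₊ (e₋ v) +ᴹ -ᴹ e₋ (e₊ v))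
        ≈⟨ combine (e₋ (e₊ v) ∷ e₊ (e₋ v) ∷ []) (#₀ ⊕ (#₁ ⊝ #₀)) #₁
             (λ { zero → refl ; (suc zero) → refl }) ⟩
      e₊ (e₋ v) ∎

    iterate : (Carrierᴹ → Carrierᴹ) → ℕ → Carrierᴹ → Carrierᴹ
    iterate f zero v = v
    iterate f (suc k) v = f (iterate f k v)

    iterate-e₊-0 : ∀ k {w} → w ≈ᴹ 0ᴹ → iterate e₊ k w ≈ᴹ 0ᴹ
    iterate-e₊-0 zero w≈0 = w≈0
    iterate-e₊-0 (suc k) w≈0 = ≈ᴹ-trans (E₊.⟦⟧-cong (iterate-e₊-0 k w≈0)) E₊.0ᴹ-homo

    -- Moving e₋ past one e₊ after another contributes the weights μ + 2j of e₊^j v for j = 0, ...,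
    -- k, and their sum is (k+1)(μ+k). The weight of e₊^k v is proved alongside because the next
    -- step needs it.
    e₋e₊^ : ∀ {μ v} k → Weight μ v →
      Weight (μ + fromℕ 2 * ι k) (iterate e₊ k v) ×
      e₋ (iterate e₊ (suc k) v) +ᴹ (ι (suc k) * (μ + ι k)) *ₗ iterate e₊ k v
        ≈ᴹ iterate e₊ (suc k) (e₋ v)
    e₋e₊^ {μ} {v} zero hv =
      ≈ᴹ-trans hv (*ₗ-cong (weight (ι 0) ι-0) ≈ᴹ-refl) ,
      ≈ᴹ-trans (+ᴹ-cong ≈ᴹ-refl (*ₗ-cong (factor (ι 0) (ι 1) ι-0 (ι-suc 0)) ≈ᴹ-refl)) (e₋e₊ hv)
      where
      open ℚSolver.+-*-Solver
      weight : ∀ z → z ≡ 0ℚ → μ ≡ μ + fromℕ 2 * z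
      weight _ refl = solve 1 (λ m → m := m :+ con (fromℕ 2) :* con 0ℚ) refl μ
      factor : ∀ z z′ → z ≡ 0ℚ → z′ ≡ 1ℚ + z → z′ * (μ + z) ≡ μ
      factor _ _ refl refl = solve 1 (λ m → con 1ℚ :* (m :+ con 0ℚ) := m) refl μ
    e₋e₊^ {μ} {v} (suc k) hv with hk , eq ← e₋e₊^ k hv = hk′ , (begin
      e₋ (e₊ z) +ᴹ c′ *ₗ z
        ≈⟨ combine (e₋ (e₊ z) ∷ z ∷ []) (#₀ ⊕ c′ ⊙ #₁) (#₀ ⊕ ν ⊙ #₁ ⊕ c₀ ⊙ #₁)
             (λ { zero → solve 3 (λ c n c₀ → con 1ℚ :+ c :* con 0ℚ
                    := con 1ℚ :+ n :* con 0ℚ :+ c₀ :* con 0ℚ) refl c′ ν c₀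
                ; (suc zero) → coefficients (ι k) (ι (suc k)) (ι (suc (suc k))) (ι-suc k)
                    (ι-suc (suc k)) }) ⟩
      e₋ (e₊ z) +ᴹ ν *ₗ z +ᴹ c₀ *ₗ z ≈⟨ +ᴹ-cong (e₋e₊ hk′) ≈ᴹ-refl ⟩
      e₊ (e₋ z) +ᴹ c₀ *ₗ z ≈⟨ +ᴹ-cong ≈ᴹ-refl (E₊.*ₗ-homo c₀ (iterate e₊ k v)) ⟨
      e₊ (e₋ z) +ᴹ e₊ (c₀ *ₗ iterate e₊ k v) ≈⟨ E₊.+ᴹ-homo _ _ ⟨
      e₊ (e₋ z +ᴹ c₀ *ₗ iterate e₊ k v) ≈⟨ E₊.⟦⟧-cong eq ⟩
      e₊ (iterate e₊ (suc k) (e₋ v)) ∎)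
      where
      open ℚSolver.+-*-Solver
      z = iterate e₊ (suc k) v
      c₀ = ι (suc k) * (μ + ι k)
      c′ = ι (suc (suc k)) * (μ + ι (suc k))
      ν = μ + fromℕ 2 * ι (suc k)
      weights : ∀ k k′ → k′ ≡ 1ℚ + k → μ + fromℕ 2 * k′ ≡ μ + fromℕ 2 * k + fromℕ 2
      weights k _ refl = solve 2 (λ m k → m :+ con (fromℕ 2) :* (con 1ℚ :+ k)
        := m :+ con (fromℕ 2) :* k :+ con (fromℕ 2)) refl μ k
      hk′ : Weight ν z
      hk′ = weight-e₊ (weights (ι k) (ι (suc k)) (ι-suc k)) (proj₁ (e₋e₊^ k hv))
      coefficients : ∀ k k′ k″ → k′ ≡ 1ℚ + k → k″ ≡ 1ℚ + k′ →
        0ℚ + k″ * (μ + k′) * 1ℚ ≡ 0ℚ + (μ + fromℕ 2 * k′) * 1ℚ + k′ * (μ + k) * 1ℚ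
      coefficients k _ _ refl refl = solve 2 (λ m k →
        con 0ℚ :+ (con 1ℚ :+ (con 1ℚ :+ k)) :* (m :+ (con 1ℚ :+ k)) :* con 1ℚ
        := con 0ℚ :+ (m :+ con (fromℕ 2) :* (con 1ℚ :+ k)) :* con 1ℚ
           :+ (con 1ℚ :+ k) :* (m :+ k) :* con 1ℚ) refl μ k

    private
      -- With X k = e₊^k e₋^k v, e₋ e₊ (X k) is X (k + 1) plus a nonzero multiple
      -- of X k, and X k vanishes for large k.
      module Descent (m : ℚ) {v : Carrierᴹ} (hv : Weight (- m) v) (s s⁻¹ : ℕ → ℚ)
        (s⁻¹s≡1 : ∀ k → s⁻¹ k * s k ≡ 1ℚ)
        (s-value : ∀ k → ι (suc k) * (- m - fromℕ 2 * ι k + ι k) ≡ - s k) where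
        open ℚSolver.+-*-Solver
        open Bases.IsSubspace (Weight-subspace (- m))

        X : ℕ → Carrierᴹ
        X k = iterate e₊ k (iterate e₋ k v)

        weight-e₋^ : ∀ k → Weight (- m - fromℕ 2 * ι k) (iterate e₋ k v)
        weight-e₋^ zero = ≈ᴹ-trans hv (*ₗ-cong (initial (ι 0) ι-0) ≈ᴹ-refl)
          where
          initial : ∀ z → z ≡ 0ℚ → - m ≡ - m - fromℕ 2 * z
          initial _ refl = solve 1 (λ m → :- m := :- m :- con (fromℕ 2) :* con 0ℚ) refl m
        weight-e₋^ (suc k) = weight-e₋ (step (ι k) (ι (suc k)) (ι-suc k)) (weight-e₋^ k)
          where
          step : ∀ k k′ → k′ ≡ 1ℚ + k → - m - fromℕ 2 * k′ + fromℕ 2 ≡ - m - fromℕ 2 * k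
          step k _ refl = solve 2 (λ l k → :- l :- con (fromℕ 2) :* (con 1ℚ :+ k) :+ con (fromℕ 2)
            := :- l :- con (fromℕ 2) :* k) refl m k

        weight-X : ∀ k → Weight (- m) (X k)
        weight-X k = ≈ᴹ-trans (proj₁ (e₋e₊^ k (weight-e₋^ k))) (*ₗ-cong
          (solve 2 (λ m k → m :- k :+ k := m) refl (- m) (fromℕ 2 * ι k)) ≈ᴹ-refl)

        e₋e₊X : ∀ k → e₋ (e₊ (X k)) ≈ᴹ X (suc k) +ᴹ s k *ₗ X k
        e₋e₊X k = begin
          e₋ (e₊ (X k))
            ≈⟨ combine (e₋ (e₊ (X k)) ∷ X k ∷ []) #₀ ((#₀ ⊕ (- s k) ⊙ #₁) ⊕ s k ⊙ #₁)
                 (λ { zero → solve 1 (λ s → con 1ℚ := con 1ℚ :+ (:- s) :* con 0ℚ :+ s :* con 0ℚ)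
                        refl (s k)
                    ; (suc zero) → solve 1 (λ s →
                        con 0ℚ := con 0ℚ :+ (:- s) :* con 1ℚ :+ s :* con 1ℚ)
                        refl (s k) }) ⟩
          e₋ (e₊ (X k)) +ᴹ (- s k) *ₗ X k +ᴹ s k *ₗ X k
            ≈⟨ +ᴹ-cong (≈ᴹ-trans (+ᴹ-cong ≈ᴹ-refl (*ₗ-cong (sym (s-value k)) ≈ᴹ-refl))
                 (proj₂ (e₋e₊^ k (weight-e₋^ k)))) ≈ᴹ-refl ⟩
          X (suc k) +ᴹ s k *ₗ X k ∎

        -- If r is a preimage of X (k+1), then X k - r is sent to s k · X k, and it remains to
        -- divide by s k.
        step : ∀ k → (∃[ r ] Weight (- m) r × e₋ (e₊ r) ≈ᴹ X (suc k)) →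
               ∃[ r ] Weight (- m) r × e₋ (e₊ r) ≈ᴹ X k
        step k (r , hr , er) = i *ₗ (X k +ᴹ (- 1ℚ) *ₗ r) ,
          *∈ i (+∈ (weight-X k) (*∈ (- 1ℚ) hr)) , (begin
          e₋ (e₊ (i *ₗ (X k +ᴹ (- 1ℚ) *ₗ r)))
            ≈⟨ E₋.⟦⟧-cong (≈ᴹ-trans (E₊.*ₗ-homo i _) (*ₗ-cong refl
                 (≈ᴹ-trans (E₊.+ᴹ-homo _ _) (+ᴹ-cong ≈ᴹ-refl (E₊.*ₗ-homo _ _))))) ⟩
          e₋ (i *ₗ (e₊ (X k) +ᴹ (- 1ℚ) *ₗ e₊ r))
            ≈⟨ ≈ᴹ-trans (E₋.*ₗ-homo i _) (*ₗ-cong refl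
                 (≈ᴹ-trans (E₋.+ᴹ-homo _ _) (+ᴹ-cong ≈ᴹ-refl (E₋.*ₗ-homo _ _)))) ⟩
          i *ₗ (e₋ (e₊ (X k)) +ᴹ (- 1ℚ) *ₗ e₋ (e₊ r))
            ≈⟨ *ₗ-cong refl (+ᴹ-cong (e₋e₊X k) (*ₗ-cong refl er)) ⟩
          i *ₗ ((X (suc k) +ᴹ s k *ₗ X k) +ᴹ (- 1ℚ) *ₗ X (suc k))
            ≈⟨ combine (X (suc k) ∷ X k ∷ []) (i ⊙ ((#₀ ⊕ s k ⊙ #₁) ⊕ (- 1ℚ) ⊙ #₀)) ((i * s k) ⊙ #₁)
                 (λ { zero → solve 2 (λ i s → i :* ((con 1ℚ :+ s :* con 0ℚ) :+ con (- 1ℚ) :* con 1ℚ)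
                        := (i :* s) :* con 0ℚ) refl i (s k)
                    ; (suc zero) → solve 2 (λ i s →
                        i :* ((con 0ℚ :+ s :* con 1ℚ) :+ con (- 1ℚ) :* con 0ℚ)
                        := (i :* s) :* con 1ℚ) refl i (s k) }) ⟩
          (i * s k) *ₗ X k ≈⟨ *ₗ-cong (s⁻¹s≡1 k) ≈ᴹ-refl ⟩
          1ℚ *ₗ X k ≈⟨ *ₗ-identityˡ (X k) ⟩
          X k ∎)
          where i = s⁻¹ k

        descend : ∀ k → iterate e₋ k v ≈ᴹ 0ᴹ → ∃[ r ] Weight (- m) r × e₋ (e₊ r) ≈ᴹ v
        descend k e₋^v≈0 = go k 0 (ℕₚ.+-identityʳ k)
          where
          go : ∀ t j → t ℕ.+ j ≡ k → ∃[ r ] Weight (- m) r × e₋ (e₊ r) ≈ᴹ X j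
          go zero j refl = 0ᴹ , 0∈ ,
            ≈ᴹ-trans (≈ᴹ-trans (E₋.⟦⟧-cong E₊.0ᴹ-homo) E₋.0ᴹ-homo) (≈ᴹ-sym (iterate-e₊-0 j e₋^v≈0))
          go (suc t) j 1+t+j≡k = step j (go t (suc j) (trans (ℕₚ.+-suc t j) 1+t+j≡k))

    -- The descent starts at k = D: e₋^D v has weight -(l+1) - 2D, which lies below -D, so it
    -- vanishes.
    e₋e₊-onto : ∀ {D} → (∀ {N v} → D < N → Weight (- ι N) v → v ≈ᴹ 0ᴹ) →
      ∀ l {v} → Weight (- ι (suc l)) v →
      ∃[ r ] Weight (- ι (suc l)) r × e₋ (e₊ r) ≈ᴹ v
    e₋e₊-onto {D} bounded l hv = descend D
      (bounded {suc l ℕ.+ 2 ℕ.* D} D<N (≈ᴹ-trans (weight-e₋^ D) (*ₗ-cong N≡ ≈ᴹ-refl)))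
      where
      -- The scalar of the descent at k is (k+1)(l+1+k). Writing it as a successor, `suc (κ k)`,
      -- shows it to be nonzero and lets `recip` invert it.
      κ : ℕ → ℕ
      κ k = l ℕ.+ k ℕ.+ k ℕ.* suc (l ℕ.+ k)

      κ-suc : ∀ k → suc (κ k) ≡ suc k ℕ.* (suc l ℕ.+ k)
      κ-suc k = refl

      κ-value : ∀ k → ι (suc k) * (- ι (suc l) - fromℕ 2 * ι k + ι k)
                      ≡ - ι (suc (κ k))
      κ-value k = descent-factor (ι (suc l)) (ι (suc k)) (ι k) (ι (suc l ℕ.+ k))
        (ι (suc (κ k))) (ι-+ (suc l) k)
        (trans (cong ι (κ-suc k)) (ι-* (suc k) (suc l ℕ.+ k)))

      N≡ : - ι (suc l) - fromℕ 2 * ι D ≡ - ι (suc l ℕ.+ 2 ℕ.* D)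
      N≡ = descent-weight (ι (suc l)) (fromℕ 2 * ι D) (ι (2 ℕ.* D))
        (ι (suc l ℕ.+ 2 ℕ.* D)) (trans (ι-* 2 D) (cong (_* ι D) (ι≡fromℕ 2)))
        (ι-+ (suc l) (2 ℕ.* D))

      D<N : D < suc l ℕ.+ 2 ℕ.* D
      D<N = s≤s (ℕₚ.≤-trans (ℕₚ.m≤m+n D (D ℕ.+ 0)) (ℕₚ.m≤n+m (2 ℕ.* D) l))

      open Descent (ι (suc l)) hv (λ k → ι (suc (κ k))) (λ k → recip (κ k))
        (λ k → recip-inverseˡ (κ k)) κ-value

    *ₗ-cancel-0 : ∀ {p v} → p ≢ 0ℚ → p *ₗ v ≈ᴹ 0ᴹ → v ≈ᴹ 0ᴹ
    *ₗ-cancel-0 {p} {v} p≢0 pv≈0 = begin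
      v ≈⟨ *ₗ-identityˡ v ⟨
      1ℚ *ₗ v ≈⟨ *ₗ-cong (ℚₚ.*-inverseˡ p) ≈ᴹ-refl ⟨
      (ℚ.1/ p * p) *ₗ v ≈⟨ *ₗ-assoc (ℚ.1/ p) p v ⟩
      ℚ.1/ p *ₗ p *ₗ v ≈⟨ *ₗ-cong refl pv≈0 ⟩
      ℚ.1/ p *ₗ 0ᴹ ≈⟨ *ₗ-zeroʳ (ℚ.1/ p) ⟩
      0ᴹ ∎
      where instance p-nonZero = ℚ.≢-nonZero p≢0

    -- Applying h - μ₀ to the relation kills its first term and multiplies each other term by μᵢ -
    -- μ₀, which is nonzero. Induction then kills the other terms, and so the first.
    separate : ∀ {n} (μ : Fin n → ℚ) → (∀ {i j} → μ i ≡ μ j → i ≡ j) →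
      ∀ w → (∀ i → Weight (μ i) (w i)) → sum w ≈ᴹ 0ᴹ → ∀ i → w i ≈ᴹ 0ᴹ
    separate {suc n} μ μ-injective w hw ∑w≈0 = λ
      { zero → ≈ᴹ-trans (≈ᴹ-sym (+ᴹ-identityʳ (w zero)))
          (≈ᴹ-trans (+ᴹ-cong ≈ᴹ-refl (≈ᴹ-sym (sum-0 (w ∘ suc) rest≈0))) ∑w≈0)
      ; (suc i) → rest≈0 i }
      where
      open ℚSolver.+-*-Solver
      a : Fin n → ℚ
      a i = μ (suc i) - μ zero
      a≢0 : ∀ i → a i ≢ 0ℚ
      a≢0 i eq with () ← μ-injective {suc i} {zero} (ℚG.x∙y⁻¹≈ε⇒x≈y (μ (suc i)) (μ zero) eq)
      Z : Fin (suc n) → Carrierᴹ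
      Z i = (μ i - μ zero) *ₗ w i
      ∑Z≈0 : sum Z ≈ᴹ 0ᴹ
      ∑Z≈0 = begin
        sum Z ≈⟨ sum-cong-≋ (λ i → ≈ᴹ-trans (*ₗ-distribʳ (w i) (μ i) (- μ zero))
                   (+ᴹ-cong (≈ᴹ-sym (hw i)) ≈ᴹ-refl)) ⟩
        sum (λ i → h (w i) +ᴹ (- μ zero) *ₗ w i)
          ≈⟨ ∑-distrib-+ (h ∘ w) (λ i → (- μ zero) *ₗ w i) ⟩
        sum (h ∘ w) +ᴹ sum (λ i → (- μ zero) *ₗ w i)
          ≈⟨ +ᴹ-cong (linear-sum vectorSpace vectorSpace h-linear w)
               (linear-sum vectorSpace vectorSpace (scale-linear (- μ zero)) w) ⟨
        h (sum w) +ᴹ (- μ zero) *ₗ sum w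
          ≈⟨ +ᴹ-cong (≈ᴹ-trans (H.⟦⟧-cong ∑w≈0) H.0ᴹ-homo)
               (≈ᴹ-trans (*ₗ-cong refl ∑w≈0) (*ₗ-zeroʳ (- μ zero))) ⟩
        0ᴹ +ᴹ 0ᴹ ≈⟨ +ᴹ-identityˡ 0ᴹ ⟩
        0ᴹ ∎
      Z₀≈0 : Z zero ≈ᴹ 0ᴹ
      Z₀≈0 = ≈ᴹ-trans (*ₗ-cong (ℚₚ.+-inverseʳ (μ zero)) ≈ᴹ-refl) (*ₗ-zeroˡ (w zero))
      rest≈0 : ∀ i → w (suc i) ≈ᴹ 0ᴹ
      rest≈0 i = *ₗ-cancel-0 (a≢0 i) (separate (μ ∘ suc) (Finₚ.suc-injective ∘ μ-injective)
        (Z ∘ suc) (λ i → Bases.IsSubspace.*∈ (Weight-subspace (μ (suc i))) (a i) (hw (suc i)))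
        (≈ᴹ-trans (≈ᴹ-sym (≈ᴹ-trans (+ᴹ-cong Z₀≈0 ≈ᴹ-refl) (+ᴹ-identityˡ _))) ∑Z≈0) i)

  -- Not the contragredient module: the space is the same and the action is twisted by the
  -- automorphism that exchanges e₊ with e₋ and negates h. It carries statements about negative
  -- weights over to positive ones.
  dual : SL2Module → SL2Module
  dual M = record
    { vectorSpace = vectorSpace
    ; e₋ = e₊ ; h = λ v → (- 1ℚ) *ₗ h v ; e₊ = e₋
    ; e₋-linear = e₊-linear
    ; h-linear = linear vectorSpace vectorSpace (λ v → (- 1ℚ) *ₗ h v)
        (λ u≈v → *ₗ-cong refl (H.⟦⟧-cong u≈v))
        (λ u v → ≈ᴹ-trans (*ₗ-cong refl (H.+ᴹ-homo u v)) (*ₗ-distribˡ (- 1ℚ) (h u) (h v)))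
        (λ a v → ≈ᴹ-trans (*ₗ-cong refl (H.*ₗ-homo a v))
          (combine (h v ∷ []) ((- 1ℚ) ⊙ a ⊙ #₀) (a ⊙ (- 1ℚ) ⊙ #₀) (λ { zero →
            solve 1 (λ a → con (- 1ℚ) :* (a :* con 1ℚ) := a :* (con (- 1ℚ) :* con 1ℚ)) refl a })))
    ; e₊-linear = e₋-linear
    ; [h,e₊] = λ v → begin
        (- 1ℚ) *ₗ h (e₋ v) +ᴹ -ᴹ e₋ ((- 1ℚ) *ₗ h v)
          ≈⟨ +ᴹ-cong ≈ᴹ-refl (-ᴹ‿cong (E₋.*ₗ-homo (- 1ℚ) (h v))) ⟩
        (- 1ℚ) *ₗ h (e₋ v) +ᴹ -ᴹ ((- 1ℚ) *ₗ e₋ (h v))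
          ≈⟨ negate (h (e₋ v)) (e₋ (h v)) ⟩
        (- 1ℚ) *ₗ (h (e₋ v) +ᴹ -ᴹ e₋ (h v)) ≈⟨ *ₗ-cong refl ([h,e₋] v) ⟩
        (- 1ℚ) *ₗ (- fromℕ 2) *ₗ e₋ v ≈⟨ *ₗ-assoc (- 1ℚ) (- fromℕ 2) (e₋ v) ⟨
        fromℕ 2 *ₗ e₋ v ∎
    ; [h,e₋] = λ v → begin
        (- 1ℚ) *ₗ h (e₊ v) +ᴹ -ᴹ e₊ ((- 1ℚ) *ₗ h v)
          ≈⟨ +ᴹ-cong ≈ᴹ-refl (-ᴹ‿cong (E₊.*ₗ-homo (- 1ℚ) (h v))) ⟩
        (- 1ℚ) *ₗ h (e₊ v) +ᴹ -ᴹ ((- 1ℚ) *ₗ e₊ (h v))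
          ≈⟨ negate (h (e₊ v)) (e₊ (h v)) ⟩
        (- 1ℚ) *ₗ (h (e₊ v) +ᴹ -ᴹ e₊ (h v)) ≈⟨ *ₗ-cong refl ([h,e₊] v) ⟩
        (- 1ℚ) *ₗ fromℕ 2 *ₗ e₊ v ≈⟨ *ₗ-assoc (- 1ℚ) (fromℕ 2) (e₊ v) ⟨
        (- fromℕ 2) *ₗ e₊ v ∎
    ; [e₊,e₋] = λ v → ≈ᴹ-trans
        (combine (e₋ (e₊ v) ∷ e₊ (e₋ v) ∷ []) (#₀ ⊝ #₁) ((- 1ℚ) ⊙ (#₁ ⊝ #₀))
          (λ { zero → refl ; (suc zero) → refl }))
        (*ₗ-cong refl ([e₊,e₋] v)) }
    where
    open SL2Module M
    open Combinations vectorSpace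
    open Weights M using (module H; module E₊; module E₋)
    open SetoidReasoning ≈ᴹ-setoid
    open ℚSolver.+-*-Solver
    negate : ∀ u v → (- 1ℚ) *ₗ u +ᴹ -ᴹ ((- 1ℚ) *ₗ v) ≈ᴹ (- 1ℚ) *ₗ (u +ᴹ -ᴹ v)
    negate u v = combine (u ∷ v ∷ []) ((- 1ℚ) ⊙ #₀ ⊝ (- 1ℚ) ⊙ #₁) ((- 1ℚ) ⊙ (#₀ ⊝ #₁))
      (λ { zero → refl ; (suc zero) → refl })

  module DualWeights (M : SL2Module) where
    open SL2Module M
    open Weights M using (Weight)
    private module D = Weights (dual M)

    dual-weight : ∀ {μ v} → Weight μ v → D.Weight (- μ) v
    dual-weight {μ} {v} hv = ≈ᴹ-trans (*ₗ-cong refl hv) (≈ᴹ-trans (≈ᴹ-sym (*ₗ-assoc (- 1ℚ) μ v))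
      (*ₗ-cong (solve 1 (λ m → con (- 1ℚ) :* m := :- m) refl μ) ≈ᴹ-refl))
      where open ℚSolver.+-*-Solver

    undual-weight : ∀ {μ v} → D.Weight (- μ) v → Weight μ v
    undual-weight {μ} {v} hv = ≈ᴹ-trans (≈ᴹ-sym (*ₗ-identityˡ (h v)))
      (≈ᴹ-trans (*ₗ-assoc (- 1ℚ) (- 1ℚ) (h v)) (≈ᴹ-trans (*ₗ-cong refl hv)
        (≈ᴹ-trans (≈ᴹ-sym (*ₗ-assoc (- 1ℚ) (- μ) v))
          (*ₗ-cong (solve 1 (λ m → con (- 1ℚ) :* (:- m) := m) refl μ) ≈ᴹ-refl))))
      where open ℚSolver.+-*-Solver

    e₊e₋-onto : ∀ {D} → (∀ {N v} → D < N → Weight (ι N) v → v ≈ᴹ 0ᴹ) →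
      ∀ l {v} → Weight (ι (suc l)) v → ∃[ r ] Weight (ι (suc l)) r × e₊ (e₋ r) ≈ᴹ v
    e₊e₋-onto {D} bounded l {v} hv =
      let r , hr , er = D.e₋e₊-onto {D}
            (λ {N} {w} D<N hw → bounded {N} {w} D<N (undual-weight {ι N} {w} hw)) l
            {v} (dual-weight {ι (suc l)} {v} hv)
      in r , undual-weight {ι (suc l)} {r} hr , er

  -- Homomorphisms, copies of V i, and the decomposition

  record Hom (N M : SL2Module) : Set where
    private
      module N = SL2Module N
      module M = SL2Module M
    field
      map : N.Carrierᴹ → M.Carrierᴹ
      map-linear : IsLinear N.vectorSpace M.vectorSpace map
      map-e₋ : ∀ v → map (N.e₋ v) M.≈ᴹ M.e₋ (map v)
      map-h  : ∀ v → map (N.h v) M.≈ᴹ M.h (map v)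
      map-e₊ : ∀ v → map (N.e₊ v) M.≈ᴹ M.e₊ (map v)
    open LeftModuleMorphisms.IsLeftModuleHomomorphism map-linear public

  module _ {n} {N : Fin n → SL2Module} {M : SL2Module} (f : ∀ i → Hom (N i) M) where
    open SL2Module M
    open Sums vectorSpace
    open Combinations vectorSpace using (scale-linear)
    private module N i = SL2Module (N i)

    ⨁-hom : Hom (⨁ N) M
    ⨁-hom = record
      { map = λ u → sum (λ i → map (f i) (u i))
      ; map-linear = linear (SL2Module.vectorSpace (⨁ N)) vectorSpace
          (λ u → sum (λ i → map (f i) (u i)))
          (λ u≈v → sum-cong-≋ (λ i → ⟦⟧-cong (f i) (u≈v i)))
          (λ u v → ≈ᴹ-trans (sum-cong-≋ (λ i → +ᴹ-homo (f i) (u i) (v i)))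
            (∑-distrib-+ (λ i → map (f i) (u i)) (λ i → map (f i) (v i))))
          (λ a u → ≈ᴹ-trans (sum-cong-≋ (λ i → *ₗ-homo (f i) a (u i)))
            (≈ᴹ-sym (linear-sum vectorSpace vectorSpace (scale-linear a) (λ i → map (f i) (u i)))))
      ; map-e₋ = intertwines N.e₋ e₋ e₋-linear (λ i → map-e₋ (f i))
      ; map-h = intertwines N.h h h-linear (λ i → map-h (f i))
      ; map-e₊ = intertwines N.e₊ e₊ e₊-linear (λ i → map-e₊ (f i)) }
      where
      open Hom
      intertwines : (s : ∀ i → N.Carrierᴹ i → N.Carrierᴹ i) (t : Carrierᴹ → Carrierᴹ) →
        IsLinear vectorSpace vectorSpace t → (∀ i v → map (f i) (s i v) ≈ᴹ t (map (f i) v)) →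
        ∀ (u : ∀ i → N.Carrierᴹ i) →
        sum (λ i → map (f i) (s i (u i))) ≈ᴹ t (sum (λ i → map (f i) (u i)))
      intertwines s t t-linear fs≈tf u = ≈ᴹ-trans (sum-cong-≋ (λ i → fs≈tf i (u i)))
        (≈ᴹ-sym (linear-sum vectorSpace vectorSpace t-linear (λ i → map (f i) (u i))))

  module _ {N M : SL2Module} (f : Hom N M) where
    private
      module N = SL2Module N
      module M = SL2Module M
      module f = Hom f
    open GroupProperties M.+ᴹ-group using () renaming (x≈y⇒x∙y⁻¹≈ε to M-x≈y⇒x-y≈0)
    open GroupProperties N.+ᴹ-group using () renaming (x∙y⁻¹≈ε⇒x≈y to N-x-y≈0⇒x≈y)

    -- Maps out of a direct sum are the ones easily built, while the isomorphism is wanted in the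
    -- other direction. Preimages form a linear and equivariant map because the injective f reflects
    -- equations.
    bijective⇒≅ : (∀ u → f.map u M.≈ᴹ M.0ᴹ → u N.≈ᴹ N.0ᴹ) →
                  (∀ v → ∃[ u ] f.map u M.≈ᴹ v) → M ≅ N
    bijective⇒≅ ker≈0 onto = record
      { to = g
      ; isLinearIsomorphism = record
        { isLeftModuleMonomorphism = record
          { isLeftModuleHomomorphism = linear M.vectorSpace N.vectorSpace g
              (λ {u} {v} u≈v → injective (M.≈ᴹ-trans (fg u) (M.≈ᴹ-trans u≈v (M.≈ᴹ-sym (fg v)))))
              (λ u v → injective (M.≈ᴹ-trans (fg (u M.+ᴹ v)) (M.≈ᴹ-sym
                (M.≈ᴹ-trans (f.+ᴹ-homo (g u) (g v)) (M.+ᴹ-cong (fg u) (fg v))))))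
              (λ a v → injective (M.≈ᴹ-trans (fg (a M.*ₗ v)) (M.≈ᴹ-sym
                (M.≈ᴹ-trans (f.*ₗ-homo a (g v)) (M.*ₗ-cong refl (fg v))))))
          ; injective = λ {u} {v} gu≈gv → M.≈ᴹ-trans (M.≈ᴹ-sym (fg u))
              (M.≈ᴹ-trans (f.⟦⟧-cong gu≈gv) (fg v)) }
        ; surjective = λ u → f.map u , λ {v} v≈fu → injective (M.≈ᴹ-trans (fg v) v≈fu) }
      ; to-e₋ = λ v → intertwines (f.map-e₋ (g v)) (LM.⟦⟧-cong M.e₋-linear (fg v))
      ; to-h = λ v → intertwines (f.map-h (g v)) (LM.⟦⟧-cong M.h-linear (fg v))
      ; to-e₊ = λ v → intertwines (f.map-e₊ (g v)) (LM.⟦⟧-cong M.e₊-linear (fg v)) }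
      where
      module LM = LeftModuleMorphisms.IsLeftModuleHomomorphism
      g : M.Carrierᴹ → N.Carrierᴹ
      g v = proj₁ (onto v)
      fg : ∀ v → f.map (g v) M.≈ᴹ v
      fg v = proj₂ (onto v)
      injective : ∀ {u v} → f.map u M.≈ᴹ f.map v → u N.≈ᴹ v
      injective {u} {v} fu≈fv = N-x-y≈0⇒x≈y u v (ker≈0 (u N.+ᴹ N.-ᴹ v)
        (M.≈ᴹ-trans (f.+ᴹ-homo u (N.-ᴹ v)) (M.≈ᴹ-trans (M.+ᴹ-cong M.≈ᴹ-refl (f.-ᴹ-homo v))
          (M-x≈y⇒x-y≈0 fu≈fv))))
      intertwines : ∀ {v t s} → f.map s M.≈ᴹ t → t M.≈ᴹ v → g v N.≈ᴹ s
      intertwines {v} fs≈t t≈v = injective (M.≈ᴹ-trans (fg v) (M.≈ᴹ-sym (M.≈ᴹ-trans fs≈t t≈v)))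

  -- A vector of weight −i killed by e₋ generates a copy of V i, provided that no
  -- vector of positive weight is killed by e₋.
  module LowestWeight (M : SL2Module) (i : ℕ) (L : SL2Module.Carrierᴹ M)
    (weight-L : Weights.Weight M (- ι i) L)
    (e₋L≈0 : SL2Module._≈ᴹ_ M (SL2Module.e₋ M L) (SL2Module.0ᴹ M))
    (no-lowest : ∀ N v → Weights.Weight M (ι (suc N)) v →
                 SL2Module._≈ᴹ_ M (SL2Module.e₋ M v) (SL2Module.0ᴹ M) →
                 SL2Module._≈ᴹ_ M v (SL2Module.0ᴹ M)) where
    open SL2Module M
    open Sums vectorSpace
    open Combinations vectorSpace
    open Weights M
    open SetoidReasoning ≈ᴹ-setoid
    open ℚSolver.+-*-Solver

    -- b k = e₊^k L / (i (i − 1) ⋯ (i − k + 1)) for k ≤ i.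
    b : ℕ → Carrierᴹ
    b zero = L
    b (suc k) = recip (i ∸ suc k) *ₗ e₊ (b k)

    ι-∸ : ∀ {k} → k < i → ι i ≡ ι k + ι (suc (i ∸ suc k))
    ι-∸ {k} k<i = trans (cong ι (sym (trans (ℕₚ.+-suc k (i ∸ suc k)) (ℕₚ.m+[n∸m]≡n k<i))))
      (ι-+ k (suc (i ∸ suc k)))

    e₊b : ∀ {k} → k < i → e₊ (b k) ≈ᴹ (ι i - ι k) *ₗ b (suc k)
    e₊b {k} k<i = ≈ᴹ-sym (begin
      (ι i - ι k) *ₗ b (suc k) ≈⟨ *ₗ-assoc (ι i - ι k) (recip (i ∸ suc k)) (e₊ (b k)) ⟨
      ((ι i - ι k) * recip (i ∸ suc k)) *ₗ e₊ (b k)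
        ≈⟨ *ₗ-cong (scalar (ι i) (ι k) (ι (suc (i ∸ suc k))) (recip (i ∸ suc k)) (ι-∸ k<i)
             (recip-inverseˡ (i ∸ suc k))) ≈ᴹ-refl ⟩
      1ℚ *ₗ e₊ (b k) ≈⟨ *ₗ-identityˡ (e₊ (b k)) ⟩
      e₊ (b k) ∎)
      where
      scalar : ∀ i k m r → i ≡ k + m → r * m ≡ 1ℚ → (i - k) * r ≡ 1ℚ
      scalar _ k m r refl rm≡1 =
        trans (solve 3 (λ k m r → (k :+ m :- k) :* r := r :* m) refl k m r) rm≡1

    weight-b : ∀ k → Weight (fromℕ 2 * ι k - ι i) (b k)
    weight-b zero = ≈ᴹ-trans weight-L (*ₗ-cong (initial (ι i) (ι 0) ι-0) ≈ᴹ-refl)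
      where
      initial : ∀ i z → z ≡ 0ℚ → - i ≡ fromℕ 2 * z - i
      initial i _ refl = solve 1 (λ i → :- i := con (fromℕ 2) :* con 0ℚ :- i) refl i
    weight-b (suc k) = Bases.IsSubspace.*∈ (Weight-subspace _) (recip (i ∸ suc k))
      (weight-e₊ (next (ι i) (ι k) (ι (suc k)) (ι-suc k)) (weight-b k))
      where
      next : ∀ i k k′ → k′ ≡ 1ℚ + k → fromℕ 2 * k′ - i ≡ fromℕ 2 * k - i + fromℕ 2
      next i k _ refl = solve 2 (λ i k → con (fromℕ 2) :* (con 1ℚ :+ k) :- i
        := con (fromℕ 2) :* k :- i :+ con (fromℕ 2)) refl i k

    mutual
      -- The three identities climb together: e₋ on b k gives e₊ e₋, the commutator gives e₋ e₊, and
      -- division by i - k gives e₋ on b (k+1).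
      e₊e₋b : ∀ k → k ≤ i → e₊ (e₋ (b k)) ≈ᴹ (ι k * (ι i - ι k + 1ℚ)) *ₗ b k
      e₊e₋b zero _ = begin
        e₊ (e₋ L) ≈⟨ ≈ᴹ-trans (E₊.⟦⟧-cong e₋L≈0) E₊.0ᴹ-homo ⟩
        0ᴹ ≈⟨ *ₗ-zeroˡ L ⟨
        0ℚ *ₗ L ≈⟨ *ₗ-cong (trans (sym (ℚₚ.*-zeroˡ (ι i - ι 0 + 1ℚ)))
                              (cong (_* (ι i - ι 0 + 1ℚ)) (sym ι-0))) ≈ᴹ-refl ⟩
        (ι 0 * (ι i - ι 0 + 1ℚ)) *ₗ L ∎
      e₊e₋b (suc k) k<i = begin
        e₊ (e₋ (b (suc k))) ≈⟨ ≈ᴹ-trans (E₊.⟦⟧-cong (e₋b k k<i)) (E₊.*ₗ-homo (ι (suc k)) (b k)) ⟩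
        ι (suc k) *ₗ e₊ (b k) ≈⟨ *ₗ-cong refl (e₊b k<i) ⟩
        ι (suc k) *ₗ (ι i - ι k) *ₗ b (suc k) ≈⟨ *ₗ-assoc (ι (suc k)) (ι i - ι k) (b (suc k)) ⟨
        (ι (suc k) * (ι i - ι k)) *ₗ b (suc k)
          ≈⟨ *ₗ-cong (scalar (ι i) (ι k) (ι (suc k)) (ι-suc k)) ≈ᴹ-refl ⟩
        (ι (suc k) * (ι i - ι (suc k) + 1ℚ)) *ₗ b (suc k) ∎
        where
        scalar : ∀ i k k′ → k′ ≡ 1ℚ + k → k′ * (i - k) ≡ k′ * (i - k′ + 1ℚ)
        scalar i k _ refl = solve 2 (λ i k → (con 1ℚ :+ k) :* (i :- k)
          := (con 1ℚ :+ k) :* (i :- (con 1ℚ :+ k) :+ con 1ℚ)) refl i k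

      e₋e₊b : ∀ k → k ≤ i → e₋ (e₊ (b k)) ≈ᴹ ((1ℚ + ι k) * (ι i - ι k)) *ₗ b k
      e₋e₊b k k≤i = begin
        e₋ (e₊ (b k)) ≈⟨ expand (fromℕ 2 * ι k - ι i) ⟩
        (e₋ (e₊ (b k)) +ᴹ μ *ₗ b k) +ᴹ (- μ) *ₗ b k
          ≈⟨ +ᴹ-cong (≈ᴹ-trans (e₋e₊ (weight-b k)) (e₊e₋b k k≤i)) ≈ᴹ-refl ⟩
        (ι k * (ι i - ι k + 1ℚ)) *ₗ b k +ᴹ (- μ) *ₗ b k
          ≈⟨ *ₗ-distribʳ (b k) (ι k * (ι i - ι k + 1ℚ)) (- μ) ⟨
        (ι k * (ι i - ι k + 1ℚ) + - μ) *ₗ b k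
          ≈⟨ *ₗ-cong (solve 2 (λ i k → k :* (i :- k :+ con 1ℚ) :+ :- (con (fromℕ 2) :* k :- i)
               := (con 1ℚ :+ k) :* (i :- k)) refl (ι i) (ι k)) ≈ᴹ-refl ⟩
        ((1ℚ + ι k) * (ι i - ι k)) *ₗ b k ∎
        where
        μ = fromℕ 2 * ι k - ι i
        expand : ∀ μ → e₋ (e₊ (b k)) ≈ᴹ (e₋ (e₊ (b k)) +ᴹ μ *ₗ b k) +ᴹ (- μ) *ₗ b k
        expand μ = combine (e₋ (e₊ (b k)) ∷ b k ∷ []) #₀ ((#₀ ⊕ μ ⊙ #₁) ⊕ (- μ) ⊙ #₁)
          (λ { zero → solve 1 (λ m → con 1ℚ := con 1ℚ :+ m :* con 0ℚ :+ (:- m) :* con 0ℚ) refl μ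
             ; (suc zero) → solve 1 (λ m → con 0ℚ := con 0ℚ :+ m :* con 1ℚ :+ (:- m) :* con 1ℚ)
                 refl μ })

      e₋b : ∀ k → k < i → e₋ (b (suc k)) ≈ᴹ ι (suc k) *ₗ b k
      e₋b k k<i = begin
        e₋ (recip (i ∸ suc k) *ₗ e₊ (b k)) ≈⟨ E₋.*ₗ-homo (recip (i ∸ suc k)) (e₊ (b k)) ⟩
        recip (i ∸ suc k) *ₗ e₋ (e₊ (b k)) ≈⟨ *ₗ-cong refl (e₋e₊b k (ℕₚ.<⇒≤ k<i)) ⟩
        recip (i ∸ suc k) *ₗ ((1ℚ + ι k) * (ι i - ι k)) *ₗ b k
          ≈⟨ *ₗ-assoc (recip (i ∸ suc k)) ((1ℚ + ι k) * (ι i - ι k)) (b k) ⟨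
        (recip (i ∸ suc k) * ((1ℚ + ι k) * (ι i - ι k))) *ₗ b k
          ≈⟨ *ₗ-cong (scalar (ι i) (ι k) (ι (suc k)) (ι (suc (i ∸ suc k))) (recip (i ∸ suc k))
               (ι-suc k) (ι-∸ k<i) (recip-inverseˡ (i ∸ suc k))) ≈ᴹ-refl ⟩
        ι (suc k) *ₗ b k ∎
        where
        scalar : ∀ i k k′ m r → k′ ≡ 1ℚ + k → i ≡ k + m → r * m ≡ 1ℚ →
                 r * ((1ℚ + k) * (i - k)) ≡ k′
        scalar _ k _ m r refl refl rm≡1 = trans
          (solve 3 (λ k m r → r :* ((con 1ℚ :+ k) :* (k :+ m :- k)) := (con 1ℚ :+ k) :* (r :* m))
            refl k m r)
          (trans (cong ((1ℚ + k) *_) rm≡1) (ℚₚ.*-identityʳ (1ℚ + k)))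

    -- The factor i - k in `e₋e₊b` vanishes at k = i, so this vector of weight i + 2 is killed by
    -- e₋, and `no-lowest` applies.
    e₊b-top : e₊ (b i) ≈ᴹ 0ᴹ
    e₊b-top = no-lowest (suc i) (e₊ (b i))
      (weight-e₊ (weight (ι i) (ι (suc i)) (ι (suc (suc i))) (ι-suc i) (ι-suc (suc i)))
        (weight-b i))
      (≈ᴹ-trans (e₋e₊b i ℕₚ.≤-refl) (≈ᴹ-trans
        (*ₗ-cong (trans (cong ((1ℚ + ι i) *_) (ℚₚ.+-inverseʳ (ι i))) (ℚₚ.*-zeroʳ (1ℚ + ι i)))
          ≈ᴹ-refl)
        (*ₗ-zeroˡ (b i))))
      where
      weight : ∀ i i′ i″ → i′ ≡ 1ℚ + i → i″ ≡ 1ℚ + i′ → i″ ≡ fromℕ 2 * i - i + fromℕ 2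
      weight i _ _ refl refl = solve 1 (λ i → con 1ℚ :+ (con 1ℚ :+ i)
        := con (fromℕ 2) :* i :- i :+ con (fromℕ 2)) refl i

    private module S = Standard i

    φ : S.Carrierᴹ → Carrierᴹ
    φ a = lincomb a (b ∘ toℕ)

    φ-linear : IsLinear S.space vectorSpace φ
    φ-linear = lincomb-linear (b ∘ toℕ)

    private module Φ = LeftModuleMorphisms.IsLeftModuleHomomorphism φ-linear

    φ-v : ∀ {j} → j ≤ i → φ (S.v j) ≈ᴹ b j
    φ-v {j} j≤i = subst (λ m → φ (S.v m) ≈ᴹ b m) (Finₚ.toℕ-fromℕ< (s≤s j≤i))
      (sum-δ (fromℕ< (s≤s j≤i)) (b ∘ toℕ))

    φ-extend : ∀ F t → IsLinear vectorSpace vectorSpace t →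
      (∀ {j} → j ≤ i → φ (F j) ≈ᴹ t (b j)) → ∀ a → φ (S.extend F a) ≈ᴹ t (φ a)
    φ-extend F t t-linear φF≈tb a = begin
      sum (λ k → ℚΣ.sum (λ j → a j * F (toℕ j) k) *ₗ b (toℕ k))
        ≈⟨ sum-cong-≋ (λ k → linear-sum ℚ¹ vectorSpace
             (Bases.*ₗ-linear vectorSpace (b (toℕ k))) (λ j → a j * F (toℕ j) k)) ⟩
      sum (λ k → sum (λ j → (a j * F (toℕ j) k) *ₗ b (toℕ k)))
        ≈⟨ ∑-comm (λ k j → (a j * F (toℕ j) k) *ₗ b (toℕ k)) ⟩
      sum (λ j → sum (λ k → (a j * F (toℕ j) k) *ₗ b (toℕ k)))
        ≈⟨ sum-cong-≋ (λ j → Φ.*ₗ-homo (a j) (F (toℕ j))) ⟩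
      sum (λ j → a j *ₗ φ (F (toℕ j)))
        ≈⟨ sum-cong-≋ (λ j → *ₗ-cong (refl {x = a j}) (φF≈tb (ℕₚ.≤-pred (Finₚ.toℕ<n j)))) ⟩
      lincomb a (t ∘ b ∘ toℕ) ≈⟨ linear-lincomb vectorSpace vectorSpace t-linear a (b ∘ toℕ) ⟨
      t (φ a) ∎

    φ-e₋v : ∀ {j} → j ≤ i → φ (S.e₋v j) ≈ᴹ e₋ (b j)
    φ-e₋v {zero} _ = ≈ᴹ-trans Φ.0ᴹ-homo (≈ᴹ-sym e₋L≈0)
    φ-e₋v {suc j} j<i = ≈ᴹ-trans (Φ.*ₗ-homo (fromℕ (suc j)) (S.v j))
      (≈ᴹ-trans (*ₗ-cong (sym (ι≡fromℕ (suc j))) (φ-v (ℕₚ.<⇒≤ j<i))) (≈ᴹ-sym (e₋b j j<i)))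

    φ-hv : ∀ {j} → j ≤ i → φ (S.hv j) ≈ᴹ h (b j)
    φ-hv {j} j≤i = ≈ᴹ-trans (Φ.*ₗ-homo (fromℕ 2 * fromℕ j - fromℕ i) (S.v j))
      (≈ᴹ-trans (*ₗ-cong (sym (cong₂ (λ s t → fromℕ 2 * s - t) (ι≡fromℕ j) (ι≡fromℕ i))) (φ-v j≤i))
        (≈ᴹ-sym (weight-b j)))

    φ-e₊v : ∀ {j} → j ≤ i → φ (S.e₊v j) ≈ᴹ e₊ (b j)
    φ-e₊v {j} j≤i = ≈ᴹ-trans (Φ.*ₗ-homo (fromℕ i - fromℕ j) (S.v (suc j)))
      (≈ᴹ-trans (*ₗ-cong (sym (cong₂ _-_ (ι≡fromℕ i) (ι≡fromℕ j))) ≈ᴹ-refl)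
        (cases (ℕₚ.m≤n⇒m<n∨m≡n j≤i)))
      where
      cases : j < i ⊎ j ≡ i → (ι i - ι j) *ₗ φ (S.v (suc j)) ≈ᴹ e₊ (b j)
      cases (inj₁ j<i) = ≈ᴹ-trans (*ₗ-cong refl (φ-v j<i)) (≈ᴹ-sym (e₊b j<i))
      cases (inj₂ refl) = ≈ᴹ-trans (*ₗ-cong (ℚₚ.+-inverseʳ (ι i)) ≈ᴹ-refl)
        (≈ᴹ-trans (*ₗ-zeroˡ (φ (S.v (suc i)))) (≈ᴹ-sym e₊b-top))

    V-hom : Hom (V i) M
    V-hom = record
      { map = φ ; map-linear = φ-linear
      ; map-e₋ = φ-extend S.e₋v e₋ e₋-linear φ-e₋v
      ; map-h = φ-extend S.hv h h-linear φ-hv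
      ; map-e₊ = φ-extend S.e₊v e₊ e₊-linear φ-e₊v }

  δ-sym : ∀ m n → δ m n ≡ δ n m
  δ-sym zero zero = refl
  δ-sym zero (suc n) = refl
  δ-sym (suc m) zero = refl
  δ-sym (suc m) (suc n) = δ-sym m n

  δ-≢ : ∀ m n → m ≢ n → δ m n ≡ 0ℚ
  δ-≢ zero zero m≢n with () ← m≢n refl
  δ-≢ zero (suc n) _ = refl
  δ-≢ (suc m) zero _ = refl
  δ-≢ (suc m) (suc n) m≢n = δ-≢ m n (m≢n ∘ cong suc)

  module _ {i : ℕ} (a : Fin (suc i) → ℚ) where
    open Standard i

    private
      term : Fin i → Fin (suc i) → ℚ
      term j k = a (suc j) * (fromℕ (suc (toℕ j)) * v (toℕ j) k)

      e₋-terms : ∀ k → extend e₋v a k ≡ ℚΣ.sum (λ j → term j k)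
      e₋-terms k = trans (cong (_+ ℚΣ.sum (λ j → term j k)) (ℚₚ.*-zeroʳ (a zero)))
        (ℚₚ.+-identityˡ (ℚΣ.sum (λ j → term j k)))

    e₋-coefficient : ∀ l → extend e₋v a (inject₁ l) ≡ fromℕ (suc (toℕ l)) * a (suc l)
    e₋-coefficient l = trans (e₋-terms (inject₁ l))
      (trans (ℚΣ.sum-cong-≋ (λ j → trans
          (swap (a (suc j)) (fromℕ (suc (toℕ j))) (v (toℕ j) (inject₁ l)))
          (cong (_* (fromℕ (suc (toℕ j)) * a (suc j)))
            (trans (cong (δ (toℕ j)) (Finₚ.toℕ-inject₁ l)) (δ-sym (toℕ j) (toℕ l))))))
        (δ-in l (λ j → fromℕ (suc (toℕ j)) * a (suc j))))
      where
      open ℚSolver.+-*-Solver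
      swap : ∀ x y z → x * (y * z) ≡ z * (y * x)
      swap = solve 3 (λ x y z → x :* (y :* z) := z :* (y :* x)) refl

    e₋-vanishes : ∀ K → (∀ k → suc K ≤ toℕ k → a k ≡ 0ℚ) → ∀ k → K ≤ toℕ k → extend e₋v a k ≡ 0ℚ
    e₋-vanishes K a≡0 k K≤k = trans (e₋-terms k) (∑-zero (λ j → term j k) zero-term)
      where
      zero-term : ∀ j → term j k ≡ 0ℚ
      zero-term j with toℕ j ℕ.≟ toℕ k
      ... | yes j≡k = trans
              (cong (_* (fromℕ (suc (toℕ j)) * v (toℕ j) k))
                (a≡0 (suc j) (s≤s (subst (K ≤_) (sym j≡k) K≤k))))
              (ℚₚ.*-zeroˡ (fromℕ (suc (toℕ j)) * v (toℕ j) k))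
      ... | no j≢k = trans
              (cong (λ t → a (suc j) * (fromℕ (suc (toℕ j)) * t)) (δ-≢ (toℕ j) (toℕ k) j≢k))
              (trans (cong (a (suc j) *_) (ℚₚ.*-zeroʳ (fromℕ (suc (toℕ j)))))
                (ℚₚ.*-zeroʳ (a (suc j))))

  ι-suc≢0 : ∀ k → ι (suc k) ≢ 0ℚ
  ι-suc≢0 k eq with () ← ι-injective {suc k} {0} (trans eq (sym ι-0))

  e₋≡0⇒≡0 : ∀ {i} (a : Fin (suc i) → ℚ) → (∀ k → Standard.extend i (Standard.e₋v i) a k ≡ 0ℚ) →
            ∀ l → a (suc l) ≡ 0ℚ
  e₋≡0⇒≡0 a e₋a≡0 l = *-cancel-0 (ι-suc≢0 (toℕ l))
    (trans (cong (_* a (suc l)) (ι≡fromℕ (suc (toℕ l))))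
      (trans (sym (e₋-coefficient a l)) (e₋a≡0 (inject₁ l))))

  -- All that the decomposition asks of a module. Weights are given as a sign and a natural number
  -- because the later inductions run on their absolute value.
  record WeightData (M : SL2Module) (D : ℕ) : Set where
    open SL2Module M
    open Weights M
    open Sums vectorSpace using (sum)
    open Bases vectorSpace using (Basis)
    field
      bounded₋ : ∀ {N v} → D < N → Weight (- ι N) v → v ≈ᴹ 0ᴹ
      bounded₊ : ∀ {N v} → D < N → Weight (ι N) v → v ≈ᴹ 0ᴹ
      weight-sum : ∀ v → ∃[ n ] Σ[ w ∈ (Fin n → Carrierᴹ) ]
        (∀ q → ∃[ N ] (Weight (- ι N) (w q) ⊎ Weight (ι N) (w q))) × v ≈ᴹ sum w
      mult : Fin (suc D) → ℕ
      lowest : ∀ i → Basis (λ v → Weight (- ι (toℕ i)) v × e₋ v ≈ᴹ 0ᴹ) (mult i)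

  module Decomposition (M : SL2Module) (D : ℕ) (X : WeightData M D) where
    open WeightData X
    open SL2Module M
    open Sums vectorSpace
    open Combinations vectorSpace
    open Weights M
    open Bases vectorSpace
    open SetoidReasoning ≈ᴹ-setoid

    -- As e₋ v = 0, e₋ sends e₊^(k+1) v to -(k+1)(N+1+k) e₊^k v, a nonzero multiple. Now e₊^D v
    -- vanishes by its weight, so all lower powers vanish in turn, down to v itself.
    no-lowest : ∀ N v → Weight (ι (suc N)) v → e₋ v ≈ᴹ 0ᴹ → v ≈ᴹ 0ᴹ
    no-lowest N v hv e₋v≈0 = go D 0 (ℕₚ.+-identityʳ D)
      where
      open ℚSolver.+-*-Solver
      s : ℕ → ℚ
      s k = ι (suc k) * (ι (suc N) + ι k)
      s≢0 : ∀ k → s k ≢ 0ℚ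
      s≢0 k eq = ι-suc≢0 (N ℕ.+ k ℕ.+ k ℕ.* suc (N ℕ.+ k)) (trans
        (ι-* (suc k) (suc N ℕ.+ k)) (trans (cong (ι (suc k) *_) (ι-+ (suc N) k)) eq))
      top-weight : ι (suc N) + fromℕ 2 * ι D ≡ ι (suc N ℕ.+ 2 ℕ.* D)
      top-weight = sym (trans (ι-+ (suc N) (2 ℕ.* D)) (cong (λ t → ι (suc N) + t)
        (trans (ι-* 2 D) (cong (_* ι D) (ι≡fromℕ 2)))))
      D<N : D < suc N ℕ.+ 2 ℕ.* D
      D<N = s≤s (ℕₚ.≤-trans (ℕₚ.m≤m+n D (D ℕ.+ 0)) (ℕₚ.m≤n+m (2 ℕ.* D) N))
      go : ∀ t k → t ℕ.+ k ≡ D → iterate e₊ k v ≈ᴹ 0ᴹ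
      go zero k refl = bounded₊ {suc N ℕ.+ 2 ℕ.* D} D<N
        (≈ᴹ-trans (proj₁ (e₋e₊^ {ι (suc N)} k hv)) (*ₗ-cong top-weight ≈ᴹ-refl))
      go (suc t) k 1+t+k≡D = *ₗ-cancel-0 (s≢0 k) (begin
        s k *ₗ iterate e₊ k v ≈⟨ +ᴹ-identityˡ _ ⟨
        0ᴹ +ᴹ s k *ₗ iterate e₊ k v
          ≈⟨ +ᴹ-cong (≈ᴹ-trans (E₋.⟦⟧-cong (go t (suc k) (trans (ℕₚ.+-suc t k) 1+t+k≡D)))
               E₋.0ᴹ-homo) ≈ᴹ-refl ⟨
        e₋ (iterate e₊ (suc k) v) +ᴹ s k *ₗ iterate e₊ k v ≈⟨ proj₂ (e₋e₊^ {ι (suc N)} k hv) ⟩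
        iterate e₊ (suc k) (e₋ v) ≈⟨ iterate-e₊-0 (suc k) e₋v≈0 ⟩
        0ᴹ ∎)

    module L i = Basis (lowest i)
    module LW i t = LowestWeight M (toℕ i) (L.vec i t) (proj₁ (L.vec∈ i t)) (proj₂ (L.vec∈ i t))
                      no-lowest

    N : SL2Module
    N = ⨁ (λ i → mult i · V (toℕ i))
    module N = SL2Module N

    Φᵢ : ∀ i → Hom (mult i · V (toℕ i)) M
    Φᵢ i = ⨁-hom {N = λ _ → V (toℕ i)} {M} (λ t → LW.V-hom i t)

    Φ : Hom N M
    Φ = ⨁-hom {N = λ i → mult i · V (toℕ i)} {M} Φᵢ
    module Φ = Hom Φ

    lowest-part : ∀ (u : N.Carrierᴹ) → (∀ i t l → u i t (suc l) ≡ 0ℚ) →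
      Φ.map u ≈ᴹ sum (λ i → lincomb (λ t → u i t zero) (L.vec i))
    lowest-part u u≡0 = sum-cong-≋ (λ i → sum-cong-≋ (λ t → ≈ᴹ-trans
      (+ᴹ-cong ≈ᴹ-refl (sum-0 _ (λ l → ≈ᴹ-trans (*ₗ-cong (u≡0 i t l) ≈ᴹ-refl)
        (*ₗ-zeroˡ (LW.b i t (suc (toℕ l)))))))
      (+ᴹ-identityʳ (u i t zero *ₗ L.vec i t))))

    -- Applying e₋ lowers the bound K beyond which all coordinates of u vanish.
    Φ-ker : ∀ K (u : N.Carrierᴹ) → (∀ i t k → K ≤ toℕ k → u i t k ≡ 0ℚ) →
            Φ.map u ≈ᴹ 0ᴹ → ∀ i t k → u i t k ≡ 0ℚ
    Φ-ker zero u u≡0 Φu≈0 i t k = u≡0 i t k z≤n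
    Φ-ker (suc K) u u≡0 Φu≈0 = u≡0′
      where
      e₋u≡0 : ∀ i t k → N.e₋ u i t k ≡ 0ℚ
      e₋u≡0 = Φ-ker K (N.e₋ u) (λ i t → e₋-vanishes (u i t) K (u≡0 i t))
        (≈ᴹ-trans (Φ.map-e₋ u) (≈ᴹ-trans (E₋.⟦⟧-cong Φu≈0) E₋.0ᴹ-homo))
      u₊≡0 : ∀ i t l → u i t (suc l) ≡ 0ℚ
      u₊≡0 i t = e₋≡0⇒≡0 (u i t) (e₋u≡0 i t)
      w : Fin (suc D) → Carrierᴹ
      w i = lincomb (λ t → u i t zero) (L.vec i)
      -- Only the coordinates at v 0 are left. For each i they contribute a vector of weight -i, and
      -- these weights are distinct.
      w≈0 : ∀ i → w i ≈ᴹ 0ᴹ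
      w≈0 = separate (λ i → - ι (toℕ i))
        (λ eq → Finₚ.toℕ-injective (ι-injective (ℚₚ.neg-injective eq))) w
        (λ i → IsSubspace.lincomb∈ (Weight-subspace (- ι (toℕ i))) (λ t → u i t zero) (L.vec i)
          (λ t → proj₁ (L.vec∈ i t)))
        (≈ᴹ-trans (≈ᴹ-sym (lowest-part u u₊≡0)) Φu≈0)
      u≡0′ : ∀ i t k → u i t k ≡ 0ℚ
      u≡0′ i t zero = L.independent i (λ t → u i t zero) (w≈0 i) t
      u≡0′ i t (suc l) = u₊≡0 i t l

    Φ-injective : ∀ u → Φ.map u ≈ᴹ 0ᴹ → ∀ i t k → u i t k ≡ 0ℚ
    -- Coordinates are indexed by k ≤ i ≤ D, so vanishing from D + 1 on is vacuous.
    Φ-injective u = Φ-ker (suc D) u λ i t k D<k → contradiction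
      (ℕₚ.≤-trans (Finₚ.toℕ≤pred[n] k) (Finₚ.toℕ≤pred[n] i)) (ℕₚ.<⇒≱ D<k)

    Im : Carrierᴹ → Set
    Im v = Σ[ u ∈ N.Carrierᴹ ] Φ.map u ≈ᴹ v

    Im-subspace : IsSubspace Im
    Im-subspace = record
      { ∈-resp = λ v≈w (u , Φu≈v) → u , ≈ᴹ-trans Φu≈v v≈w
      ; 0∈ = N.0ᴹ , Φ.0ᴹ-homo
      ; +∈ = λ (u , Φu≈v) (u′ , Φu′≈v′) →
          u N.+ᴹ u′ , ≈ᴹ-trans (Φ.+ᴹ-homo u u′) (+ᴹ-cong Φu≈v Φu′≈v′)
      ; *∈ = λ a (u , Φu≈v) → a N.*ₗ u , ≈ᴹ-trans (Φ.*ₗ-homo a u) (*ₗ-cong refl Φu≈v) }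
    module Im = IsSubspace Im-subspace

    Im-e₊ : ∀ {v} → Im v → Im (e₊ v)
    Im-e₊ (u , Φu≈v) = N.e₊ u , ≈ᴹ-trans (Φ.map-e₊ u) (E₊.⟦⟧-cong Φu≈v)

    Im-lowest : ∀ i t → Im (L.vec i t)
    Im-lowest i t = u , (begin
      Φ.map u ≈⟨ sum-cong-≋ (λ i′ → Hom.*ₗ-homo (Φᵢ i′) (δ (toℕ i) (toℕ i′)) (w i′)) ⟩
      sum (λ i′ → δ (toℕ i) (toℕ i′) *ₗ Hom.map (Φᵢ i′) (w i′))
        ≈⟨ sum-δ i (λ i′ → Hom.map (Φᵢ i′) (w i′)) ⟩
      Hom.map (Φᵢ i) (w i)
        ≈⟨ sum-cong-≋ (λ t′ → Hom.*ₗ-homo (LW.V-hom i t′) (δ (toℕ t) (toℕ t′))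
             (Standard.v (toℕ i) 0)) ⟩
      sum (λ t′ → δ (toℕ t) (toℕ t′) *ₗ LW.φ i t′ (Standard.v (toℕ i) 0))
        ≈⟨ sum-δ t (λ t′ → LW.φ i t′ (Standard.v (toℕ i) 0)) ⟩
      LW.φ i t (Standard.v (toℕ i) 0) ≈⟨ LW.φ-v i t z≤n ⟩
      L.vec i t ∎)
      where
      w : N.Carrierᴹ
      w i′ t′ k = δ (toℕ t) (toℕ t′) * Standard.v (toℕ i′) 0 k
      u : N.Carrierᴹ
      u i′ t′ k = δ (toℕ i) (toℕ i′) * w i′ t′ k

    Im-kernel : ∀ n v → Weight (- ι n) v → e₋ v ≈ᴹ 0ᴹ → Im v
    Im-kernel n v hv e₋v≈0 with ℕₚ.≤-<-connex n D
    ... | inj₂ D<n = Im.∈-resp (≈ᴹ-sym (bounded₋ {n} D<n hv)) Im.0∈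
    ... | inj₁ n≤D = Im.∈-resp (≈ᴹ-sym (proj₂ spanned))
            (Im.lincomb∈ (proj₁ spanned) (L.vec i) (Im-lowest i))
      where
      i = fromℕ< (s≤s n≤D)
      spanned = L.spans i
        (subst (λ m → Weight (- ι m) v) (sym (Finₚ.toℕ-fromℕ< (s≤s n≤D))) hv , e₋v≈0)

    -- `fuel` bounds the remaining steps: each passes from weight -n to -n - 2, and below -D only 0
    -- is left. Since e₋ v has weight -n - 2, the inversion of e₋ e₊ is available even for n = 0.
    Im-low : ∀ fuel n v → D < n ℕ.+ fuel → Weight (- ι n) v → Im v
    Im-low zero n v D<n hv = Im.∈-resp
      (≈ᴹ-sym (bounded₋ {n} (subst (D <_) (ℕₚ.+-identityʳ n) D<n) hv)) Im.0∈
    Im-low (suc fuel) n v D<n+1+fuel hv = Im.∈-resp v≈ (Im.+∈ Im-e₊r (Im-kernel n κ hκ e₋κ≈0))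
      where
      onto = e₋e₊-onto {D} (λ {N} {v} → bounded₋ {N} {v}) (suc n) {e₋ v}
        (weight-e₋ { - ι n} (-ι-suc-suc n) hv)
      r = proj₁ onto
      hr = proj₁ (proj₂ onto)
      Im-e₊r : Im (e₊ r)
      Im-e₊r = Im-e₊ (Im-low fuel (suc (suc n)) r
        (ℕₚ.<-≤-trans D<n+1+fuel (ℕₚ.≤-trans (ℕₚ.≤-reflexive (ℕₚ.+-suc n fuel)) (ℕₚ.n≤1+n _))) hr)
      κ = v +ᴹ (- 1ℚ) *ₗ e₊ r
      module W = IsSubspace (Weight-subspace (- ι n))
      hκ : Weight (- ι n) κ
      hκ = W.+∈ hv (W.*∈ (- 1ℚ) (weight-e₊ { - ι (suc (suc n))} (sym (-ι-suc-suc n)) hr))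
      cancel : ∀ w → w +ᴹ (- 1ℚ) *ₗ w ≈ᴹ 0ᴹ
      cancel w = ≈ᴹ-trans
        (combine (w ∷ []) (#₀ ⊕ (- 1ℚ) ⊙ #₀) (0ℚ ⊙ #₀) (λ { zero → refl })) (*ₗ-zeroˡ w)
      e₋κ≈0 : e₋ κ ≈ᴹ 0ᴹ
      e₋κ≈0 = ≈ᴹ-trans (E₋.+ᴹ-homo v _) (≈ᴹ-trans (+ᴹ-cong ≈ᴹ-refl (≈ᴹ-trans
        (E₋.*ₗ-homo (- 1ℚ) (e₊ r)) (*ₗ-cong refl (proj₂ (proj₂ onto))))) (cancel (e₋ v)))
      v≈ : e₊ r +ᴹ κ ≈ᴹ v
      v≈ = combine (v ∷ e₊ r ∷ []) (#₁ ⊕ (#₀ ⊕ (- 1ℚ) ⊙ #₁)) #₀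
        (λ { zero → refl ; (suc zero) → refl })

    Im-high : ∀ n v → Weight (ι n) v → Im v
    Im-high zero v hv = Im-low (suc D) 0 v ℕₚ.≤-refl (≈ᴹ-trans hv
      (*ₗ-cong (trans ι-0 (cong -_ (sym ι-0))) ≈ᴹ-refl))
    Im-high (suc n) v hv = Im.∈-resp (proj₂ (proj₂ onto)) (Im-e₊ (below n refl))
      where
      open ℚSolver.+-*-Solver
      onto = DualWeights.e₊e₋-onto M {D} (λ {N} {v} → bounded₊ {N} {v}) n {v} hv
      r = proj₁ onto
      hr = proj₁ (proj₂ onto)
      -- The weight of `e₋ r` is n - 1. For n = 0 this is -1, which `Im-low` covers; otherwise it is
      -- a smaller nonnegative weight.
      below : ∀ m → m ≡ n → Im (e₋ r)
      below zero refl = Im-low D 1 (e₋ r) ℕₚ.≤-refl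
        (weight-e₋ {ι 1} (eq (ι 0) (ι 1) ι-0 (ι-suc 0)) hr)
        where
        eq : ∀ a b → a ≡ 0ℚ → b ≡ 1ℚ + a → - b + fromℕ 2 ≡ b
        eq _ _ refl refl = refl
      below (suc m) refl = Im-high m (e₋ r) (weight-e₋ {ι (suc (suc m))}
        (eq (ι m) (ι (suc m)) (ι (suc (suc m))) (ι-suc m) (ι-suc (suc m))) hr)
        where
        eq : ∀ a b c → b ≡ 1ℚ + a → c ≡ 1ℚ + b → a + fromℕ 2 ≡ c
        eq a _ _ refl refl = solve 1 (λ a → a :+ con (fromℕ 2) := con 1ℚ :+ (con 1ℚ :+ a)) refl a

    decomposition : M ≅ ⨁ (λ i → mult i · V (toℕ i))
    decomposition = bijective⇒≅ Φ Φ-injective onto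
      where
      Im-weight : ∀ v → ∃[ N ] (Weight (- ι N) v ⊎ Weight (ι N) v) → Im v
      Im-weight v (n , inj₁ hv) = Im-low (suc D) n v (ℕₚ.m≤n+m (suc D) n) hv
      Im-weight v (n , inj₂ hv) = Im-high n v hv
      onto : ∀ v → Im v
      onto v = let n , w , hw , v≈ = weight-sum v in
        Im.∈-resp (≈ᴹ-sym v≈) (Im.sum∈ w (λ q → Im-weight (w q) (hw q)))

open SL2Representations

-- Weight spaces of symmetric polynomials

module SymmetricPolynomialModule where

  open import Data.Rational using (_+_; _*_; -_; _-_)

  γ-nonintegral : ∀ m n q → (∀ j → q ≢ fromℕ j) → γ m n q ≡ 0ℤ
  γ-nonintegral m n (mkℚ (+ j) zero _) q≢ = contradiction refl (q≢ j)
  γ-nonintegral m n (mkℚ (+ _) (suc _) _) q≢ = refl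
  γ-nonintegral m n (mkℚ -[1+ _ ] _ _) q≢ = refl

  module _ (n d i : ℕ) where
    private
      q : ℚ
      q = ½ * fromℕ (d ℕ.* n) - ½ * fromℕ i

      q≡ι : q ≡ ½ * ι (n ℕ.* d) - ½ * ι i
      q≡ι = cong₂ (λ a b → ½ * a - ½ * b)
        (trans (sym (ι≡fromℕ (d ℕ.* n))) (cong ι (ℕₚ.*-comm d n))) (sym (ι≡fromℕ i))

      ι-double : ∀ s → ι (2 ℕ.* s ℕ.+ i) ≡ fromℕ 2 * ι s + ι i
      ι-double s = trans (ι-+ (2 ℕ.* s) i)
        (cong (_+ ι i) (trans (ι-* 2 s) (cong (_* ι s) (ι≡fromℕ 2))))

      q-integral : ∀ s → 2 ℕ.* s ℕ.+ i ≡ n ℕ.* d → q ≡ ι s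
      q-integral s eq = trans q≡ι
        (halve (ι (n ℕ.* d)) (ι i) (ι s) (trans (cong ι (sym eq)) (ι-double s)))
        where
        halve : ∀ a b s → a ≡ fromℕ 2 * s + b → ½ * a - ½ * b ≡ s
        halve _ b s refl =
          solve 2 (λ b s → con ½ :* (con (fromℕ 2) :* s :+ b) :- con ½ :* b := s) refl b s
          where open ℚSolver.+-*-Solver

      q-integral⁻ : ∀ s → q ≡ ι s → 2 ℕ.* s ℕ.+ i ≡ n ℕ.* d
      q-integral⁻ s eq = ι-injective (trans (ι-double s)
        (sym (double (ι (n ℕ.* d)) (ι i) (ι s) (trans (sym q≡ι) eq))))
        where
        double : ∀ a b s → ½ * a - ½ * b ≡ s → a ≡ fromℕ 2 * s + b
        double a b _ refl =
          solve 2 (λ a b → a := con (fromℕ 2) :* (con ½ :* a :- con ½ :* b) :+ b) refl a b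
          where open ℚSolver.+-*-Solver

      γ-ι : ∀ s q → q ≡ ι s → γ (d ℕ.+ n) n q ≡ + count n d s
      γ-ι s q q≡ = trans (cong (γ (d ℕ.+ n) n) (trans q≡ (ι≡fromℕ s))) (γ-count n d s)

    -- Here q = 0, so the second argument of γ is -1 and its value is 0 by convention.
    c-zero : 2 ℕ.* 0 ℕ.+ i ≡ n ℕ.* d → c n d i ≡ + count n d 0
    c-zero eq = trans (cong₂ ℤ._-_ (γ-ι 0 q (q-integral 0 eq))
      (cong (λ t → γ (d ℕ.+ n) n (t - 1ℚ)) (trans (q-integral 0 eq) ι-0)))
      (ℤₚ.+-identityʳ (+ count n d 0))

    c-suc : ∀ s → 2 ℕ.* suc s ℕ.+ i ≡ n ℕ.* d → c n d i ≡ + count n d (suc s) ℤ.- + count n d s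
    c-suc s eq = cong₂ ℤ._-_ (γ-ι (suc s) q (q-integral (suc s) eq))
      (γ-ι s (q - 1ℚ) (predecessor q (ι s) (trans (q-integral (suc s) eq) (ι-suc s))))
      where
      predecessor : ∀ q r → q ≡ 1ℚ + r → q - 1ℚ ≡ r
      predecessor _ r refl = solve 1 (λ r → con 1ℚ :+ r :- con 1ℚ := r) refl r
        where open ℚSolver.+-*-Solver

    -- If q or q - 1 were a natural number j, then s = j or s = j + 1 would solve 2s + i = nd. Hence
    -- both values of γ are 0 by convention.
    c-odd : (∀ s → 2 ℕ.* s ℕ.+ i ≢ n ℕ.* d) → c n d i ≡ 0ℤ
    c-odd odd = cong₂ ℤ._-_
      (γ-nonintegral (d ℕ.+ n) n q (λ j eq → odd j (q-integral⁻ j (trans eq (sym (ι≡fromℕ j))))))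
      (γ-nonintegral (d ℕ.+ n) n (q - 1ℚ) (λ j eq → odd (suc j) (q-integral⁻ (suc j)
        (trans (successor q (ι j) (trans eq (sym (ι≡fromℕ j)))) (sym (ι-suc j))))))
      where
      successor : ∀ q r → q - 1ℚ ≡ r → q ≡ 1ℚ + r
      successor q _ refl = solve 1 (λ q → q := con 1ℚ :+ (q :- con 1ℚ)) refl q
        where open ℚSolver.+-*-Solver

  sum-exponents : ∀ {n} (α : Vec ℕ n) → ℚΣ.sum (λ k → fromℕ (lookup α k)) ≡ ι ∣ α ∣
  sum-exponents [] = sym ι-0
  sum-exponents (m ∷ α) = trans (cong₂ _+_ (sym (ι≡fromℕ m)) (sum-exponents α)) (sym (ι-+ m ∣ α ∣))

  -- Euler's identity: the sum of the x_k ∂_k multiplies x^α by ∣α∣. So h is diagonal on monomials,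
  -- and its weight spaces are the homogeneous parts.
  coeff-Euler : ∀ n d (p : Polynomial n) α →
    coeff (Operators.H n d p) α ≡ (fromℕ 2 * ι ∣ α ∣ - ι (n ℕ.* d)) * coeff p α
  coeff-Euler n d p α = combine-terms (coeff p α) (fromℕ (n ℕ.* d)) (ι (n ℕ.* d)) _ (ι ∣ α ∣)
    (sym (ι≡fromℕ (n ℕ.* d)))
    (trans (coeff-sum (λ k → x k (∂ k p)) α)
      (trans (ℚΣ.sum-cong-≋ (λ k → coeff-x∂ k p α))
        (trans (sym (ℚΣ.*-distribʳ-sum (coeff p α) (λ k → fromℕ (lookup α k))))
          (cong (_* coeff p α) (sum-exponents α)))))
    where
    open OperatorProperties n d using (coeff-sum; coeff-x∂)
    open ℚSolver.+-*-Solver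
    combine-terms : ∀ y D D′ s a → D ≡ D′ → s ≡ a * y →
      fromℕ 2 * s + - (D * y) ≡ (fromℕ 2 * a - D′) * y
    combine-terms y D _ _ a refl refl = solve 3 (λ y D a →
      con (fromℕ 2) :* (a :* y) :+ :- (D :* y) := (con (fromℕ 2) :* a :- D) :* y) refl y D a

  module SymmetricPolynomials (n d : ℕ) where
    open SL2Module (Λ n d)
    open Weights (Λ n d)
    open Sums vectorSpace
    open Bases vectorSpace

    D : ℕ
    D = n ℕ.* d

    infix 8 _at_
    _at_ : Carrierᴹ → Vec ℕ n → ℚ
    f at α = coeff (polynomial f) α

    at-linear : ∀ α → IsLinear vectorSpace ℚ¹ (_at α)
    at-linear α = linear vectorSpace ℚ¹ (_at α) (λ f≈g → f≈g α) (λ _ _ → refl) (λ _ _ → refl)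

    at-sum : ∀ {m} (w : Fin m → Carrierᴹ) α → sum w at α ≡ ℚΣ.sum (λ q → w q at α)
    at-sum w α = linear-sum vectorSpace ℚ¹ (at-linear α) w

    at-lincomb : ∀ {m} a (w : Fin m → Carrierᴹ) α → lincomb a w at α ≡ ℚΣ.sum (λ q → a q * w q at α)
    at-lincomb a w α = linear-lincomb vectorSpace ℚ¹ (at-linear α) a w

    degree-vanish : ∀ f α → D < ∣ α ∣ → f at α ≡ 0ℚ
    degree-vanish f α D<∣α∣ with Finₚ.all? (λ k → lookup α k ℕ.≤? d)
    ... | yes α≤d = contradiction (∣∣-≤ α α≤d) (ℕₚ.<⇒≱ D<∣α∣)
    ... | no ¬α≤d with k , αk≰d ← Finₚ.¬∀⟶∃¬ n
            (λ k → lookup α k ≤ d) (λ k → lookup α k ℕ.≤? d) ¬α≤d =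
      degrees f α k (ℕₚ.≰⇒> αk≰d)

    Homogeneous : ℕ → Carrierᴹ → Set
    Homogeneous s f = ∀ α → ∣ α ∣ ≢ s → f at α ≡ 0ℚ

    weight-vanish : ∀ {μ f} → Weight μ f → ∀ α → fromℕ 2 * ι ∣ α ∣ - ι D ≢ μ → f at α ≡ 0ℚ
    weight-vanish {μ} {f} hf α w≢μ = *-cancel-0
      (λ eq → w≢μ (ℚG.x∙y⁻¹≈ε⇒x≈y (fromℕ 2 * ι ∣ α ∣ - ι D) μ eq))
      (difference (fromℕ 2 * ι ∣ α ∣ - ι D) (f at α)
        (trans (sym (coeff-Euler n d (polynomial f) α)) (hf α)))
      where
      difference : ∀ w y → w * y ≡ μ * y → (w - μ) * y ≡ 0ℚ
      difference w y eq = trans (solve 3 (λ w m y → (w :- m) :* y := w :* y :- m :* y) refl w μ y)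
        (trans (cong (_- μ * y) eq) (ℚₚ.+-inverseʳ (μ * y)))
        where open ℚSolver.+-*-Solver

    homogeneous-weight : ∀ {s μ f} → fromℕ 2 * ι s - ι D ≡ μ → Homogeneous s f → Weight μ f
    homogeneous-weight {s} {μ} {f} eq hom α =
      trans (coeff-Euler n d (polynomial f) α) (go (∣ α ∣ ℕ.≟ s))
      where
      go : Dec (∣ α ∣ ≡ s) → (fromℕ 2 * ι ∣ α ∣ - ι D) * f at α ≡ μ * f at α
      go (yes ∣α∣≡s) = cong (_* f at α) (trans (cong (λ t → fromℕ 2 * ι t - ι D) ∣α∣≡s) eq)
      go (no ∣α∣≢s) = trans (cong ((fromℕ 2 * ι ∣ α ∣ - ι D) *_) (hom α ∣α∣≢s))
        (trans (ℚₚ.*-zeroʳ (fromℕ 2 * ι ∣ α ∣ - ι D))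
          (trans (sym (ℚₚ.*-zeroʳ μ)) (cong (μ *_) (sym (hom α ∣α∣≢s)))))

    private
      ι-2* : ∀ a → ι (2 ℕ.* a) ≡ fromℕ 2 * ι a
      ι-2* a = trans (ι-* 2 a) (cong (_* ι a) (ι≡fromℕ 2))

    module _ where
      open ℚSolver.+-*-Solver

      low-weight : ∀ {a N} → 2 ℕ.* a ℕ.+ N ≡ D → fromℕ 2 * ι a - ι D ≡ - ι N
      low-weight {a} {N} eq = scalar (fromℕ 2 * ι a) (ι N) (ι D)
        (trans (cong ι (sym eq)) (trans (ι-+ (2 ℕ.* a) N) (cong (_+ ι N) (ι-2* a))))
        where
        scalar : ∀ a N D → D ≡ a + N → a - D ≡ - N
        scalar a N _ refl = solve 2 (λ a N → a :- (a :+ N) := :- N) refl a N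

      low-weight⁻ : ∀ {a N} → fromℕ 2 * ι a - ι D ≡ - ι N → 2 ℕ.* a ℕ.+ N ≡ D
      low-weight⁻ {a} {N} eq = ι-injective (trans (ι-+ (2 ℕ.* a) N)
        (trans (cong (_+ ι N) (ι-2* a)) (scalar (fromℕ 2 * ι a) (ι N) (ι D) eq)))
        where
        scalar : ∀ a N D → a - D ≡ - N → a + N ≡ D
        scalar a N D eq = trans (solve 3 (λ a N D → a :+ N := (a :- D) :+ N :+ D) refl a N D)
          (trans (cong (λ t → t + N + D) eq) (solve 2 (λ N D → :- N :+ N :+ D := D) refl N D))

      high-weight : ∀ {a N} → 2 ℕ.* a ≡ D ℕ.+ N → fromℕ 2 * ι a - ι D ≡ ι N
      high-weight {a} {N} eq = scalar (fromℕ 2 * ι a) (ι N) (ι D)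
        (trans (sym (ι-2* a)) (trans (cong ι eq) (ι-+ D N)))
        where
        scalar : ∀ a N D → a ≡ D + N → a - D ≡ N
        scalar _ N D refl = solve 2 (λ N D → D :+ N :- D := N) refl N D

      high-weight⁻ : ∀ {a N} → fromℕ 2 * ι a - ι D ≡ ι N → 2 ℕ.* a ≡ D ℕ.+ N
      high-weight⁻ {a} {N} eq = ι-injective (trans (ι-2* a)
        (trans (scalar (fromℕ 2 * ι a) (ι N) (ι D) eq) (sym (ι-+ D N))))
        where
        scalar : ∀ a N D → a - D ≡ N → a ≡ D + N
        scalar a _ D refl = solve 2 (λ a D → a := D :+ (a :- D)) refl a D

    bounded₋ : ∀ {N f} → D < N → Weight (- ι N) f → f ≈ᴹ 0ᴹ
    bounded₋ {N} {f} D<N hf α = weight-vanish {f = f} hf α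
      (λ eq → ℕₚ.<-irrefl refl (ℕₚ.<-≤-trans D<N
        (subst (N ≤_) (low-weight⁻ {∣ α ∣} {N} eq) (ℕₚ.m≤n+m N (2 ℕ.* ∣ α ∣)))))

    bounded₊ : ∀ {N f} → D < N → Weight (ι N) f → f ≈ᴹ 0ᴹ
    bounded₊ {N} {f} D<N hf α = go (∣ α ∣ ℕ.≤? D)
      where
      -- Beyond degree D some exponent exceeds d. Up to degree D, weight N would mean 2∣α∣ = D + N >
      -- 2D.
      go : Dec (∣ α ∣ ≤ D) → f at α ≡ 0ℚ
      go (no ∣α∣≰D) = degree-vanish f α (ℕₚ.≰⇒> ∣α∣≰D)
      go (yes ∣α∣≤D) = weight-vanish {f = f} hf α (λ eq → ℕₚ.<-irrefl (high-weight⁻ {∣ α ∣} {N} eq)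
        (ℕₚ.+-mono-≤-< ∣α∣≤D (subst (_< N) (sym (ℕₚ.+-identityʳ ∣ α ∣)) (ℕₚ.≤-<-trans ∣α∣≤D D<N))))

    component : ℕ → Carrierᴹ → Carrierᴹ
    component j f = record
      { polynomial = record
        { coeff = λ α → δ ∣ α ∣ j * f at α
        ; bound = d
        ; bounded = vanish }
      ; symmetric = λ σ α → cong₂ (λ a y → δ a j * y) (∣permute∣ σ α) (symmetric f σ α)
      ; degrees = vanish }
      where
      vanish : DegreesAtMost d (λ α → δ ∣ α ∣ j * f at α)
      vanish α k d<αk = trans (cong (δ ∣ α ∣ j *_) (degrees f α k d<αk)) (ℚₚ.*-zeroʳ (δ ∣ α ∣ j))

    component-homogeneous : ∀ j f → Homogeneous j (component j f)
    component-homogeneous j f α ∣α∣≢j =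
      trans (cong (_* f at α) (δ-≢ ∣ α ∣ j ∣α∣≢j)) (ℚₚ.*-zeroˡ (f at α))

    sum-components : ∀ f → f ≈ᴹ sum {suc D} (λ j → component (toℕ j) f)
    sum-components f α = sym
      (trans (at-sum {suc D} (λ j → component (toℕ j) f) α) (go (∣ α ∣ ℕ.≤? D)))
      where
      go : Dec (∣ α ∣ ≤ D) → ℚΣ.sum {suc D} (λ j → δ ∣ α ∣ (toℕ j) * f at α) ≡ f at α
      go (yes ∣α∣≤D) = subst
        (λ m → ℚΣ.sum {suc D} (λ j → δ m (toℕ j) * f at α) ≡ f at α)
        (Finₚ.toℕ-fromℕ< (s≤s ∣α∣≤D)) (δ-in (fromℕ< (s≤s ∣α∣≤D)) (λ _ → f at α))
      go (no ∣α∣≰D) = trans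
        (∑-zero {suc D} (λ j → δ ∣ α ∣ (toℕ j) * f at α)
          (λ j → trans (cong (δ ∣ α ∣ (toℕ j) *_) fα≡0) (ℚₚ.*-zeroʳ (δ ∣ α ∣ (toℕ j)))))
        (sym fα≡0)
        where fα≡0 = degree-vanish f α (ℕₚ.≰⇒> ∣α∣≰D)

    weight-sum : ∀ f → ∃[ m ] Σ[ w ∈ (Fin m → Carrierᴹ) ]
      (∀ q → ∃[ N ] (Weight (- ι N) (w q) ⊎ Weight (ι N) (w q))) × f ≈ᴹ sum w
    weight-sum f = suc D , (λ j → component (toℕ j) f) , (λ j → weight (toℕ j)) , sum-components f
      where
      weight : ∀ j → ∃[ N ] (Weight (- ι N) (component j f) ⊎ Weight (ι N) (component j f))
      weight j = go (ℕₚ.≤-total (2 ℕ.* j) D)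
        where
        go : 2 ℕ.* j ≤ D ⊎ D ≤ 2 ℕ.* j → _
        go (inj₁ 2j≤D) = D ∸ 2 ℕ.* j , inj₁ (homogeneous-weight {j} {f = component j f}
          (low-weight {j} (ℕₚ.m+[n∸m]≡n 2j≤D)) (component-homogeneous j f))
        go (inj₂ D≤2j) = 2 ℕ.* j ∸ D , inj₂ (homogeneous-weight {j} {f = component j f}
          (high-weight {j} (sym (ℕₚ.m+[n∸m]≡n D≤2j))) (component-homogeneous j f))

    module _ {s : ℕ} where
      open PartitionInRectangle

      -- The monomial symmetric polynomial of π. Testing `key α` against π gives every monomial of
      -- the orbit coefficient 1, so no sum over permutations has to be corrected for stabilisers.
      orbitSum : PartitionInRectangle n d s → Carrierᴹ
      orbitSum π = record
        { polynomial = record { coeff = value ; bound = d ; bounded = vanish }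
        ; symmetric = λ σ α → cong
            (λ κ → if does (Listₚ.≡-dec ℕ._≟_ κ (parts π)) then 1ℚ else 0ℚ) (key-permute σ α)
        ; degrees = vanish }
        where
        value : Coefficients n
        value α = if does (Listₚ.≡-dec ℕ._≟_ (key α) (parts π)) then 1ℚ else 0ℚ
        vanish : DegreesAtMost d value
        vanish α k d<αk = cong (if_then 1ℚ else 0ℚ) (dec-false (Listₚ.≡-dec ℕ._≟_ (key α) (parts π))
          (λ eq → ℕₚ.<⇒≱ d<αk (key-≤ α (subst (All (_≤ d)) (sym eq) (parts-≤ π)) k)))

      orbitSum-≡ : ∀ π α → key α ≡ parts π → orbitSum π at α ≡ 1ℚ
      orbitSum-≡ π α eq =
        cong (if_then 1ℚ else 0ℚ) (dec-true (Listₚ.≡-dec ℕ._≟_ (key α) (parts π)) eq)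

      orbitSum-≢ : ∀ π α → key α ≢ parts π → orbitSum π at α ≡ 0ℚ
      orbitSum-≢ π α neq =
        cong (if_then 1ℚ else 0ℚ) (dec-false (Listₚ.≡-dec ℕ._≟_ (key α) (parts π)) neq)

      orbitSum-homogeneous : ∀ π → Homogeneous s (orbitSum π)
      orbitSum-homogeneous π α ∣α∣≢s = orbitSum-≢ π α
        (λ eq → ∣α∣≢s (trans (sym (sum-key α)) (trans (cong sumˡ eq) (sum-parts π))))

    module _ (s : ℕ) where
      open PartitionInRectangle

      private
        module P = Inverse (count-↔ n d s)

        to-injective : ∀ {p q} → P.to p ≡ P.to q → p ≡ q
        to-injective {p} {q} eq =
          trans (sym (P.strictlyInverseʳ p)) (trans (cong P.from eq) (P.strictlyInverseʳ q))

      monomial : Fin (count n d s) → Carrierᴹ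
      monomial q = orbitSum (P.to q)

      exponents : Fin (count n d s) → Vec ℕ n
      exponents q = representative (P.to q)

      private
        key-exponents : ∀ q → key (exponents q) ≡ parts (P.to q)
        key-exponents q = key-representative (P.to q)

        monomial-δ : ∀ q α → key α ≡ parts (P.to q) → ∀ p → monomial p at α ≡ δ (toℕ q) (toℕ p)
        monomial-δ q α keyα≡ p = go (q Finₚ.≟ p)
          where
          δ-refl : ∀ m → δ m m ≡ 1ℚ
          δ-refl zero = refl
          δ-refl (suc m) = δ-refl m
          go : Dec (q ≡ p) → monomial p at α ≡ δ (toℕ q) (toℕ p)
          go (yes refl) = trans (orbitSum-≡ (P.to q) α keyα≡) (sym (δ-refl (toℕ q)))
          go (no q≢p) = trans
            (orbitSum-≢ (P.to p) α (λ keyα≡′ → q≢p (to-injective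
              (parts-injective (trans (sym keyα≡) keyα≡′)))))
            (sym (δ-≢ (toℕ q) (toℕ p) (q≢p ∘ Finₚ.toℕ-injective)))

      -- Distinct partitions have disjoint orbits, so only the q-th term contributes at α.
      monomial-coefficient : ∀ a q α → key α ≡ parts (P.to q) → lincomb a monomial at α ≡ a q
      monomial-coefficient a q α keyα≡ = trans (at-lincomb a monomial α)
        (trans (ℚΣ.sum-cong-≋ (λ p → trans (cong (a p *_) (monomial-δ q α keyα≡ p))
            (ℚₚ.*-comm (a p) (δ (toℕ q) (toℕ p)))))
          (δ-in q a))

      at-exponents : ∀ a q → lincomb a monomial at exponents q ≡ a q
      at-exponents a q = monomial-coefficient a q (exponents q) (key-exponents q)

      monomial-expansion : ∀ f → Homogeneous s f → f ≈ᴹ lincomb (λ q → f at exponents q) monomial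
      monomial-expansion f hom α = go (∣ α ∣ ℕ.≟ s) (Finₚ.all? (λ k → lookup α k ℕ.≤? d))
        where
        a : Fin (count n d s) → ℚ
        a q = f at exponents q
        go : Dec (∣ α ∣ ≡ s) → Dec (∀ k → lookup α k ≤ d) → f at α ≡ lincomb a monomial at α
        go (no ∣α∣≢s) _ = trans (hom α ∣α∣≢s) (sym (trans (at-lincomb a monomial α)
          (∑-zero (λ q → a q * monomial q at α) (λ q → trans
            (cong (a q *_) (orbitSum-homogeneous (P.to q) α ∣α∣≢s)) (ℚₚ.*-zeroʳ (a q))))))
        go (yes _) (no ¬α≤d) =
          let k , αk≰d = Finₚ.¬∀⟶∃¬ n (λ k → lookup α k ≤ d) (λ k → lookup α k ℕ.≤? d) ¬α≤d in
          trans (degrees f α k (ℕₚ.≰⇒> αk≰d))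
            (sym (degrees (lincomb a monomial) α k (ℕₚ.≰⇒> αk≰d)))
        go (yes ∣α∣≡s) (yes α≤d) =
          trans (Symmetric-key (symmetric f) α (exponents q) (trans keyα≡ (sym (key-exponents q))))
            (sym (monomial-coefficient a q α keyα≡))
          where
          π = toPartition α α≤d ∣α∣≡s
          q = P.from π
          keyα≡ : key α ≡ parts (P.to q)
          keyα≡ = cong parts (sym (P.strictlyInverseˡ π))

      monomial-basis : Basis (Homogeneous s) (count n d s)
      monomial-basis = record
        { vec = monomial
        ; vec∈ = λ q → orbitSum-homogeneous (P.to q)
        ; independent = λ a a≈0 q → trans (sym (at-exponents a q)) (a≈0 (exponents q))
        ; spans = λ {f} hom → (λ q → f at exponents q) , monomial-expansion f hom }

    weight-homogeneous : ∀ {s i f} → 2 ℕ.* s ℕ.+ i ≡ D → Weight (- ι i) f → Homogeneous s f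
    weight-homogeneous {s} {i} {f} 2s+i≡D hf α ∣α∣≢s = weight-vanish {f = f} hf α
      (λ eq → ∣α∣≢s (ℕₚ.*-cancelˡ-≡ ∣ α ∣ s 2 (ℕₚ.+-cancelʳ-≡ i _ _
        (trans (low-weight⁻ {∣ α ∣} {i} eq) (sym 2s+i≡D)))))

    weight-basis : ∀ s i → 2 ℕ.* s ℕ.+ i ≡ D → Basis (Weight (- ι i)) (count n d s)
    weight-basis s i 2s+i≡D = Basis-resp
      (λ {f} → homogeneous-weight {s} {f = f} (low-weight {s} 2s+i≡D))
      (λ {f} → weight-homogeneous {s} {i} {f} 2s+i≡D) (monomial-basis s)

    Lowest : ℕ → Carrierᴹ → Set
    Lowest i f = Weight (- ι i) f × e₋ f ≈ᴹ 0ᴹ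

    weight-lowered : ∀ i {f} → Weight (- ι i) f → Weight (- ι (suc (suc i))) (e₋ f)
    weight-lowered i {f} hf = weight-e₋ { - ι i} { - ι (suc (suc i))} {f} (-ι-suc-suc i) hf

    -- In degree 0 the weight is -D, and e₋ leads to -D - 2, where there is only 0. So e₋ kills the
    -- whole weight space.
    lowest-0 : ∀ i → 2 ℕ.* 0 ℕ.+ i ≡ D → Basis (Lowest i) (count n d 0)
    lowest-0 i i≡D = Basis-resp
      (λ {f} hf → hf , bounded₋ {suc (suc i)} {e₋ f}
        (s≤s (ℕₚ.≤-trans (ℕₚ.≤-reflexive (sym i≡D)) (ℕₚ.n≤1+n i)))
        (weight-lowered i {f} hf))
      proj₁ (weight-basis 0 i i≡D)

    lowest-odd : ∀ i → (∀ s → 2 ℕ.* s ℕ.+ i ≢ D) → Basis (Lowest i) 0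
    lowest-odd i odd = record
      { vec = λ () ; vec∈ = λ () ; independent = λ _ _ ()
      ; spans = λ {f} (hf , _) → (λ ()) ,
          λ α → weight-vanish {f = f} hf α (λ eq → odd ∣ α ∣ (low-weight⁻ {∣ α ∣} {i} eq)) }

    -- The functionals `φ q` are the coordinates of e₋ f in the monomial basis of degree s, so their
    -- common kernel is the kernel of e₋, and rank-nullity applies once they are jointly onto.
    lowest-suc : ∀ s i → 2 ℕ.* suc s ℕ.+ i ≡ D →
      ∃[ k ] k ℕ.+ count n d s ≡ count n d (suc s) × Basis (Lowest i) k
    lowest-suc s i eq =
      let k , k+b≡ , B = rank-nullity (count n d s)
            (Weight-subspace (- ι i)) (weight-basis (suc s) i eq)
            φ φ-linear onto
      in k , k+b≡ , Basis-resp
        (λ {f} (hf , φ≡0) → hf , λ α → trans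
          (monomial-expansion s (e₋ f)
            (weight-homogeneous {s} {f = e₋ f} eq′ (weight-lowered i {f} hf)) α)
          (trans (at-lincomb (λ q → φ q f) (monomial s) α) (∑-zero (λ q → φ q f * monomial s q at α)
            (λ q → trans (cong (_* monomial s q at α) (φ≡0 q)) (ℚₚ.*-zeroˡ (monomial s q at α))))))
        (λ {f} (hf , e₋f≈0) → hf , λ q → e₋f≈0 (exponents s q)) B
      where
      eq′ : 2 ℕ.* s ℕ.+ suc (suc i) ≡ D
      eq′ = trans (trans (ℕₚ.+-suc (2 ℕ.* s) (suc i)) (cong suc (ℕₚ.+-suc (2 ℕ.* s) i)))
        (trans (cong (ℕ._+ i) (sym (ℕₚ.*-suc 2 s))) eq)
      φ : Fin (count n d s) → Carrierᴹ → ℚ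
      φ q f = e₋ f at exponents s q
      φ-linear : ∀ q → IsLinear vectorSpace ℚ¹ (φ q)
      φ-linear q = linear vectorSpace ℚ¹ (φ q)
        (λ {f} {g} f≈g → E₋.⟦⟧-cong {f} {g} f≈g (exponents s q))
        (λ f g → E₋.+ᴹ-homo f g (exponents s q))
        (λ a f → E₋.*ₗ-homo a f (exponents s q))
      onto : ∀ (y : Fin (count n d s) → ℚ) →
        ∃[ f ] Weight (- ι i) f × (∀ q → φ q f ≡ y q)
      onto y =
        -- The polynomial with the prescribed coordinates has weight -i - 2, so it equals e₋ (e₊ r)
        -- for some r of that weight, and e₊ r is the preimage under e₋.
        let g = lincomb y (monomial s)
            hg = IsSubspace.lincomb∈ (Weight-subspace (- ι (suc (suc i)))) y (monomial s)
                   (Basis.vec∈ (weight-basis s (suc (suc i)) eq′))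
            r , hr , e₋e₊r≈g = e₋e₊-onto {D} (λ {N} {v} → bounded₋ {N} {v}) (suc i) {g} hg
        in e₊ r , weight-e₊ { - ι (suc (suc i))} {v = r} (sym (-ι-suc-suc i)) hr ,
           λ q → trans (e₋e₊r≈g (exponents s q)) (at-exponents s y q)

open SymmetricPolynomialModule

-- Multiplicities of the summands and the theorem

halve : ∀ m → ∃[ s ] (2 ℕ.* s ≡ m ⊎ suc (2 ℕ.* s) ≡ m)
halve zero = 0 , inj₁ refl
halve (suc m) with halve m
... | s , inj₁ refl = s , inj₂ refl
... | s , inj₂ refl = suc s , inj₁ (ℕₚ.*-suc 2 s)

module LowestWeights (n d : ℕ) where
  open SymmetricPolynomials n d
  open Bases (SL2Module.vectorSpace (Λ n d)) using (Basis)

  -- The parity of D - i decides whether weight -i occurs; if it does, the degree is half of D - i.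
  -- In positive degree, the equation k + b = a from rank-nullity exhibits the integer a - b as the
  -- natural number k.
  lowest : ∀ i → i ≤ D → ∃[ k ] + k ≡ c n d i × Basis (Lowest i) k
  lowest i i≤D = go (halve (D ∸ i))
    where
    go : ∃[ s ] (2 ℕ.* s ≡ D ∸ i ⊎ suc (2 ℕ.* s) ≡ D ∸ i) →
         ∃[ k ] + k ≡ c n d i × Basis (Lowest i) k
    go (s , inj₂ 1+2s≡) = 0 , sym (c-odd n d i odd) , lowest-odd i odd
      where
      odd : ∀ t → 2 ℕ.* t ℕ.+ i ≢ D
      odd t 2t+i≡D = ℕₚ.even≢odd t s (trans
        (sym (trans (cong (_∸ i) (sym 2t+i≡D)) (ℕₚ.m+n∸n≡m (2 ℕ.* t) i))) (sym 1+2s≡))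
    go (zero , inj₁ 0≡) = count n d 0 , sym (c-zero n d i i≡D) , lowest-0 i i≡D
      where
      i≡D : 2 ℕ.* 0 ℕ.+ i ≡ D
      i≡D = trans (cong (ℕ._+ i) 0≡) (ℕₚ.m∸n+n≡m i≤D)
    go (suc s , inj₁ 2s≡) =
      let k , k+b≡a , B = lowest-suc s i 2s+i≡D in
      k , trans (difference k k+b≡a) (sym (c-suc n d i s 2s+i≡D)) , B
      where
      2s+i≡D : 2 ℕ.* suc s ℕ.+ i ≡ D
      2s+i≡D = trans (cong (ℕ._+ i) 2s≡) (ℕₚ.m∸n+n≡m i≤D)
      difference : ∀ k {a b} → k ℕ.+ b ≡ a → + k ≡ + a ℤ.- + b
      difference k {b = b} refl = trans
        (solve 2 (λ k b → k := k :+ b :- b) refl (+ k) (+ b))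
        (cong (ℤ._- + b) (sym (ℤₚ.pos-+ k b)))
        where open ℤSolver.+-*-Solver

  lowest-at : (i : Fin (suc (n ℕ.* d))) → ∃[ k ] + k ≡ c n d (toℕ i) × Basis (Lowest (toℕ i)) k
  lowest-at i = lowest (toℕ i) (Finₚ.toℕ≤pred[n] i)

  weightData : WeightData (Λ n d) (n ℕ.* d)
  weightData = record
    { bounded₋ = λ {N} {f} → bounded₋ {N} {f}
    ; bounded₊ = λ {N} {f} → bounded₊ {N} {f}
    ; weight-sum = weight-sum
    ; mult = λ i → proj₁ (lowest-at i)
    ; lowest = λ i → proj₂ (proj₂ (lowest-at i)) }

  mult-c : ∀ i → + WeightData.mult weightData i ≡ c n d (toℕ i)
  mult-c i = proj₁ (proj₂ (lowest-at i))

  open Decomposition (Λ n d) (n ℕ.* d) weightData public using (decomposition)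

open import Data.Nat using (_+_; _*_)

theorem5 : (n d : ℕ) → n ≥ 1 → d ≥ 1 →
    (Σ[ mult ∈ (Fin (suc (n * d)) → ℕ) ]
    ((i : Fin (suc (n * d))) → + mult i ≡ c n d (toℕ i))
    × (Λ n d ≅ ⨁ (λ i → mult i · V (toℕ i))))
    × ((j : ℕ) → ∃[ N ] (γ (d + n) n (fromℕ j) ≡ + N) × (Fin N ↔ PartitionInRectangle d n j))
theorem5 n d _ _ = (WeightData.mult P.weightData , P.mult-c , P.decomposition) , λ j →
  count d n j , trans (γ-count n d j) (cong +_ (count-comm n d j)) , count-↔ d n j
  where module P = LowestWeights n d
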